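{- There exist constants $c_1, c_2 \in \mathbb{N}$ and absolute constants hidden in the $O(\cdot),\Omega(\cdot)$ below such that for every $\epsilon \in (0,1]$, every $d \in \mathbb{N}$ and every finite field $\mathbb{F}$ of size $q$ and characteristic $p$ with $q > c_1 \cdot d/\epsilon^{c_2}$, the following holds. Let $f\colon \mathbb{F}^2 \to \mathbb{F}$ be an oracle that passes $\mathrm{LDT}_d$ with probability at least $\epsilon$. Then there is a non-zero polynomial $A(x,y,z) \in \mathbb{F}[x,y,z]$ and a subset $S \subseteq \mathbb{F}^2$ such that <ul> <li>$\deg_{1,1,d}(A) = O(d/\epsilon^2)$ and $|S| = \Omega(\epsilon^2 q^2)$;</li> <li>$\sum_{x \in S} \epsilon_x = \Omega(\epsilon^3 q^2)$;</li> <li>for every $(a,b) \in S$, $\epsilon_{(a,b)} \geq \epsilon/2$;</li> <li>for every $(a,b) \in S$, $A(a,b,f(a,b)) = 0$;</li> <li>the Hasse derivative $\bar\partial_z(A)$ and the discriminant $\mathsf{Disc}_z(A)$ are not identically zero.</li> </ul>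
   Context: For a line $\ell$ in $\mathbb{F}^2$, $P_\ell$ is a best-fit degree-$d$ polynomial for $f$ on $\ell$ (a degree-$\le d$ univariate polynomial in a parametrization of $\ell$ maximizing agreement with $f$ on $\ell$, ties broken arbitrarily). $\mathrm{LDT}_d$ picks a uniform point $a\in\mathbb{F}^2$ and a uniform line $\ell\ni a$ and accepts iff $P_\ell(a)=f(a)$. For $x\in\mathbb{F}^2$, $\epsilon_x := \Pr_{\ell\ni x}[P_\ell(x)=f(x)]$ over a uniform line $\ell$ through $x$. $\deg_{1,1,d}$ is the weighted degree: the maximum of $i+j+dk$ over monomials $x^iy^jz^k$ in the support. The Hasse derivative $\bar\partial_z(A)$ is the coefficient of $w^1$ in $A(x,y,z+w)$ viewed as a polynomial in $w$. $\mathsf{Disc}_z(A)$ is the resultant (determinant of the Sylvester matrix) of $A$ and $\bar\partial_z(A)$, viewed as polynomials in $z$ with coefficients in $\mathbb{F}[x,y]$. -}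

module Defs where

open import Data.Bool using (Bool; true; false; if_then_else_; T; _∧_)
open import Data.Nat as ℕ using (ℕ; zero; suc; _⊔_; _∸_; _≤ᵇ_; _<ᵇ_)
open import Data.Nat.Base using (pred)
open import Data.Fin using (Fin; toℕ; punchIn)
import Data.Fin as Fin
open import Data.Integer using (+_)
open import Data.Rational as ℚ using (ℚ; _/_; 0ℚ; 1ℚ)
open import Data.List using (List; []; _∷_; map; length; filter; filterᵇ; cartesianProduct; foldr)
open import Data.List.Membership.Propositional using (_∈_)
open import Data.List.Relation.Unary.All using (All)
open import Data.List.Relation.Unary.All as All using (all?)
open import Data.List.Relation.Unary.Unique.Propositional using (Unique)
open import Data.Vec using (Vec)
import Data.Vec as Vec
open import Data.Product using (_×_; _,_; ∃)
open import Relation.Nullary using (¬_; Dec; yes; no; does)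
open import Relation.Binary.Definitions using (DecidableEquality)
open import Relation.Binary.PropositionalEquality using (_≡_)
open import Algebra.Structures using (IsCommutativeRing)

ℕtoℚ : ℕ → ℚ
ℕtoℚ n = + n / 1

_^ℚ_ : ℚ → ℕ → ℚ
x ^ℚ zero  = 1ℚ
x ^ℚ suc n = x ℚ.* (x ^ℚ n)

sumℚ : List ℚ → ℚ
sumℚ = foldr ℚ._+_ 0ℚ

record FiniteField : Set₁ where
  infixl 6 _+_
  infixl 7 _*_
  field
    Carrier    : Set
    _+_ _*_    : Carrier → Carrier → Carrier
    -_         : Carrier → Carrier
    0# 1#      : Carrier
    isCommutativeRing : IsCommutativeRing _≡_ _+_ _*_ -_ 0# 1#
    0≢1        : ¬ (0# ≡ 1#)
    inverse    : ∀ x → ¬ (x ≡ 0#) → ∃ λ y → x * y ≡ 1#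
    _≟_        : DecidableEquality Carrier
    elements   : List Carrier
    complete   : ∀ x → x ∈ elements
    unique     : Unique elements

module FF (F : FiniteField) where
  open FiniteField F

  size : ℕ
  size = length elements

  Point : Set
  Point = Carrier × Carrier

  points : List Point
  points = cartesianProduct elements elements

  ℕ→F : ℕ → Carrier
  ℕ→F zero    = 0#
  ℕ→F (suc n) = 1# + ℕ→F n

  horner : List Carrier → Carrier → Carrier
  horner []       t = 0#
  horner (c ∷ cs) t = c + t * horner cs t

  UPoly : ℕ → Set
  UPoly d = Vec Carrier (suc d)

  evalU : ∀ {d} → UPoly d → Carrier → Carrier
  evalU p t = horner (Vec.toList p) t

  -- Lines of F², each represented exactly once:
  --   slope m b  = { (t , m t + b) : t ∈ F }
  --   vert  c    = { (c , t)       : t ∈ F }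
  -- with the indicated parametrization t ↦ param ℓ t.

  data Line : Set where
    slope : Carrier → Carrier → Line
    vert  : Carrier → Line

  param : Line → Carrier → Point
  param (slope m b) t = t , m * t + b
  param (vert c)    t = c , t

  -- the parameter of a point lying on the line
  paramOf : Line → Point → Carrier
  paramOf (slope m b) (a₁ , a₂) = a₁
  paramOf (vert c)    (a₁ , a₂) = a₂

  linesThrough : Point → List Line
  linesThrough (a₁ , a₂) = vert a₁ ∷ map (λ m → slope m (a₂ + - (m * a₁))) elements

  agreement : ∀ {d} → (Point → Carrier) → Line → UPoly d → ℕ
  agreement f ℓ P = length (filter (λ t → evalU P t ≟ f (param ℓ t)) elements)

  IsBestFit : (d : ℕ) → (Point → Carrier) → Line → UPoly d → Set
  IsBestFit d f ℓ P = ∀ (Q : UPoly d) → agreement f ℓ Q ℕ.≤ agreement f ℓ P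

  -- ε_x = Pr_{ℓ ∋ x}[P_ℓ(x) = f(x)], uniform over the q+1 lines through x
  goodLines : ∀ {d} → (Line → UPoly d) → (Point → Carrier) → Point → ℕ
  goodLines P f x =
    length (filter (λ ℓ → evalU (P ℓ) (paramOf ℓ x) ≟ f x) (linesThrough x))

  epsAt : ∀ {d} → (Line → UPoly d) → (Point → Carrier) → Point → ℚ
  epsAt P f x = + goodLines P f x / suc size

  -- Pr[LDT_d accepts] = (1/q²) Σ_a ε_a ; "passes with probability ≥ ε"
  -- is stated with the denominator q² cleared.
  PassesLDT : ∀ {d} → (Line → UPoly d) → (Point → Carrier) → ℚ → Set
  PassesLDT P f ε = ε ℚ.* ℕtoℚ (size ℕ.* size) ℚ.≤ sumℚ (map (epsAt P f) points)

  -- Multivariate polynomials as nested coefficient lists.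
  -- Poly1 = F[y], Poly2 = F[x][y] = F[x,y], Poly3 = F[x,y][z]:
  -- a Poly3 is the list (A₀, A₁, …) with A = Σ_k A_k(x,y) z^k,
  -- and a Poly2 is the list (B₀, B₁, …) with B = Σ_i B_i(y) x^i.

  Poly1 Poly2 Poly3 : Set
  Poly1 = List Carrier
  Poly2 = List Poly1
  Poly3 = List Poly2

  IsZero1 : Poly1 → Set
  IsZero1 = All (_≡ 0#)
  IsZero2 : Poly2 → Set
  IsZero2 = All IsZero1
  IsZero3 : Poly3 → Set
  IsZero3 = All IsZero2

  isZero1? : (p : Poly1) → Dec (IsZero1 p)
  isZero1? = all? (λ c → c ≟ 0#)
  isZero2? : (p : Poly2) → Dec (IsZero2 p)
  isZero2? = all? isZero1?

  module ListPoly {A : Set} (z : A) (add mul : A → A → A) (neg : A → A) where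
    addP : List A → List A → List A
    addP []       ys       = ys
    addP (x ∷ xs) []       = x ∷ xs
    addP (x ∷ xs) (y ∷ ys) = add x y ∷ addP xs ys
    negP : List A → List A
    negP = map neg
    mulP : List A → List A → List A
    mulP []       ys = []
    mulP (x ∷ xs) ys = addP (map (mul x) ys) (z ∷ mulP xs ys)

  module P1 = ListPoly 0# _+_ _*_ -_
  module P2 = ListPoly [] P1.addP P1.mulP P1.negP

  one2 : Poly2
  one2 = (1# ∷ []) ∷ []

  eval2 : Poly2 → Carrier → Carrier → Carrier
  eval2 B a b = horner (map (λ p → horner p b) B) a

  eval3 : Poly3 → Carrier → Carrier → Carrier → Carrier
  eval3 A a b c = horner (map (λ B → eval2 B a b) A) c

  -- weighted degree deg_{1,1,d}: max of i + j + d·k over the support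
  -- (taken to be 0 for the zero polynomial)
  wdeg1 : ℕ → ℕ → Poly1 → ℕ
  wdeg1 base j []       = 0
  wdeg1 base j (c ∷ cs) = (if does (c ≟ 0#) then 0 else base ℕ.+ j) ⊔ wdeg1 base (suc j) cs

  wdeg2 : ℕ → ℕ → Poly2 → ℕ
  wdeg2 base i []       = 0
  wdeg2 base i (p ∷ ps) = wdeg1 (base ℕ.+ i) 0 p ⊔ wdeg2 base (suc i) ps

  wdeg3 : ℕ → ℕ → Poly3 → ℕ
  wdeg3 d k []       = 0
  wdeg3 d k (B ∷ Bs) = wdeg2 (d ℕ.* k) 0 B ⊔ wdeg3 d (suc k) Bs

  deg₁₁ : ℕ → Poly3 → ℕ
  deg₁₁ d A = wdeg3 d 0 A

  -- Hasse derivative in z: coefficient of w¹ in A(x,y,z+w),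
  -- i.e. Σ_k (k choose 1) A_k z^{k-1}
  hasseGo : ℕ → Poly3 → Poly3
  hasseGo n []       = []
  hasseGo n (B ∷ Bs) = map (map (ℕ→F n *_)) B ∷ hasseGo (suc n) Bs

  hasseZ : Poly3 → Poly3
  hasseZ []       = []
  hasseZ (B ∷ Bs) = hasseGo 1 Bs

  stripZ : Poly3 → Poly3
  stripZ []       = []
  stripZ (B ∷ Bs) with stripZ Bs
  ... | []     = if does (isZero2? B) then [] else B ∷ []
  ... | r ∷ rs = B ∷ r ∷ rs

  degZ : Poly3 → ℕ
  degZ A = pred (length (stripZ A))

  coeffZ : Poly3 → ℕ → Poly2
  coeffZ []       k       = []
  coeffZ (B ∷ Bs) zero    = B
  coeffZ (B ∷ Bs) (suc k) = coeffZ Bs k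

  -- Sylvester matrix of A (z-degree m) and B (z-degree n), size m+n:
  -- rows 0..n-1 hold the shifted coefficients a_m … a_0 of A,
  -- rows n..n+m-1 the shifted coefficients b_n … b_0 of B.
  sylEntry : Poly3 → ℕ → ℕ → ℕ → Poly2
  sylEntry P deg i j =
    if (i ≤ᵇ j) ∧ ((j ∸ i) ≤ᵇ deg) then coeffZ P (deg ∸ (j ∸ i)) else []

  sylvester : (A B : Poly3) → Fin (degZ A ℕ.+ degZ B) → Fin (degZ A ℕ.+ degZ B) → Poly2
  sylvester A B r c =
    if toℕ r <ᵇ degZ B
      then sylEntry A (degZ A) (toℕ r) (toℕ c)
      else sylEntry B (degZ B) (toℕ r ∸ degZ B) (toℕ c)

  sumFin : ∀ n → (Fin n → Poly2) → Poly2
  sumFin zero    g = []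
  sumFin (suc n) g = P2.addP (g Fin.zero) (sumFin n (λ j → g (Fin.suc j)))

  signed : ℕ → Poly2 → Poly2
  signed zero          p = p
  signed (suc zero)    p = P2.negP p
  signed (suc (suc n)) p = signed n p

  det : ∀ n → (Fin n → Fin n → Poly2) → Poly2
  det zero    M = one2
  det (suc n) M = sumFin (suc n) λ j →
    signed (toℕ j) (P2.mulP (M Fin.zero j) (det n (λ r c → M (Fin.suc r) (punchIn j c))))

  resultantZ : Poly3 → Poly3 → Poly2
  resultantZ A B = det (degZ A ℕ.+ degZ B) (sylvester A B)

  DiscZ : Poly3 → Poly2
  DiscZ A = resultantZ A (hasseZ A)

  Subset : Set
  Subset = Point → Bool

  card : Subset → ℕ
  card S = length (filterᵇ S points)

  sumOver : Subset → (Point → ℚ) → ℚ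
  sumOver S g = sumℚ (map g (filterᵇ S points))

{-# OPTIONS --safe #-}

-- The polynomial is A = z − Q(x,y), where Q is a single polynomial of degree O(d) that agrees with f
-- on Ω(ε²q²) points x with ε_x ≥ ε/2; its z-derivative and its discriminant are then constants.
--
-- To find Q, delete points with few accepting lines and lines with few accepted points until every
-- surviving point x has at least an ε/2 fraction of good lines and every surviving line is good at Ω(εq)
-- surviving points.  Interpolate B(x,y,z) of low degree vanishing on the graphs of P_ℓ for O(d/ε⁴) lines ℓ
-- through one surviving point; another line meets them in distinct points, so B vanishes on the graph of
-- P_ℓ for Ω(ε²q²) lines ℓ.  Passing from B to ∂B/∂z, or from B(x,y,z^p) to B(x,y,z), lowers the z-degree
-- O(1/ε²) times at most, so some step produces many lines on which B(x,y,P_ℓⁿ) = 0 but ∂B/∂z does not vanish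
-- identically (n a power of the characteristic).  A point lying on many such lines is a simple root there,
-- and Hensel lifting gives a polynomial Q̃ with Q̃ = P_ℓⁿ on all of them at once.  Counting again, Q̃ = P_ℓⁿ on
-- many lines in two directions, which forces Q̃ = Qⁿ, and Q agrees with P_ℓ for an Ω(ε) fraction of the
-- lines through some surviving point.
--
-- For d = 0 (where the field may be small) the constant Q = f(x) works for any surviving x, and for
-- q = O(1/ε) a single point is enough.
module Submission where

-- No lower bound on the characteristic is assumed, so ∂B/∂z may vanish identically although B
-- depends on z. A power n of the characteristic must then be carried along; lifting yields only an
-- n-th power, whose root has to be taken at the end. Factorisation is avoided: B only steers a
-- Newton iteration, and A is built afresh, so no discriminant of B is ever considered. Polynomials
-- are functions with a degree bound. A function determines its coefficients only when the degree is
-- below q, and this is where the size of the field is used besides counting. Lines are given by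
-- slope and intercept. The vertical ones are left out, at the cost of one line per point, so that
-- points and lines are both pairs of field elements and acceptance is a relation between them. The
-- exponent 9 arises as follows. With E proportional to 1/ε, the core has minimal degree w about
-- q/E, the number u of lines through the centre of the lifting is about w/E⁴, and the counting for
-- the lifted polynomial needs u to exceed a multiple of d·E⁴.

open import Defs


-- Finite sums of indicators and double counting.

module FiniteSums where

  open import Data.Nat
  open import Data.Nat.Properties
  open import Data.Nat.Solver using (module +-*-Solver)
  open import Data.List using (List; []; _∷_; map; length; take; filter; cartesianProduct; _++_)
  open import Data.List.Properties using (map-++; map-∘)
  open import Data.Nat.ListAction using (sum)
  open import Data.Nat.ListAction.Properties using (sum-++)
  open import Data.List.Membership.Propositional using (_∈_)
  open import Data.List.Relation.Unary.Any using (here; there)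
  open import Data.List.Relation.Unary.All using (All; []; _∷_)
  import Data.List.Relation.Unary.All as All
  open import Data.List.Relation.Unary.AllPairs using ([]; _∷_)
  open import Data.List.Relation.Unary.Unique.Propositional using (Unique)
  open import Data.Product using (∃; _×_; _,_; proj₂)
  open import Data.Empty using (⊥-elim)
  open import Relation.Nullary using (¬_; Dec; yes; no; _×-dec_; ¬?)
  open import Relation.Binary.Definitions using (DecidableEquality)
  open import Relation.Binary.PropositionalEquality hiding ([_])

  private variable
    A B : Set
    P Q : Set

  -- Cardinalities are sums of these values over a fixed list, so that double counting is `∑-swap`
  -- and inclusion of sets is a pointwise implication (`[]-mono`).
  [_] : Dec P → ℕ
  [ yes _ ] = 1
  [ no  _ ] = 0

  []≤1 : (d : Dec P) → [ d ] ≤ 1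
  []≤1 (yes _) = ≤-refl
  []≤1 (no  _) = z≤n

  []-mono : (d : Dec P) (d′ : Dec Q) → (P → Q) → [ d ] ≤ [ d′ ]
  []-mono (no _)  _        _ = z≤n
  []-mono (yes _) (yes _)  _ = ≤-refl
  []-mono (yes p) (no ¬q)  h = ⊥-elim (¬q (h p))

  []-yes : (d : Dec P) → P → [ d ] ≡ 1
  []-yes (yes _) _ = refl
  []-yes (no ¬p) p = ⊥-elim (¬p p)

  []-no : (d : Dec P) → ¬ P → [ d ] ≡ 0
  []-no (yes p) ¬p = ⊥-elim (¬p p)
  []-no (no _)  _  = refl

  []-pos : (d : Dec P) → 0 < [ d ] → P
  []-pos (yes p) _ = p

  []-≤ : ∀ {n} (d : Dec P) → (P → 1 ≤ n) → [ d ] ≤ n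
  []-≤ (yes p) h = h p
  []-≤ (no _)  _ = z≤n

  []*-≤ : ∀ {m n} (d : Dec P) → (P → m ≤ n) → [ d ] * m ≤ n
  []*-≤ {m = m} (yes p) h = ≤-trans (≤-reflexive (+-identityʳ m)) (h p)
  []*-≤ (no _)  _ = z≤n

  ∑ : List A → (A → ℕ) → ℕ
  ∑ xs f = sum (map f xs)

  module _ {f g : A → ℕ} where
    ∑-mono-∈ : ∀ xs → (∀ {x} → x ∈ xs → f x ≤ g x) → ∑ xs f ≤ ∑ xs g
    ∑-mono-∈ []       h = z≤n
    ∑-mono-∈ (x ∷ xs) h = +-mono-≤ (h (here refl)) (∑-mono-∈ xs (λ p → h (there p)))

    ∑-mono : ∀ xs → (∀ x → f x ≤ g x) → ∑ xs f ≤ ∑ xs g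
    ∑-mono xs h = ∑-mono-∈ xs (λ {x} _ → h x)

    ∑-cong : ∀ xs → (∀ x → f x ≡ g x) → ∑ xs f ≡ ∑ xs g
    ∑-cong []       h = refl
    ∑-cong (x ∷ xs) h = cong₂ _+_ (h x) (∑-cong xs h)

    ∑-+ : ∀ xs → ∑ xs (λ x → f x + g x) ≡ ∑ xs f + ∑ xs g
    ∑-+ []       = refl
    ∑-+ (x ∷ xs) = trans (cong ((f x + g x) +_) (∑-+ xs))
      (+-*-Solver.solve 4 (λ a b c d → (a :+ b) :+ (c :+ d) := (a :+ c) :+ (b :+ d)) refl
        (f x) (g x) (∑ xs f) (∑ xs g))
      where open +-*-Solver

  ∑-*ˡ : ∀ c (f : A → ℕ) xs → ∑ xs (λ x → c * f x) ≡ c * ∑ xs f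
  ∑-*ˡ c f []       = sym (*-zeroʳ c)
  ∑-*ˡ c f (x ∷ xs) = trans (cong (c * f x +_) (∑-*ˡ c f xs)) (sym (*-distribˡ-+ c (f x) _))

  ∑-*ʳ : ∀ c (f : A → ℕ) xs → ∑ xs (λ x → f x * c) ≡ ∑ xs f * c
  ∑-*ʳ c f xs = trans (∑-cong xs (λ x → *-comm (f x) c)) (trans (∑-*ˡ c f xs) (*-comm c _))

  ∑-const : ∀ c (xs : List A) → ∑ xs (λ _ → c) ≡ length xs * c
  ∑-const c []       = refl
  ∑-const c (x ∷ xs) = cong (c +_) (∑-const c xs)

  ∑-0 : (xs : List A) → ∑ xs (λ _ → 0) ≡ 0
  ∑-0 []       = refl
  ∑-0 (x ∷ xs) = ∑-0 xs

  ∑-swap : ∀ (f : A → B → ℕ) xs ys →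
           ∑ xs (λ x → ∑ ys (f x)) ≡ ∑ ys (λ y → ∑ xs (λ x → f x y))
  ∑-swap f []       ys = sym (∑-0 ys)
  ∑-swap f (x ∷ xs) ys = trans (cong (∑ ys (f x) +_) (∑-swap f xs ys)) (sym (∑-+ ys))

  ∑-≤-* : ∀ {c} (f : A → ℕ) xs → (∀ x → f x ≤ c) → ∑ xs f ≤ length xs * c
  ∑-≤-* {c = c} f xs h = ≤-trans (∑-mono xs h) (≤-reflexive (∑-const c xs))

  ∑-∈ : ∀ (f : A → ℕ) {xs a} → a ∈ xs → f a ≤ ∑ xs f
  ∑-∈ f {x ∷ xs} (here refl) = m≤m+n (f x) _
  ∑-∈ f {x ∷ xs} (there p)   = ≤-trans (∑-∈ f p) (m≤n+m _ (f x))

  ∑-++ : ∀ (f : A → ℕ) xs ys → ∑ (xs ++ ys) f ≡ ∑ xs f + ∑ ys f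
  ∑-++ f xs ys = trans (cong sum (map-++ f xs ys)) (sum-++ (map f xs) (map f ys))

  ∑-× : ∀ (f : A × B → ℕ) xs ys → ∑ (cartesianProduct xs ys) f ≡ ∑ xs (λ x → ∑ ys (λ y → f (x , y)))
  ∑-× f []       ys = refl
  ∑-× f (x ∷ xs) ys = trans (∑-++ f (map (x ,_) ys) _)
    (cong₂ _+_ (cong sum (sym (map-∘ ys))) (∑-× f xs ys))

  ∑-take : ∀ (f : A → ℕ) n xs → ∑ (take n xs) f ≤ ∑ xs f
  ∑-take f zero    xs       = z≤n
  ∑-take f (suc n) []       = z≤n
  ∑-take f (suc n) (x ∷ xs) = +-monoʳ-≤ (f x) (∑-take f n xs)

  pigeonhole : ∀ (f : A → ℕ) xs c → length xs * c < ∑ xs f → ∃ λ x → x ∈ xs × c < f x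
  pigeonhole f (x ∷ xs) c h with c <? f x
  ... | yes p = x , here refl , p
  ... | no ¬p with pigeonhole f xs c
                    (+-cancelˡ-< c _ _ (<-≤-trans h (+-monoˡ-≤ _ (≮⇒≥ ¬p))))
  ...   | y , m , q = y , there m , q

  ∑-pos : ∀ (f : A → ℕ) xs → 0 < ∑ xs f → ∃ λ x → x ∈ xs × 0 < f x
  ∑-pos f xs h = pigeonhole f xs 0 (subst (_< ∑ xs f) (sym (*-zeroʳ (length xs))) h)

  module _ {P : A → Set} (P? : ∀ x → Dec (P x)) where

    ∑-filter : ∀ xs → length (filter P? xs) ≡ ∑ xs (λ x → [ P? x ])
    ∑-filter []       = refl
    ∑-filter (x ∷ xs) with P? x
    ... | yes _ = cong suc (∑-filter xs)
    ... | no _  = ∑-filter xs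

    ∑-none : ∀ xs → All (λ x → ¬ P x) xs → ∑ xs (λ x → [ P? x ]) ≡ 0
    ∑-none []       []       = refl
    ∑-none (x ∷ xs) (p ∷ ps) = cong₂ _+_ ([]-no (P? x) p) (∑-none xs ps)

    ∑-all : ∀ xs → (∀ {x} → x ∈ xs → P x) → ∑ xs (λ x → [ P? x ]) ≡ length xs
    ∑-all []       h = refl
    ∑-all (x ∷ xs) h = cong₂ _+_ ([]-yes (P? x) (h (here refl))) (∑-all xs (λ p → h (there p)))

    at-most-one-∈ : ∀ {xs} → Unique xs → (∀ {x y} → x ∈ xs → y ∈ xs → P x → P y → x ≡ y) → ∑ xs (λ x → [ P? x ]) ≤ 1
    at-most-one-∈ {[]}     []      h = z≤n
    at-most-one-∈ {x ∷ xs} (n ∷ u) h with P? x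
    ... | no _  = at-most-one-∈ u (λ p q → h (there p) (there q))
    ... | yes p = ≤-reflexive (cong suc (∑-none xs (All.tabulate λ m q → All.lookup n m (h (here refl) (there m) p q))))

    at-most-one : ∀ {xs} → Unique xs → (∀ {x y} → P x → P y → x ≡ y) → ∑ xs (λ x → [ P? x ]) ≤ 1
    at-most-one u h = at-most-one-∈ u (λ _ _ → h)

    count-split : ∀ {Q : A → Set} (Q? : ∀ x → Dec (Q x)) xs →
                  ∑ xs (λ x → [ P? x ]) ≤ ∑ xs (λ x → [ P? x ×-dec ¬? (Q? x) ]) + ∑ xs (λ x → [ P? x ×-dec Q? x ])
    count-split Q? xs = ≤-trans (∑-mono xs pt) (≤-reflexive (∑-+ xs))
      where
      pt : ∀ x → [ P? x ] ≤ [ P? x ×-dec ¬? (Q? x) ] + [ P? x ×-dec Q? x ]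
      pt x with P? x | Q? x
      ... | no _  | _     = z≤n
      ... | yes _ | yes _ = ≤-refl
      ... | yes _ | no _  = ≤-refl

  -- Only one entry of a list without repetitions can be `a`. Used to discard the centre of a
  -- pencil, the line just travelled, or the parameter 0.
  count-remove : {P : A → Set} (P? : ∀ x → Dec (P x)) (_≟_ : DecidableEquality A) → ∀ {xs} → Unique xs → ∀ a →
                 ∑ xs (λ x → [ P? x ]) ≤ suc (∑ xs (λ x → [ P? x ×-dec ¬? (x ≟ a) ]))
  count-remove P? _≟_ {xs} u a = begin
    ∑ xs (λ x → [ P? x ])                            ≤⟨ count-split P? (_≟ a) xs ⟩
    rest + ∑ xs (λ x → [ P? x ×-dec (x ≟ a) ])       ≤⟨ +-monoʳ-≤ rest (∑-mono xs λ x → []-mono (P? x ×-dec (x ≟ a)) (x ≟ a) proj₂) ⟩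
    rest + ∑ xs (λ x → [ x ≟ a ])                    ≤⟨ +-monoʳ-≤ rest (at-most-one (_≟ a) u λ p q → trans p (sym q)) ⟩
    rest + 1                                         ≡⟨ +-comm rest 1 ⟩
    suc rest                                         ∎
    where
    open ≤-Reasoning
    rest = ∑ xs (λ x → [ P? x ×-dec ¬? (x ≟ a) ])

-- Incidence graphs: dense cores, pencils and averaging.

module Incidences where

  open FiniteSums
  open import Data.Bool using (Bool; T; not; _∧_)
  open import Data.Bool.Properties using (T?; T-∧)
  open import Data.Nat
  open import Data.Nat.Properties
  open import Data.Nat.Solver using (module +-*-Solver)
  open import Data.List using (List; length)
  open import Data.List.Membership.Propositional using (_∈_; find; lose)
  open import Data.List.Relation.Unary.Any using (any?)
  import Data.List.Relation.Unary.All as All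
  open import Data.List.Relation.Unary.Unique.Propositional using (Unique)
  open import Data.Product using (∃; _×_; _,_; proj₁; proj₂)
  open import Data.Empty using (⊥-elim)
  open import Function using (flip; _∘_; Equivalence)
  open import Relation.Nullary using (¬_; Dec; yes; no; does; _×-dec_; ¬?)
  open import Relation.Nullary.Decidable using (dec-true; dec-false)
  open import Relation.Binary.Definitions using (DecidableEquality)
  open import Relation.Binary.PropositionalEquality hiding ([_])
  open ≤-Reasoning

  private variable
    A B : Set

  deg : List B → (A → B → Bool) → A → ℕ
  deg ys e x = ∑ ys (λ y → [ T? (e x y) ])

  -- `1 ⊓ deg` is the indicator of a positive degree: this counts the vertices that still carry an
  -- edge, and it is what each deletion lowers.
  supp : List A → List B → (A → B → Bool) → ℕ
  supp xs ys e = ∑ xs (λ x → 1 ⊓ deg ys e x)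

  edges : List A → List B → (A → B → Bool) → ℕ
  edges xs ys e = ∑ xs (deg ys e)

  edges-flip : ∀ xs ys (e : A → B → Bool) → edges ys xs (flip e) ≡ edges xs ys e
  edges-flip xs ys e = ∑-swap (λ y x → [ T? (e x y) ]) ys xs

  _⊑_ : (A → B → Bool) → (A → B → Bool) → Set
  e′ ⊑ e = ∀ x y → T (e′ x y) → T (e x y)

  supp-mono : ∀ xs ys {e′ e : A → B → Bool} → e′ ⊑ e → supp xs ys e′ ≤ supp xs ys e
  supp-mono xs ys sub = ∑-mono xs λ x → ⊓-monoʳ-≤ 1 (∑-mono ys λ y → []-mono (T? _) (T? _) (sub x y))

  module _ (_≟_ : DecidableEquality A) (xs : List A) (ys : List B) (uxs : Unique xs)
           (e : A → B → Bool) (a : A) (a∈ : a ∈ xs) (a>0 : 0 < deg ys e a) where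

    dropPoint : A → B → Bool
    dropPoint x y = e x y ∧ not (does (x ≟ a))

    dropPoint-⊑ : dropPoint ⊑ e
    dropPoint-⊑ x y t = proj₁ (Equivalence.to T-∧ t)

    private
      keep : ∀ x (x≟a : Dec (x ≡ a)) → deg ys e x ≤ deg ys dropPoint x + [ x≟a ] * deg ys e a
      keep x (yes refl) = ≤-trans (≤-reflexive (sym (+-identityʳ (deg ys e x)))) (m≤n+m (1 * deg ys e x) (deg ys dropPoint x))
      keep x (no x≢a)   = ≤-trans (∑-mono ys λ y → []-mono (T? (e x y)) (T? (dropPoint x y))
        λ t → Equivalence.from T-∧ (t , subst (T ∘ not) (sym (dec-false (x ≟ a) x≢a)) _)) (m≤m+n (deg ys dropPoint x) _)

      gone : deg ys dropPoint a ≡ 0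
      gone = trans (∑-cong ys λ y → []-no (T? _) λ t →
        subst (T ∘ not) (dec-true (a ≟ a) refl) (proj₂ (Equivalence.to T-∧ t))) (∑-0 ys)

      lose1 : ∀ x (x≟a : Dec (x ≡ a)) → [ x≟a ] + 1 ⊓ deg ys dropPoint x ≤ 1 ⊓ deg ys e x
      lose1 x (yes refl) = ≤-trans (≤-reflexive (cong (λ z → 1 + 1 ⊓ z) gone)) (⊓-glb ≤-refl a>0)
      lose1 x (no _)     = ⊓-monoʳ-≤ 1 (∑-mono ys λ y → []-mono (T? _) (T? _) (dropPoint-⊑ x y))

    dropPoint-edges : edges xs ys e ≤ edges xs ys dropPoint + deg ys e a
    dropPoint-edges = begin
      edges xs ys e                                                  ≤⟨ ∑-mono xs (λ x → keep x (x ≟ a)) ⟩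
      ∑ xs (λ x → deg ys dropPoint x + [ x ≟ a ] * deg ys e a)       ≡⟨ ∑-+ xs ⟩
      edges xs ys dropPoint + ∑ xs (λ x → [ x ≟ a ] * deg ys e a)     ≡⟨ cong (edges xs ys dropPoint +_) (∑-*ʳ (deg ys e a) _ xs) ⟩
      edges xs ys dropPoint + ∑ xs (λ x → [ x ≟ a ]) * deg ys e a     ≤⟨ +-monoʳ-≤ (edges xs ys dropPoint)
                                                                         (*-monoˡ-≤ (deg ys e a) (at-most-one (_≟ a) uxs λ p q → trans p (sym q))) ⟩
      edges xs ys dropPoint + 1 * deg ys e a                          ≡⟨ cong (edges xs ys dropPoint +_) (*-identityˡ _) ⟩
      edges xs ys dropPoint + deg ys e a                              ∎

    dropPoint-supp : suc (supp xs ys dropPoint) ≤ supp xs ys e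
    dropPoint-supp = begin
      1 + supp xs ys dropPoint                                   ≡⟨ cong (_+ supp xs ys dropPoint) ([]-yes (a ≟ a) refl) ⟨
      [ a ≟ a ] + supp xs ys dropPoint                           ≤⟨ +-monoˡ-≤ _ (∑-∈ (λ x → [ x ≟ a ]) a∈) ⟩
      ∑ xs (λ x → [ x ≟ a ]) + supp xs ys dropPoint              ≡⟨ ∑-+ xs ⟨
      ∑ xs (λ x → [ x ≟ a ] + 1 ⊓ deg ys dropPoint x)            ≤⟨ ∑-mono xs (λ x → lose1 x (x ≟ a)) ⟩
      supp xs ys e                                               ∎

    -- Removing a vertex of small weighted degree keeps the potential κ·|e| − α·|points| − β·|lines| positive.
    dropPoint-potential : ∀ α β κ → κ * deg ys e a < α →
      α * supp xs ys e + β * supp ys xs (flip e) < κ * edges xs ys e →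
      α * supp xs ys dropPoint + β * supp ys xs (flip dropPoint) < κ * edges xs ys dropPoint
    dropPoint-potential α β κ small inv = +-cancelʳ-< α _ _ (begin-strict
      α * supp xs ys dropPoint + β * supp ys xs (flip dropPoint) + α
        ≡⟨ solve 4 (λ a s b t → a :* s :+ b :* t :+ a := a :* (con 1 :+ s) :+ b :* t) refl α (supp xs ys dropPoint) β (supp ys xs (flip dropPoint)) ⟩
      α * suc (supp xs ys dropPoint) + β * supp ys xs (flip dropPoint)
        ≤⟨ +-mono-≤ (*-monoʳ-≤ α dropPoint-supp) (*-monoʳ-≤ β (supp-mono ys xs λ y x → dropPoint-⊑ x y)) ⟩
      α * supp xs ys e + β * supp ys xs (flip e)
        <⟨ inv ⟩
      κ * edges xs ys e
        ≤⟨ *-monoʳ-≤ κ dropPoint-edges ⟩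
      κ * (edges xs ys dropPoint + deg ys e a)
        ≡⟨ *-distribˡ-+ κ (edges xs ys dropPoint) _ ⟩
      κ * edges xs ys dropPoint + κ * deg ys e a
        ≤⟨ +-monoʳ-≤ (κ * edges xs ys dropPoint) (<⇒≤ small) ⟩
      κ * edges xs ys dropPoint + α ∎)
      where open +-*-Solver

  module _ (_≟A_ : DecidableEquality A) (_≟B_ : DecidableEquality B)
           (xs : List A) (ys : List B) (uxs : Unique xs) (uys : Unique ys)
           (cxs : ∀ x → x ∈ xs) (cys : ∀ y → y ∈ ys) (α β κ : ℕ) where

    IsCore : (A → B → Bool) → Set
    IsCore e = (∀ x y → T (e x y) → α ≤ κ * deg ys e x × β ≤ κ * deg xs (flip e) y)
               × ∃ λ x → ∃ λ y → T (e x y)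

    private
      pos : ∀ {C D : Set} {zs : List D} (e : C → D → Bool) x {z} → z ∈ zs → T (e x z) → 0 < deg zs e x
      pos e x z∈ t = ≤-trans (≤-reflexive (sym ([]-yes (T? _) t))) (∑-∈ (λ z → [ T? (e x z) ]) z∈)

      low? : ∀ {C D : Set} (zs : List D) (e : C → D → Bool) γ x → Dec (0 < deg zs e x × κ * deg zs e x < γ)
      low? zs e γ x = (0 <? deg zs e x) ×-dec (κ * deg zs e x <? γ)

      -- The fuel `k` bounds the number of vertices of positive degree. `low?` selects only such
      -- vertices, so each deletion lowers the bound, and a vertex to delete contradicts `k` being
      -- zero.
      go : ∀ k e → supp xs ys e + supp ys xs (flip e) ≤ k →
           α * supp xs ys e + β * supp ys xs (flip e) < κ * edges xs ys e →
           ∃ λ e′ → e′ ⊑ e × IsCore e′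
      go k e bound inv with any? (low? ys e α) xs | any? (low? xs (flip e) β) ys
      ... | no hp | no hl = e , (λ _ _ t → t) ,
            (λ x y t → ≮⇒≥ (λ lt → hp (lose (cxs x) (pos e x (cys y) t , lt)))
                     , ≮⇒≥ (λ lt → hl (lose (cys y) (pos (flip e) y (cxs x) t , lt)))) , edge
        where
        edge : ∃ λ x → ∃ λ y → T (e x y)
        -- The strict inequality has been kept through all deletions for this purpose: it rules out
        -- that the graph has become empty.
        edge with ∑-pos (deg ys e) xs (n≢0⇒n>0 λ z → n≮0 (<-≤-trans inv (≤-reflexive (trans (cong (κ *_) z) (*-zeroʳ κ)))))
        ... | x , _ , px with ∑-pos (λ y → [ T? (e x y) ]) ys px
        ...   | y , _ , py = x , y , []-pos (T? _) py
      go zero e bound inv | yes hp | _ with find hp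
      ... | a , a∈ , a>0 , small =
        ⊥-elim (n≮0 (≤-trans (dropPoint-supp _≟A_ xs ys uxs e a a∈ a>0) (≤-trans (m≤m+n _ _) bound)))
      go (suc k) e bound inv | yes hp | _ with find hp
      ... | a , a∈ , a>0 , small with go k (dropPoint _≟A_ xs ys uxs e a a∈ a>0)
              (s≤s⁻¹ (≤-trans (+-mono-≤ (dropPoint-supp _≟A_ xs ys uxs e a a∈ a>0)
                 (supp-mono ys xs λ y x → dropPoint-⊑ _≟A_ xs ys uxs e a a∈ a>0 x y)) bound))
              (dropPoint-potential _≟A_ xs ys uxs e a a∈ a>0 α β κ small inv)
      ...   | e′ , sub , c = e′ , (λ x y t → dropPoint-⊑ _≟A_ xs ys uxs e a a∈ a>0 x y (sub x y t)) , c
      go zero e bound inv | no _ | yes hl with find hl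
      ... | b , b∈ , b>0 , small =
        ⊥-elim (n≮0 (≤-trans (dropPoint-supp _≟B_ ys xs uys (flip e) b b∈ b>0) (≤-trans (m≤n+m _ _) bound)))
      -- A line is deleted as a point of the transposed relation, with `α` and `β` exchanged;
      -- `edges-flip` identifies the two edge counts.
      go (suc k) e bound inv | no _ | yes hl with find hl
      ... | b , b∈ , b>0 , small with go k (flip (dropPoint _≟B_ ys xs uys (flip e) b b∈ b>0))
              (s≤s⁻¹ (≤-trans (≤-reflexive (sym (+-suc _ _)))
                 (≤-trans (+-mono-≤ (supp-mono xs ys λ x y → dropPoint-⊑ _≟B_ ys xs uys (flip e) b b∈ b>0 y x)
                   (dropPoint-supp _≟B_ ys xs uys (flip e) b b∈ b>0)) bound)))
              (subst₂ _<_ (+-comm _ (α * _)) (cong (κ *_) (edges-flip xs ys (flip (dropPoint _≟B_ ys xs uys (flip e) b b∈ b>0))))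
                (dropPoint-potential _≟B_ ys xs uys (flip e) b b∈ b>0 β α κ small
                  (subst₂ _<_ (+-comm (α * _) _) (cong (κ *_) (sym (edges-flip xs ys e))) inv)))
      ...   | e′ , sub , c = e′ , (λ x y t → dropPoint-⊑ _≟B_ ys xs uys (flip e) b b∈ b>0 y x (sub x y t)) , c

    core : ∀ e → α * supp xs ys e + β * supp ys xs (flip e) < κ * edges xs ys e →
           ∃ λ e′ → e′ ⊑ e × IsCore e′
    core e inv = go _ e ≤-refl inv

  -- The form in which uniqueness enters a double count: an inner sum with at most one nonzero term
  -- is bounded by the indicator of any condition which that term implies.
  count-≤[] : ∀ {P : A → Set} (P? : ∀ x → Dec (P x)) {xs} → Unique xs → (∀ {x y} → x ∈ xs → y ∈ xs → P x → P y → x ≡ y) →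
              ∀ {Q : Set} (Q? : Dec Q) → (∀ {x} → x ∈ xs → P x → Q) → ∑ xs (λ x → [ P? x ]) ≤ [ Q? ]
  count-≤[] P? u h (yes q) i = at-most-one-∈ P? u h
  count-≤[] P? {xs} u h (no ¬q) i = ≤-reflexive (∑-none P? xs (All.tabulate λ m p → ¬q (i m p)))

  module Incidence
    (_≟A_ : DecidableEquality A) (_≟B_ : DecidableEquality B)
    (xs : List A) (ys : List B) (uxs : Unique xs) (uys : Unique ys)
    (e : A → B → Bool)
    (linear : ∀ {x x′ y y′} → T (e x y) → T (e x y′) → T (e x′ y) → T (e x′ y′) → x ≢ x′ → y ≡ y′)
    (w : ℕ)
    (rich-point : ∀ {x y} → T (e x y) → suc w ≤ deg ys e x)
    (rich-line  : ∀ {x y} → T (e x y) → suc w ≤ deg xs (flip e) y) where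

    e? : ∀ x y → Dec (T (e x y))
    e? x y = T? (e x y)

    -- A line of `M` carries at least `w` points besides `a`, and by linearity two lines through `a`
    -- share none of these, so the counts add up.
    star : ∀ a {M : B → Set} (M? : ∀ y → Dec (M y)) {S : A → Set} (S? : ∀ x → Dec (S x)) →
           (∀ {y} → M y → T (e a y)) → (∀ {x y} → M y → T (e x y) → S x) →
           ∑ ys (λ y → [ M? y ]) * w ≤ ∑ xs (λ x → [ S? x ])
    star a M? S? through inS = begin
      ∑ ys (λ y → [ M? y ]) * w                                        ≡⟨ ∑-*ʳ w _ ys ⟨
      ∑ ys (λ y → [ M? y ] * w)                                        ≤⟨ ∑-mono ys row ⟩
      ∑ ys (λ y → ∑ xs (λ x → [ M? y ×-dec (e? x y ×-dec ¬? (x ≟A a)) ])) ≡⟨ ∑-swap _ ys xs ⟩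
      ∑ xs (λ x → ∑ ys (λ y → [ M? y ×-dec (e? x y ×-dec ¬? (x ≟A a)) ])) ≤⟨ ∑-mono xs (λ x →
        count-≤[] (λ y → M? y ×-dec (e? x y ×-dec ¬? (x ≟A a))) uys
          (λ _ _ (m , t , n) (m′ , t′ , _) → linear t t′ (through m) (through m′) n)
          (S? x) (λ _ (m , t , _) → inS m t)) ⟩
      ∑ xs (λ x → [ S? x ])                                            ∎
      where
      row : ∀ y → [ M? y ] * w ≤ ∑ xs (λ x → [ M? y ×-dec (e? x y ×-dec ¬? (x ≟A a)) ])
      row y = []*-≤ (M? y) λ m → s≤s⁻¹ (begin
        suc w                                                        ≤⟨ rich-line (through m) ⟩
        ∑ xs (λ x → [ e? x y ])                                      ≤⟨ count-remove (λ x → e? x y) _≟A_ uxs a ⟩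
        suc (∑ xs (λ x → [ e? x y ×-dec ¬? (x ≟A a) ]))              ≤⟨ s≤s (∑-mono xs λ x → []-mono (e? x y ×-dec ¬? (x ≟A a)) (M? y ×-dec (e? x y ×-dec ¬? (x ≟A a))) (m ,_)) ⟩
        suc (∑ xs (λ x → [ M? y ×-dec (e? x y ×-dec ¬? (x ≟A a)) ])) ∎)

    -- Two lines of the pencil Ls meet only in a, so a line missing a meets them in distinct points.
    module _ (a : A) {Ls : List B} (uLs : Unique Ls) (through : ∀ {y} → y ∈ Ls → T (e a y))
             {Z : A → Set} (Z? : ∀ x → Dec (Z x)) (inZ : ∀ {x y} → y ∈ Ls → T (e x y) → Z x)
             (D : ℕ) {G : B → Set} (G? : ∀ y → Dec (G y))
             (inG : ∀ y → D < ∑ xs (λ x → [ e? x y ×-dec Z? x ]) → G y) where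

      private
        -- Two-step paths: along a line `l` of the pencil to a point `x` other than `a`, then onto
        -- another line `y`. Grouping them by `l` gives the lower bound, grouping them by `y` the
        -- upper one.
        τ? : ∀ l x y → Dec ((T (e x l) × x ≢ a) × (T (e x y) × y ≢ l))
        τ? l x y = (e? x l ×-dec ¬? (x ≟A a)) ×-dec (e? x y ×-dec ¬? (y ≟B l))

        hits : B → ℕ
        hits y = ∑ Ls (λ l → ∑ xs (λ x → [ τ? l x y ]))

        lower : length Ls * (w * w) ≤ ∑ ys hits
        lower = begin
          length Ls * (w * w)                                        ≡⟨ ∑-const (w * w) Ls ⟨
          ∑ Ls (λ _ → w * w)                                         ≤⟨ ∑-mono-∈ Ls row ⟩
          ∑ Ls (λ l → ∑ xs (λ x → ∑ ys (λ y → [ τ? l x y ])))        ≡⟨ ∑-cong Ls (λ l → ∑-swap _ xs ys) ⟩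
          ∑ Ls (λ l → ∑ ys (λ y → ∑ xs (λ x → [ τ? l x y ])))        ≡⟨ ∑-swap _ Ls ys ⟩
          ∑ ys hits                                                  ∎
          where
          row : ∀ {l} → l ∈ Ls → w * w ≤ ∑ xs (λ x → ∑ ys (λ y → [ τ? l x y ]))
          row {l} l∈ = begin
            w * w                                                    ≤⟨ *-monoˡ-≤ w (s≤s⁻¹ (≤-trans (rich-line (through l∈)) (count-remove (λ x → e? x l) _≟A_ uxs a))) ⟩
            ∑ xs (λ x → [ e? x l ×-dec ¬? (x ≟A a) ]) * w            ≡⟨ ∑-*ʳ w _ xs ⟨
            ∑ xs (λ x → [ e? x l ×-dec ¬? (x ≟A a) ] * w)            ≤⟨ ∑-mono xs (λ x → []*-≤ (e? x l ×-dec ¬? (x ≟A a)) λ p →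
              ≤-trans (s≤s⁻¹ (≤-trans (rich-point (proj₁ p)) (count-remove (e? x) _≟B_ uys l)))
                      (∑-mono ys λ y → []-mono (e? x y ×-dec ¬? (y ≟B l)) (τ? l x y) (p ,_))) ⟩
            ∑ xs (λ x → ∑ ys (λ y → [ τ? l x y ]))                   ∎

        -- For `y` in `G`, each `l` meets `y` at most once. Otherwise the paths ending in `y` pass
        -- through distinct points of `Z` on `y`, of which there are at most `D`.
        upper : ∀ y → hits y ≤ D + length Ls * [ G? y ]
        upper y with G? y
        ... | yes _ = ≤-trans (∑-≤-* _ Ls λ l → at-most-one (λ x → τ? l x y) uxs (same l)) (m≤n+m _ D)
          where
          same : ∀ l {x x′} → (T (e x l) × x ≢ a) × (T (e x y) × y ≢ l) → (T (e x′ l) × x′ ≢ a) × (T (e x′ y) × y ≢ l) → x ≡ x′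
          same l {x} {x′} ((t , _) , (s , n)) ((t′ , _) , (s′ , _)) with x ≟A x′
          ... | yes p = p
          ... | no ¬p = ⊥-elim (n (linear s t s′ t′ ¬p))
        ... | no ¬g = begin
          hits y                                             ≡⟨ ∑-swap _ Ls xs ⟩
          ∑ xs (λ x → ∑ Ls (λ l → [ τ? l x y ]))             ≤⟨ ∑-mono xs (λ x → count-≤[] (λ l → τ? l x y) uLs
            (λ m m′ ((t , n) , _) ((t′ , _) , _) → linear t t′ (through m) (through m′) n)
            (e? x y ×-dec Z? x) (λ m ((t , _) , (s , _)) → s , inZ m t)) ⟩
          ∑ xs (λ x → [ e? x y ×-dec Z? x ])                 ≤⟨ ≮⇒≥ (¬g ∘ inG y) ⟩
          D                                                  ≤⟨ m≤m+n D _ ⟩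
          D + length Ls * 0                                  ∎

      pencil : length Ls * (w * w) ≤ length ys * D + length Ls * ∑ ys (λ y → [ G? y ])
      pencil = begin
        length Ls * (w * w)                                ≤⟨ lower ⟩
        ∑ ys hits                                          ≤⟨ ∑-mono ys upper ⟩
        ∑ ys (λ y → D + length Ls * [ G? y ])              ≡⟨ ∑-+ ys ⟩
        ∑ ys (λ _ → D) + ∑ ys (λ y → length Ls * [ G? y ]) ≡⟨ cong₂ _+_ (∑-const D ys) (∑-*ˡ (length Ls) _ ys) ⟩
        length ys * D + length Ls * ∑ ys (λ y → [ G? y ])  ∎

    -- Each line of `G` has at least `v` points outside `Bad`, so averaging gives a point on many of
    -- these lines. Only pairs with a point outside `Bad` are averaged, hence the point found is not
    -- bad.
    popular-point : ∀ {G : B → Set} (G? : ∀ y → Dec (G y)) {Bad : A → Set} (Bad? : ∀ x → Dec (Bad x)) {D v c} →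
      (∀ {y} → G y → ∃ λ x → T (e x y)) →
      (∀ {y} → G y → ∑ xs (λ x → [ e? x y ×-dec Bad? x ]) ≤ D) → v + D ≤ suc w →
      length xs * c < ∑ ys (λ y → [ G? y ]) * v →
      ∃ λ x → ¬ Bad x × c < ∑ ys (λ y → [ G? y ×-dec e? x y ])
    popular-point {G} G? {Bad} Bad? {D} {v} {c} edge few v≤ big with pigeonhole good xs c (<-≤-trans big total)
      where
      good : A → ℕ
      good x = ∑ ys (λ y → [ G? y ×-dec (e? x y ×-dec ¬? (Bad? x)) ])
      row : ∀ y → [ G? y ] * v ≤ ∑ xs (λ x → [ G? y ×-dec (e? x y ×-dec ¬? (Bad? x)) ])
      row y = []*-≤ (G? y) λ g → +-cancelʳ-≤ D _ _ (begin
        v + D                                                 ≤⟨ v≤ ⟩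
        suc w                                                 ≤⟨ rich-line (proj₂ (edge g)) ⟩
        ∑ xs (λ x → [ e? x y ])                               ≤⟨ count-split (λ x → e? x y) Bad? xs ⟩
        ∑ xs (λ x → [ e? x y ×-dec ¬? (Bad? x) ]) + ∑ xs (λ x → [ e? x y ×-dec Bad? x ])
          ≤⟨ +-mono-≤ (∑-mono xs λ x → []-mono (e? x y ×-dec ¬? (Bad? x)) (G? y ×-dec (e? x y ×-dec ¬? (Bad? x))) (g ,_)) (few g) ⟩
        ∑ xs (λ x → [ G? y ×-dec (e? x y ×-dec ¬? (Bad? x)) ]) + D ∎)
      total : ∑ ys (λ y → [ G? y ]) * v ≤ ∑ xs good
      total = begin
        ∑ ys (λ y → [ G? y ]) * v     ≡⟨ ∑-*ʳ v _ ys ⟨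
        ∑ ys (λ y → [ G? y ] * v)     ≤⟨ ∑-mono ys row ⟩
        ∑ ys (λ y → ∑ xs (λ x → [ G? y ×-dec (e? x y ×-dec ¬? (Bad? x)) ])) ≡⟨ ∑-swap _ ys xs ⟩
        ∑ xs good                     ∎
    ... | x , _ , c< with ∑-pos _ ys (≤-<-trans z≤n c<)
    ...   | y , _ , p = x , proj₂ (proj₂ ([]-pos (G? y ×-dec (e? x y ×-dec ¬? (Bad? x))) p)) ,
      <-≤-trans c< (∑-mono ys λ y → []-mono (G? y ×-dec (e? x y ×-dec ¬? (Bad? x))) (G? y ×-dec e? x y) λ (g , t , _) → g , t)

    module _ {S : A → Set} (S? : ∀ x → Dec (S x)) {G : B → Set} (G? : ∀ y → Dec (G y)) {D : ℕ}
             (edge : ∀ {x} → S x → ∃ λ y → T (e x y))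
             (inG : ∀ y → D < ∑ xs (λ x → [ e? x y ×-dec S? x ]) → G y) where

      private
        bad : A → ℕ
        bad x = ∑ ys (λ y → [ e? x y ×-dec ¬? (G? y) ])

        few : ∀ y → ∑ xs (λ x → [ S? x ×-dec (e? x y ×-dec ¬? (G? y)) ]) ≤ D
        few y with G? y
        ... | yes g = ≤-trans (≤-reflexive (trans (∑-cong xs λ x → []-no (S? x ×-dec (e? x y ×-dec no λ ¬g → ¬g g)) λ (_ , _ , ¬g) → ¬g g) (∑-0 xs))) z≤n
        ... | no ¬g = ≤-trans (∑-mono xs λ x → []-mono (S? x ×-dec (e? x y ×-dec yes ¬g)) (e? x y ×-dec S? x) λ (s , t , _) → t , s) (≮⇒≥ (¬g ∘ inG y))

      -- A line outside `G` has at most `D` points of `S`. If every point of `S` were on at least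
      -- `c` such lines, they would carry more incidences than `length ys * D`.
      popular-star : ∀ {c} → length ys * D < ∑ xs (λ x → [ S? x ]) * c →
        ∃ λ x → S x × suc w ≤ c + ∑ ys (λ y → [ e? x y ×-dec G? y ])
      popular-star {c} big with any? (λ x → S? x ×-dec (bad x <? c)) xs
      ... | yes h with find h
      ...   | x , _ , s , b< = x , s , (begin
        suc w                                               ≤⟨ rich-point (proj₂ (edge s)) ⟩
        ∑ ys (λ y → [ e? x y ])                             ≤⟨ count-split (e? x) G? ys ⟩
        bad x + ∑ ys (λ y → [ e? x y ×-dec G? y ])          ≤⟨ +-monoˡ-≤ _ (<⇒≤ b<) ⟩
        c + ∑ ys (λ y → [ e? x y ×-dec G? y ])              ∎)
      popular-star {c} big | no ¬h = ⊥-elim (<⇒≱ big (begin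
        ∑ xs (λ x → [ S? x ]) * c                           ≡⟨ ∑-*ʳ c _ xs ⟨
        ∑ xs (λ x → [ S? x ] * c)                           ≤⟨ ∑-mono-∈ xs (λ {x} x∈ → []*-≤ (S? x) λ s →
          ≤-trans (≮⇒≥ λ b< → ¬h (lose x∈ (s , b<)))
            (∑-mono ys λ y → []-mono (e? x y ×-dec ¬? (G? y)) (S? x ×-dec (e? x y ×-dec ¬? (G? y))) (s ,_))) ⟩
        ∑ xs (λ x → ∑ ys (λ y → [ S? x ×-dec (e? x y ×-dec ¬? (G? y)) ])) ≡⟨ ∑-swap _ xs ys ⟩
        ∑ ys (λ y → ∑ xs (λ x → [ S? x ×-dec (e? x y ×-dec ¬? (G? y)) ])) ≤⟨ ∑-≤-* _ ys few ⟩
        length ys * D                                       ∎))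

      -- Incidences of `S`, counted by points and then by lines: a line in `G` contributes at most
      -- `q`, any other at most `D`.
      many-lines : ∀ {q} → (∀ y → deg xs (flip e) y ≤ q) →
        ∑ xs (λ x → [ S? x ]) * w ≤ length ys * D + ∑ ys (λ y → [ G? y ]) * q
      many-lines {q} thin = begin
        ∑ xs (λ x → [ S? x ]) * w                           ≡⟨ ∑-*ʳ w _ xs ⟨
        ∑ xs (λ x → [ S? x ] * w)                           ≤⟨ ∑-mono xs (λ x → []*-≤ (S? x) λ s →
          ≤-trans (≤-trans (n≤1+n w) (rich-point (proj₂ (edge s)))) (∑-mono ys λ y → []-mono (e? x y) (e? x y ×-dec S? x) (_, s))) ⟩
        ∑ xs (λ x → ∑ ys (λ y → [ e? x y ×-dec S? x ]))     ≡⟨ ∑-swap _ xs ys ⟩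
        ∑ ys (λ y → ∑ xs (λ x → [ e? x y ×-dec S? x ]))     ≤⟨ ∑-mono ys bound ⟩
        ∑ ys (λ y → D + [ G? y ] * q)                       ≡⟨ ∑-+ ys ⟩
        ∑ ys (λ _ → D) + ∑ ys (λ y → [ G? y ] * q)          ≡⟨ cong₂ _+_ (∑-const D ys) (∑-*ʳ q _ ys) ⟩
        length ys * D + ∑ ys (λ y → [ G? y ]) * q           ∎
        where
        bound : ∀ y → ∑ xs (λ x → [ e? x y ×-dec S? x ]) ≤ D + [ G? y ] * q
        bound y with G? y
        ... | no ¬g = ≤-trans (≮⇒≥ (¬g ∘ inG y)) (m≤m+n D _)
        ... | yes _ = ≤-trans (≤-trans (∑-mono xs λ x → []-mono (e? x y ×-dec S? x) (e? x y) proj₁) (thin y))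
                        (≤-trans (≤-reflexive (sym (*-identityˡ q))) (m≤n+m _ D))

-- The image of the integers in the field, and a ring solver.

module FieldArithmetic (F : FiniteField) where

  open import Data.Nat as ℕ using (ℕ; zero; suc)
  import Data.Nat.Properties as ℕP
  open import Data.Integer as ℤ using (ℤ; -[1+_]) renaming (+_ to pos)
  import Data.Integer.Properties as ℤP
  open import Algebra.Bundles using (CommutativeRing)
  import Algebra.Properties.Ring
  open import Algebra.Solver.Ring.AlmostCommutativeRing using (fromCommutativeRing; AlmostCommutativeRing; _-Raw-AlmostCommutative⟶_)
  import Algebra.Solver.Ring
  open import Data.Maybe using (Maybe; just; nothing)
  open import Relation.Nullary using (yes; no)
  open import Relation.Binary.PropositionalEquality hiding ([_])

  open FiniteField F
  open FF F using (ℕ→F)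

  ring : CommutativeRing _ _
  ring = record { isCommutativeRing = isCommutativeRing }

  open CommutativeRing ring public using
    (+-assoc; +-comm; +-identityˡ; +-identityʳ; *-assoc; *-comm; *-identityˡ; *-identityʳ;
     zeroˡ; zeroʳ; distribˡ; distribʳ; -‿inverseˡ; -‿inverseʳ)
  open Algebra.Properties.Ring (CommutativeRing.ring ring) public using
    (-‿distribˡ-*; -‿distribʳ-*; -‿involutive; -0#≈0#; -‿+-comm)

  open ≡-Reasoning

  ℕ→F-+ : ∀ m n → ℕ→F (m ℕ.+ n) ≡ ℕ→F m + ℕ→F n
  ℕ→F-+ zero    n = sym (+-identityˡ _)
  ℕ→F-+ (suc m) n = trans (cong (1# +_) (ℕ→F-+ m n)) (sym (+-assoc _ _ _))

  ℕ→F-* : ∀ m n → ℕ→F (m ℕ.* n) ≡ ℕ→F m * ℕ→F n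
  ℕ→F-* zero    n = sym (zeroˡ _)
  ℕ→F-* (suc m) n = begin
    ℕ→F (n ℕ.+ m ℕ.* n)            ≡⟨ ℕ→F-+ n (m ℕ.* n) ⟩
    ℕ→F n + ℕ→F (m ℕ.* n)          ≡⟨ cong₂ _+_ (sym (*-identityˡ _)) (ℕ→F-* m n) ⟩
    1# * ℕ→F n + ℕ→F m * ℕ→F n     ≡⟨ distribʳ _ _ _ ⟨
    (1# + ℕ→F m) * ℕ→F n           ∎

  private
    ⟦_⟧ : ℤ → Carrier
    ⟦ pos n ⟧      = ℕ→F n
    ⟦ -[1+ n ] ⟧ = - ℕ→F (suc n)

    neg-homo : ∀ i → ⟦ ℤ.- i ⟧ ≡ - ⟦ i ⟧
    neg-homo (pos zero)  = sym -0#≈0#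
    neg-homo (pos (suc n)) = refl
    neg-homo -[1+ n ]  = sym (-‿involutive _)

    shift : ∀ a b c → a + - b ≡ (c + a) + - (c + b)
    shift a b c = begin
      a + - b                     ≡⟨ cong (_+ - b) (+-identityˡ a) ⟨
      (0# + a) + - b              ≡⟨ cong (λ z → (z + a) + - b) (-‿inverseʳ c) ⟨
      ((c + - c) + a) + - b       ≡⟨ cong (_+ - b) (trans (+-assoc _ _ _) (trans (cong (c +_) (+-comm _ _)) (sym (+-assoc _ _ _)))) ⟩
      ((c + a) + - c) + - b       ≡⟨ +-assoc _ _ _ ⟩
      (c + a) + (- c + - b)       ≡⟨ cong (_ +_) (-‿+-comm c b) ⟩
      (c + a) + - (c + b)         ∎

    ⊖-homo : ∀ m n → ⟦ m ℤ.⊖ n ⟧ ≡ ℕ→F m + - ℕ→F n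
    ⊖-homo m zero = trans (cong ⟦_⟧ (ℤP.⊖-≥ {m} {zero} ℕ.z≤n)) (sym (trans (cong (ℕ→F m +_) -0#≈0#) (+-identityʳ (ℕ→F m))))
    ⊖-homo zero (suc n) = sym (+-identityˡ _)
    ⊖-homo (suc m) (suc n) = trans (cong ⟦_⟧ (ℤP.[1+m]⊖[1+n]≡m⊖n m n)) (trans (⊖-homo m n) (shift _ _ 1#))

    +-homo : ∀ i j → ⟦ i ℤ.+ j ⟧ ≡ ⟦ i ⟧ + ⟦ j ⟧
    +-homo (pos m)    (pos n)    = ℕ→F-+ m n
    +-homo (pos m)    -[1+ n ] = ⊖-homo m (suc n)
    +-homo -[1+ m ] (pos n)    = trans (⊖-homo n (suc m)) (+-comm _ _)
    +-homo -[1+ m ] -[1+ n ] = trans (cong (λ k → - ℕ→F (suc k)) (sym (ℕP.+-suc m n)))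
                                 (trans (cong -_ (ℕ→F-+ (suc m) (suc n))) (sym (-‿+-comm _ _)))

    *-homo⁺ : ∀ m j → ⟦ pos m ℤ.* j ⟧ ≡ ℕ→F m * ⟦ j ⟧
    *-homo⁺ m (pos n)    = trans (cong ⟦_⟧ (sym (ℤP.pos-* m n))) (ℕ→F-* m n)
    *-homo⁺ m -[1+ n ] = begin
      ⟦ pos m ℤ.* (ℤ.- (pos (suc n))) ⟧    ≡⟨ cong ⟦_⟧ (ℤP.neg-distribʳ-* (pos m) (pos (suc n))) ⟨
      ⟦ ℤ.- (pos m ℤ.* pos (suc n)) ⟧      ≡⟨ neg-homo (pos m ℤ.* pos (suc n)) ⟩
      - ⟦ pos m ℤ.* pos (suc n) ⟧          ≡⟨ cong -_ (*-homo⁺ m (pos (suc n))) ⟩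
      - (ℕ→F m * ℕ→F (suc n))        ≡⟨ -‿distribʳ-* _ _ ⟩
      ℕ→F m * - ℕ→F (suc n)          ∎

    *-homo : ∀ i j → ⟦ i ℤ.* j ⟧ ≡ ⟦ i ⟧ * ⟦ j ⟧
    *-homo (pos m)    j = *-homo⁺ m j
    *-homo -[1+ m ] j = begin
      ⟦ (ℤ.- (pos (suc m))) ℤ.* j ⟧      ≡⟨ cong ⟦_⟧ (ℤP.neg-distribˡ-* (pos (suc m)) j) ⟨
      ⟦ ℤ.- (pos (suc m) ℤ.* j) ⟧        ≡⟨ neg-homo (pos (suc m) ℤ.* j) ⟩
      - ⟦ pos (suc m) ℤ.* j ⟧            ≡⟨ cong -_ (*-homo⁺ (suc m) j) ⟩
      - (ℕ→F (suc m) * ⟦ j ⟧)        ≡⟨ -‿distribˡ-* _ _ ⟩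
      - ℕ→F (suc m) * ⟦ j ⟧          ∎

    acr : AlmostCommutativeRing _ _
    acr = fromCommutativeRing ring

    morphism : ℤ.+-*-rawRing -Raw-AlmostCommutative⟶ acr
    morphism = record
      { ⟦_⟧ = ⟦_⟧ ; +-homo = +-homo ; *-homo = *-homo ; -‿homo = neg-homo
      ; 0-homo = refl ; 1-homo = +-identityʳ _ }

    -- Distinct integers may coincide in positive characteristic; `nothing` makes no claim about
    -- them, so the solver is sound in every field.
    coeff-≟ : ∀ i j → Maybe (⟦ i ⟧ ≡ ⟦ j ⟧)
    coeff-≟ i j with i ℤ.≟ j
    ... | yes refl = just refl
    ... | no _     = nothing

  module Solver = Algebra.Solver.Ring ℤ.+-*-rawRing acr morphism coeff-≟

-- Functions of bounded degree and their zeros.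

module Polynomials (F : FiniteField) where

  open FiniteSums
  open FieldArithmetic F
  open import Data.Nat as ℕ using (ℕ; zero; suc; z≤n; s≤s)
  import Data.Nat.Properties as ℕP
  open import Data.List using (length)
  open import Data.Product using (∃; _×_; _,_; proj₂)
  open import Data.Sum using (_⊎_; inj₁; inj₂)
  open import Data.Empty using (⊥-elim)
  open import Function using (_∘_; id)
  open import Relation.Nullary using (¬_; yes; no; _×-dec_; ¬?)
  open import Relation.Binary.PropositionalEquality hiding ([_])

  open FiniteField F renaming (Carrier to C)
  open FF F using (size)
  open Solver using (solve; _:+_; _:*_; :-_; _:=_; con)

  infixr 8 _^_
  _^_ : C → ℕ → C
  x ^ zero  = 1#
  x ^ suc n = x * x ^ n

  ^-+ : ∀ x m n → x ^ (m ℕ.+ n) ≡ x ^ m * x ^ n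
  ^-+ x zero    n = sym (*-identityˡ _)
  ^-+ x (suc m) n = trans (cong (x *_) (^-+ x m n)) (sym (*-assoc _ _ _))

  ^-distrib-* : ∀ x y n → (x * y) ^ n ≡ x ^ n * y ^ n
  ^-distrib-* x y zero    = sym (*-identityˡ _)
  ^-distrib-* x y (suc n) = trans (cong ((x * y) *_) (^-distrib-* x y n))
    (solve 4 (λ a b c d → (a :* b) :* (c :* d) := (a :* c) :* (b :* d)) refl x y (x ^ n) (y ^ n))

  1^ : ∀ n → 1# ^ n ≡ 1#
  1^ zero    = refl
  1^ (suc n) = trans (*-identityˡ _) (1^ n)

  ^-* : ∀ x m n → x ^ (m ℕ.* n) ≡ (x ^ m) ^ n
  ^-* x zero    n = sym (1^ n)
  ^-* x (suc m) n = trans (^-+ x n (m ℕ.* n))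
    (trans (cong (x ^ n *_) (^-* x m n)) (sym (^-distrib-* x (x ^ m) n)))

  *-cancel-0 : ∀ {x y} → x * y ≡ 0# → x ≢ 0# → y ≡ 0#
  *-cancel-0 {x} {y} p x≢0 with inverse x x≢0
  ... | i , xi = trans (sym (trans (cong (_* y) (trans (*-comm i x) xi)) (*-identityˡ y)))
    (trans (*-assoc i x y) (trans (cong (i *_) p) (zeroʳ i)))

  *-zero : ∀ {x y} → x * y ≡ 0# → x ≡ 0# ⊎ y ≡ 0#
  *-zero {x} p with x ≟ 0#
  ... | yes q = inj₁ q
  ... | no  q = inj₂ (*-cancel-0 p q)

  ^-zero : ∀ {x} n → x ^ n ≡ 0# → x ≡ 0#
  ^-zero zero    p = ⊥-elim (0≢1 (sym p))
  ^-zero (suc n) p with *-zero p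
  ... | inj₁ q = q
  ... | inj₂ q = ^-zero n q

  difference-0 : ∀ {x y} → x + - y ≡ 0# → x ≡ y
  difference-0 {x} {y} p = trans (solve 2 (λ a b → a := (a :+ :- b) :+ b) refl x y) (trans (cong (_+ y) p) (+-identityˡ y))

  -- A polynomial is a function with a degree bound and no chosen coefficients; only closure under
  -- the ring operations and under pointwise equality is recorded. One proof about evaluation then
  -- serves univariate, bivariate and slope-graded polynomials.
  record Filtration (Ω : Set) : Set₁ where
    field
      𝓕   : ℕ → (Ω → C) → Set
      ext : ∀ {N g h} → (∀ ω → g ω ≡ h ω) → 𝓕 N g → 𝓕 N h
      wk  : ∀ {N M g} → N ℕ.≤ M → 𝓕 N g → 𝓕 M g
      cst : ∀ c → 𝓕 0 (λ _ → c)
      add : ∀ {N g h} → 𝓕 N g → 𝓕 N h → 𝓕 N (λ ω → g ω + h ω)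
      mul : ∀ {N M g h} → 𝓕 N g → 𝓕 M h → 𝓕 (N ℕ.+ M) (λ ω → g ω * h ω)

    cst′ : ∀ {N} c → 𝓕 N (λ _ → c)
    cst′ c = wk z≤n (cst c)

    pow : ∀ {N g} n → 𝓕 N g → 𝓕 (n ℕ.* N) (λ ω → g ω ^ n)
    pow zero    p = cst 1#
    pow (suc n) p = mul p (pow n p)

    neg : ∀ {N g} → 𝓕 N g → 𝓕 N (λ ω → - g ω)
    neg {g = g} p = ext (λ ω → trans (sym (-‿distribˡ-* 1# (g ω))) (cong -_ (*-identityˡ (g ω)))) (mul (cst (- 1#)) p)

    sub : ∀ {N g h} → 𝓕 N g → 𝓕 N h → 𝓕 N (λ ω → g ω + - h ω)
    sub p q = add p (neg q)

  constants : (Ω : Set) → Filtration Ω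
  constants Ω = record
    { 𝓕   = λ _ g → ∃ λ c → ∀ ω → g ω ≡ c
    ; ext = λ e (c , p) → c , λ ω → trans (sym (e ω)) (p ω)
    ; wk  = λ _ p → p
    ; cst = λ c → c , λ _ → refl
    ; add = λ (c , p) (c′ , p′) → c + c′ , λ ω → cong₂ _+_ (p ω) (p′ ω)
    ; mul = λ (c , p) (c′ , p′) → c * c′ , λ ω → cong₂ _*_ (p ω) (p′ ω)
    }

  pullback : ∀ {Ω Ω′ : Set} → (Ω′ → Ω) → Filtration Ω → Filtration Ω′
  pullback π 𝒢 = record
    { 𝓕   = λ N g → ∃ λ h → 𝓕 N h × (∀ ω → g ω ≡ h (π ω))
    ; ext = λ e (h , p , q) → h , p , λ ω → trans (sym (e ω)) (q ω)
    ; wk  = λ le (h , p , q) → h , wk le p , q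
    ; cst = λ c → (λ _ → c) , cst c , λ _ → refl
    ; add = λ (h , p , q) (h′ , p′ , q′) → _ , add p p′ , λ ω → cong₂ _+_ (q ω) (q′ ω)
    ; mul = λ (h , p , q) (h′ , p′ , q′) → _ , mul p p′ , λ ω → cong₂ _*_ (q ω) (q′ ω)
    }
    where open Filtration 𝒢

  -- Polynomials of degree ≤ N in the function t, whose i-th coefficient lies in level s·i + a of 𝒞.
  module Adjoin {Ω : Set} (𝒞 : Filtration Ω) (t : Ω → C) (s : ℕ) where
    private module K = Filtration 𝒞

    data Adj : ℕ → ℕ → (Ω → C) → Set where
      base : ∀ {a g} → K.𝓕 a g → Adj a zero g
      step : ∀ {a N g} c g′ → K.𝓕 a c → Adj (s ℕ.+ a) N g′ → (∀ ω → g ω ≡ c ω + t ω * g′ ω) → Adj a (suc N) g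

    Adj-ext : ∀ {a N g h} → (∀ ω → g ω ≡ h ω) → Adj a N g → Adj a N h
    Adj-ext e (base p)            = base (K.ext e p)
    Adj-ext e (step c g′ pc pg q) = step c g′ pc pg (λ ω → trans (sym (e ω)) (q ω))

    Adj-wk : ∀ {a b N g} → a ℕ.≤ b → Adj a N g → Adj b N g
    Adj-wk le (base p)            = base (K.wk le p)
    Adj-wk le (step c g′ pc pg q) = step c g′ (K.wk le pc) (Adj-wk (ℕP.+-monoʳ-≤ s le) pg) q

    Adj-cst : ∀ {a} N c → Adj a N (λ _ → c)
    Adj-cst zero    c = base (K.cst′ c)
    Adj-cst (suc N) c = step (λ _ → c) (λ _ → 0#) (K.cst′ c) (Adj-cst N 0#)
      (λ ω → sym (trans (cong (c +_) (zeroʳ (t ω))) (+-identityʳ c)))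

    Adj-embed : ∀ {a} N {g} → K.𝓕 a g → Adj a N g
    Adj-embed zero        p = base p
    Adj-embed (suc N) {g} p = step g (λ _ → 0#) p (Adj-cst N 0#)
      (λ ω → sym (trans (cong (g ω +_) (zeroʳ (t ω))) (+-identityʳ (g ω))))

    Adj-pad : ∀ {a N M g} → N ℕ.≤ M → Adj a N g → Adj a M g
    Adj-pad {M = M} z≤n      (base p)            = Adj-embed M p
    Adj-pad         (s≤s le) (step c g′ pc pg q) = step c g′ pc (Adj-pad le pg) q

    Adj-add : ∀ {a N g h} → Adj a N g → Adj a N h → Adj a N (λ ω → g ω + h ω)
    Adj-add (base p) (base q) = base (K.add p q)
    Adj-add (step c g′ pc pg q) (step d h′ pd ph r) =
      step _ _ (K.add pc pd) (Adj-add pg ph) (λ ω → trans (cong₂ _+_ (q ω) (r ω))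
        (solve 5 (λ c d t g h → (c :+ t :* g) :+ (d :+ t :* h) := (c :+ d) :+ t :* (g :+ h)) refl (c ω) (d ω) (t ω) (g′ ω) (h′ ω)))

    Adj-scale : ∀ {a b N c h} → K.𝓕 a c → Adj b N h → Adj (a ℕ.+ b) N (λ ω → c ω * h ω)
    Adj-scale p (base q) = base (K.mul p q)
    Adj-scale {a} {b} {suc N} {c} p (step d h′ pd ph r) =
      step _ _ (K.mul p pd)
      (subst (λ k → Adj k N (λ ω → c ω * h′ ω)) swap (Adj-scale p ph))
      (λ ω → trans (cong (c ω *_) (r ω))
        (solve 4 (λ c d t h → c :* (d :+ t :* h) := c :* d :+ t :* (c :* h)) refl (c ω) (d ω) (t ω) (h′ ω)))
      where
      swap : a ℕ.+ (s ℕ.+ b) ≡ s ℕ.+ (a ℕ.+ b)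
      swap = trans (sym (ℕP.+-assoc a s b)) (trans (cong (ℕ._+ b) (ℕP.+-comm a s)) (ℕP.+-assoc s a b))

    Adj-shift : ∀ {a N g} → Adj (s ℕ.+ a) N g → Adj a (suc N) (λ ω → t ω * g ω)
    Adj-shift p = step (λ _ → 0#) _ (K.cst′ 0#) p (λ ω → sym (+-identityˡ _))

    Adj-mul : ∀ {a b N M g h} → Adj a N g → Adj b M h → Adj (a ℕ.+ b) (N ℕ.+ M) (λ ω → g ω * h ω)
    Adj-mul (base p) q = Adj-scale p q
    Adj-mul {a} {b} {suc N} {M} {g} {h} (step c g′ pc pg q) ph =
      Adj-ext (λ ω → sym (trans (cong (_* h ω) (q ω))
          (solve 4 (λ c t g h → (c :+ t :* g) :* h := c :* h :+ t :* (g :* h)) refl (c ω) (t ω) (g′ ω) (h ω))))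
        (Adj-add (Adj-pad (ℕP.m≤n+m M (suc N)) (Adj-scale pc ph))
          (Adj-shift (subst (λ k → Adj k (N ℕ.+ M) (λ ω → g′ ω * h ω)) (ℕP.+-assoc s a b) (Adj-mul pg ph))))

    Adj-t^ : ∀ {a} i {c} → K.𝓕 (i ℕ.* s ℕ.+ a) c → Adj a i (λ ω → t ω ^ i * c ω)
    Adj-t^ zero    p = base (K.ext (λ ω → sym (*-identityˡ _)) p)
    Adj-t^ {a} (suc i) {c} p = Adj-ext (λ ω → sym (*-assoc (t ω) (t ω ^ i) (c ω)))
      (Adj-shift (Adj-t^ i (subst (λ k → K.𝓕 k c) (trans (cong (ℕ._+ a) (ℕP.+-comm s (i ℕ.* s))) (ℕP.+-assoc (i ℕ.* s) s a)) p)))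

    byDegree : Filtration Ω
    byDegree = record
      { 𝓕   = Adj 0
      ; ext = Adj-ext
      ; wk  = Adj-pad
      ; cst = Adj-cst 0
      ; add = Adj-add
      ; mul = Adj-mul
      }

    -- For `s` zero, the degree in `t` and the level of every coefficient are bounded by the same
    -- `N`: a polynomial of total degree `N` lands in the box of exponents at most `N`.
    byBox : Filtration Ω
    byBox = record
      { 𝓕   = λ N → Adj N N
      ; ext = Adj-ext
      ; wk  = λ le p → Adj-wk le (Adj-pad le p)
      ; cst = Adj-cst 0
      ; add = Adj-add
      ; mul = Adj-mul
      }

  module D = Adjoin (constants C) id 0
  module DegF = Filtration D.byDegree

  Deg : ℕ → (C → C) → Set
  Deg = DegF.𝓕

  Deg-id : Deg 1 id
  Deg-id = D.step (λ _ → 0#) (λ _ → 1#) (0# , λ _ → refl) (DegF.cst 1#)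
    (λ t → sym (trans (+-identityˡ _) (*-identityʳ t)))

  Deg-affine : ∀ a b → Deg 1 (λ t → a * t + b)
  Deg-affine a b = DegF.add (DegF.mul (DegF.cst a) Deg-id) (DegF.cst′ b)

  -- The coefficients form an infinite sequence, so that dropping the constant term is composition
  -- with `suc` and a change of the degree bound leaves the sequence alone.
  pev : ℕ → (ℕ → C) → C → C
  pev zero    c t = c 0
  pev (suc N) c t = c 0 + t * pev N (c ∘ suc) t

  pev-cong : ∀ N {c c′} t → (∀ k → k ℕ.≤ N → c k ≡ c′ k) → pev N c t ≡ pev N c′ t
  pev-cong zero    t h = h 0 z≤n
  pev-cong (suc N) t h = cong₂ (λ x y → x + t * y) (h 0 z≤n) (pev-cong N t (λ k le → h (suc k) (s≤s le)))

  Deg-pev : ∀ N c → Deg N (pev N c)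
  Deg-pev zero    c = DegF.cst (c 0)
  Deg-pev (suc N) c = D.step (λ _ → c 0) (pev N (c ∘ suc)) (c 0 , λ _ → refl) (Deg-pev N (c ∘ suc)) (λ _ → refl)

  prepend : {A : Set} → A → (ℕ → A) → ℕ → A
  prepend c f zero    = c
  prepend c f (suc k) = f k

  Deg⇒pev : ∀ {N g} → Deg N g → ∃ λ c → ∀ t → g t ≡ pev N c t
  Deg⇒pev (D.base (c , p)) = (λ _ → c) , p
  Deg⇒pev (D.step _ g′ (c , pc) pg q) with Deg⇒pev pg
  ... | f , pf = prepend c f , λ t → trans (q t) (cong₂ (λ x y → x + t * y) (pc t) (pf t))

  zeros : (C → C) → ℕ
  zeros g = ∑ elements (λ t → [ g t ≟ 0# ])

  private
    divide : ∀ {N g} → Deg (suc N) g → ∀ a → ∃ λ h → Deg N h × (∀ t → g t + - g a ≡ (t + - a) * h t)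
    divide {zero} {g} (D.step c g′ (k , pk) (D.base (l , pl)) q) a = (λ _ → l) , DegF.cst l ,
      λ t → trans (cong₂ (λ x y → x + - y) (at t) (at a))
        (solve 4 (λ k l t a → (k :+ t :* l) :+ :- (k :+ a :* l) := (t :+ :- a) :* l) refl k l t a)
      where
      at : ∀ t → g t ≡ k + t * l
      at t = trans (q t) (cong₂ (λ x y → x + t * y) (pk t) (pl t))
    divide {suc N} {g} (D.step c g′ (k , pk) pg q) a with divide pg a
    ... | h , ph , e = (λ t → g′ a + t * h t) , D.step (λ _ → g′ a) h (g′ a , λ _ → refl) ph (λ _ → refl) , λ t → begin
      g t + - g a                                   ≡⟨ cong₂ (λ x y → x + - y) (at t) (at a) ⟩
      (k + t * g′ t) + - (k + a * g′ a)             ≡⟨ solve 5 (λ k t a x y → (k :+ t :* x) :+ :- (k :+ a :* y) := (t :+ :- a) :* y :+ t :* (x :+ :- y)) refl k t a (g′ t) (g′ a) ⟩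
      (t + - a) * g′ a + t * (g′ t + - g′ a)        ≡⟨ cong (λ z → (t + - a) * g′ a + t * z) (e t) ⟩
      (t + - a) * g′ a + t * ((t + - a) * h t)      ≡⟨ solve 4 (λ t a y h → (t :+ :- a) :* y :+ t :* ((t :+ :- a) :* h) := (t :+ :- a) :* (y :+ t :* h)) refl t a (g′ a) (h t) ⟩
      (t + - a) * (g′ a + t * h t)                  ∎
      where
      open ≡-Reasoning
      at : ∀ t → g t ≡ k + t * g′ t
      at t = trans (q t) (cong (λ x → x + t * g′ t) (pk t))

  -- Dividing by `t + - a` at a root `a` costs one degree and at most one zero, since every other
  -- zero of `g` is a zero of the quotient.
  many-zeros : ∀ {N g} → Deg N g → N ℕ.< zeros g → ∀ t → g t ≡ 0#
  many-zeros {zero} {g} (D.base (c , p)) h t with ∑-pos _ elements h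
  ... | a , _ , pa = trans (p t) (trans (sym (p a)) ([]-pos (g a ≟ 0#) pa))
  many-zeros {suc N} {g} p h t with ∑-pos _ elements (ℕP.≤-<-trans z≤n h)
  ... | a , _ , pa with []-pos (g a ≟ 0#) pa | divide p a
  ...   | ga | k , pk , e = trans (fact t) (trans (cong ((t + - a) *_) (many-zeros pk (ℕP.≤-pred (ℕP.≤-trans h bound)) t)) (zeroʳ _))
    where
    fact : ∀ t → g t ≡ (t + - a) * k t
    fact t = trans (sym (trans (cong (λ z → g t + - z) ga) (trans (cong (g t +_) -0#≈0#) (+-identityʳ _)))) (e t)
    pt : ∀ t → [ g t ≟ 0# ] ℕ.≤ [ t ≟ a ] ℕ.+ [ k t ≟ 0# ]
    pt t = []-≤ (g t ≟ 0#) λ z → case (*-zero (trans (sym (fact t)) z))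
      where
      case : t + - a ≡ 0# ⊎ k t ≡ 0# → 1 ℕ.≤ [ t ≟ a ] ℕ.+ [ k t ≟ 0# ]
      case (inj₁ r) = ℕP.≤-trans (ℕP.≤-reflexive (sym ([]-yes (t ≟ a) (difference-0 r)))) (ℕP.m≤m+n _ _)
      case (inj₂ r) = ℕP.≤-trans (ℕP.≤-reflexive (sym ([]-yes (k t ≟ 0#) r))) (ℕP.m≤n+m _ _)
    bound : zeros g ℕ.≤ suc (zeros k)
    bound = ℕP.≤-trans (∑-mono elements pt) (ℕP.≤-trans (ℕP.≤-reflexive (∑-+ elements))
      (ℕP.+-monoˡ-≤ _ (at-most-one (_≟ a) unique λ x y → trans x (sym y))))

  few-zeros : ∀ {N g} → Deg N g → ∀ {a} → g a ≢ 0# → zeros g ℕ.≤ N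
  few-zeros p {a} ga = ℕP.≮⇒≥ λ h → ga (many-zeros p h a)

  zero-off-0 : ∀ {N g} → Deg N g → suc N ℕ.< size → (∀ t → t ≢ 0# → g t ≡ 0#) → ∀ t → g t ≡ 0#
  zero-off-0 {N} {g} p le h = many-zeros p (ℕP.≤-pred (begin
    suc (suc N)                                                     ≤⟨ le ⟩
    length elements                                                 ≡⟨ ∑-all (λ t → t ≟ t) elements (λ _ → refl) ⟨
    ∑ elements (λ t → [ t ≟ t ])                                    ≤⟨ count-remove (λ t → t ≟ t) _≟_ unique 0# ⟩
    suc (∑ elements (λ t → [ (t ≟ t) ×-dec ¬? (t ≟ 0#) ]))          ≤⟨ s≤s (∑-mono elements λ t → []-mono ((t ≟ t) ×-dec ¬? (t ≟ 0#)) (g t ≟ 0#) (h t ∘ proj₂)) ⟩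
    suc (zeros g)                                                   ∎))
    where open ℕP.≤-Reasoning

  -- As these are functions, the hypothesis is silent about `g 0#`. That value is forced by the
  -- nonzero arguments, of which there are more than `N`.
  cancel-t : ∀ {N g} → Deg N g → suc N ℕ.< size → (∀ t → t * g t ≡ 0#) → ∀ t → g t ≡ 0#
  cancel-t p le h = zero-off-0 p le λ t → *-cancel-0 (h t)

  -- Evaluation at 0 isolates the constant term, and cancelling `t` shifts the sequence. The bound
  -- on `N` is what lets a function determine its coefficients.
  pev-zero : ∀ N c → suc N ℕ.< size → (∀ t → pev N c t ≡ 0#) → ∀ k → k ℕ.≤ N → c k ≡ 0#
  pev-zero zero    c le h zero    _ = h 0#
  pev-zero (suc N) c le h k k≤ = go k k≤
    where
    c0 : c 0 ≡ 0#
    c0 = trans (sym (trans (cong (c 0 +_) (zeroˡ _)) (+-identityʳ _))) (h 0#)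
    tail0 : ∀ t → t * pev N (c ∘ suc) t ≡ 0#
    tail0 t = trans (sym (trans (cong (_+ t * pev N (c ∘ suc) t) c0) (+-identityˡ _))) (h t)
    go : ∀ k → k ℕ.≤ suc N → c k ≡ 0#
    go zero    _        = c0
    go (suc k) (s≤s le′) = pev-zero N (c ∘ suc) (ℕP.<-trans (ℕP.n<1+n _) le)
      (cancel-t (Deg-pev N (c ∘ suc)) (ℕP.<-trans (ℕP.n<1+n _) le) tail0) k le′

-- Bivariate polynomials, Taylor expansion and the grading by slope.

module Bivariate (F : FiniteField) where

  open FieldArithmetic F
  open Polynomials F
  open import Data.Nat as ℕ using (ℕ; zero; suc)
  import Data.Nat.Properties as ℕP
  open import Data.Product using (∃; _×_; _,_; proj₁; proj₂)
  open import Function using (_∘_; id)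
  open import Relation.Binary.PropositionalEquality hiding ([_])

  open FiniteField F renaming (Carrier to C)
  open FF F using (size; ℕ→F)
  open Solver using (solve; _:+_; _:*_; :-_; _:=_; con)

  -- The total degree is certified by a derivation from the two coordinates instead of an array of
  -- coefficients, because substitutions are far more frequent here than uses of coefficients.
  data Bi : ℕ → (C → C → C) → Set where
    cst : ∀ c → Bi 0 (λ _ _ → c)
    vx  : Bi 1 (λ x _ → x)
    vy  : Bi 1 (λ _ y → y)
    add : ∀ {N g h} → Bi N g → Bi N h → Bi N (λ x y → g x y + h x y)
    mul : ∀ {N M g h} → Bi N g → Bi M h → Bi (N ℕ.+ M) (λ x y → g x y * h x y)
    wk  : ∀ {N M g} → N ℕ.≤ M → Bi N g → Bi M g
    ext : ∀ {N g h} → (∀ x y → g x y ≡ h x y) → Bi N g → Bi N h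

  bivariate : Filtration (C × C)
  bivariate = record
    { 𝓕   = λ N g → Bi N (λ x y → g (x , y))
    ; ext = λ e → ext (λ x y → e (x , y))
    ; wk  = wk ; cst = cst ; add = add ; mul = mul }

  module BiF = Filtration bivariate

  -- The derivation is replayed with `X` and `Y` as coordinates. Restriction to a line, translation,
  -- linear change of coordinates and the passage to coefficients are all instances.
  Bi-subst : ∀ {Ω} (𝒢 : Filtration Ω) {X Y} → Filtration.𝓕 𝒢 1 X → Filtration.𝓕 𝒢 1 Y →
             ∀ {N g} → Bi N g → Filtration.𝓕 𝒢 N (λ ω → g (X ω) (Y ω))
  Bi-subst 𝒢 pX pY = go
    where
    module H = Filtration 𝒢
    go : ∀ {N g} → Bi N g → H.𝓕 N _
    go (cst c)   = H.cst c
    go vx        = pX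
    go vy        = pY
    go (add p q) = H.add (go p) (go q)
    go (mul p q) = H.mul (go p) (go q)
    go (wk le p) = H.wk le (go p)
    go (ext e p) = H.ext (λ ω → e _ _) (go p)

  Bi-line : ∀ m b {N g} → Bi N g → Deg N (λ t → g t (m * t + b))
  Bi-line m b = Bi-subst D.byDegree Deg-id (Deg-affine m b)

  -- The derivative of `pev L b`, by the product rule along Horner's scheme.
  dev : ℕ → (ℕ → C) → C → C
  dev zero    b z = 0#
  dev (suc L) b z = pev L (b ∘ suc) z + z * dev L (b ∘ suc) z

  -- The second-order Taylor remainder divided by `s * s`. It is built by the same recursion, so no
  -- factorial is inverted and the expansion holds in every characteristic.
  remainder : ℕ → (ℕ → C) → C → C → C
  remainder zero    b T s = 0#
  remainder (suc L) b T s = dev L (b ∘ suc) T + (T + s) * remainder L (b ∘ suc) T s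

  taylor : ∀ L b T s → pev L b (T + s) ≡ pev L b T + s * dev L b T + s * s * remainder L b T s
  taylor zero    b T s = solve 2 (λ b s → b := (b :+ s :* con (ℤ.+ 0)) :+ (s :* s) :* con (ℤ.+ 0)) refl (b 0) s
    where import Data.Integer as ℤ
  taylor (suc L) b T s = trans (cong (λ z → b 0 + (T + s) * z) (taylor L (b ∘ suc) T s))
    (solve 6 (λ b T s e e′ r → b :+ (T :+ s) :* ((e :+ s :* e′) :+ (s :* s) :* r)
                             := (b :+ T :* e) :+ s :* (e :+ T :* e′) :+ (s :* s) :* (e′ :+ (T :+ s) :* r)) refl
      (b 0) T s (pev L (b ∘ suc) T) (dev L (b ∘ suc) T) (remainder L (b ∘ suc) T s))

  private
    -- The offset `γ` is there for the induction: dropping the constant term turns it into `γ + 1#`.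
    pev-weighted : ∀ L b γ z → pev L (λ k → (γ + ℕ→F k) * b k) z ≡ γ * pev L b z + z * dev L b z
    pev-weighted zero    b γ z = trans (cong (_* b 0) (+-identityʳ γ)) (sym (trans (cong (γ * b 0 +_) (zeroʳ z)) (+-identityʳ _)))
    pev-weighted (suc L) b γ z = trans
      (cong₂ (λ x y → x + z * y) (cong (_* b 0) (+-identityʳ γ))
        (trans (pev-cong L z (λ k _ → cong (_* b (suc k)) (sym (+-assoc γ 1# (ℕ→F k))))) (pev-weighted L (b ∘ suc) (γ + 1#) z)))
      -- The solver reads its constant 1 as `ℕ→F 1`, which is `1# + 0#`.
      (trans (cong (λ o → γ * b 0 + z * ((γ + o) * pev L (b ∘ suc) z + z * dev L (b ∘ suc) z)) (sym (+-identityʳ 1#)))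
      (solve 5 (λ γ b z e e′ → γ :* b :+ z :* ((γ :+ con (ℤ.+ 1)) :* e :+ z :* e′) := γ :* (b :+ z :* e) :+ z :* (e :+ z :* e′)) refl
        γ (b 0) z (pev L (b ∘ suc) z) (dev L (b ∘ suc) z)))
      where import Data.Integer as ℤ

  pev-∂ : ∀ L (b : ℕ → C) z → pev L (λ k → ℕ→F (suc k) * b (suc k)) z ≡ dev (suc L) b z
  pev-∂ L b z = trans (pev-weighted L (b ∘ suc) 1# z) (cong (_+ z * dev L (b ∘ suc) z) (*-identityˡ _))

  module _ {Ω : Set} (𝒢 : Filtration Ω) where
    private module H = Filtration 𝒢

    private
      rot : ∀ N δ k → δ ℕ.+ (N ℕ.+ k) ≡ N ℕ.+ (δ ℕ.+ k)
      rot N δ k = trans (sym (ℕP.+-assoc δ N k)) (trans (cong (ℕ._+ k) (ℕP.+-comm δ N)) (ℕP.+-assoc N δ k))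

    pev-class : ∀ {N δ} L {b : ℕ → Ω → C} {Z} → (∀ k → H.𝓕 N (b k)) → H.𝓕 δ Z →
                H.𝓕 (N ℕ.+ L ℕ.* δ) (λ ω → pev L (λ k → b k ω) (Z ω))
    pev-class {N} zero    pb pZ = H.wk (ℕP.m≤m+n N 0) (pb 0)
    pev-class {N} {δ} (suc L) pb pZ = H.add (H.wk (ℕP.m≤m+n N _) (pb 0))
      (H.wk (ℕP.≤-reflexive (rot N δ (L ℕ.* δ))) (H.mul pZ (pev-class L (pb ∘ suc) pZ)))

    dev-class : ∀ {N δ} L {b : ℕ → Ω → C} {Z} → (∀ k → H.𝓕 N (b k)) → H.𝓕 δ Z →
                H.𝓕 (N ℕ.+ L ℕ.* δ) (λ ω → dev L (λ k → b k ω) (Z ω))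
    dev-class         zero    pb pZ = H.cst′ 0#
    dev-class {N} {δ} (suc L) pb pZ = H.add (H.wk (ℕP.+-monoʳ-≤ N (ℕP.m≤n+m _ δ)) (pev-class L (pb ∘ suc) pZ))
      (H.wk (ℕP.≤-reflexive (rot N δ (L ℕ.* δ))) (H.mul pZ (dev-class L (pb ∘ suc) pZ)))

    remainder-class : ∀ {N δ} L {b : ℕ → Ω → C} {T s} → (∀ k → H.𝓕 N (b k)) → H.𝓕 δ T → H.𝓕 δ s →
                H.𝓕 (N ℕ.+ L ℕ.* δ) (λ ω → remainder L (λ k → b k ω) (T ω) (s ω))
    remainder-class         zero    pb pT ps = H.cst′ 0#
    remainder-class {N} {δ} (suc L) pb pT ps = H.add (H.wk (ℕP.+-monoʳ-≤ N (ℕP.m≤n+m _ δ)) (dev-class L (pb ∘ suc) pT))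
      (H.wk (ℕP.≤-reflexive (rot N δ (L ℕ.* δ))) (H.mul (H.add pT ps) (remainder-class L (pb ∘ suc) pT ps)))

  split-0 : ∀ {N g} → Deg N g → ∃ λ h → Deg N h × (∀ t → g t ≡ g 0# + t * h t)
  split-0 (D.base (c , p)) = (λ _ → 0#) , DegF.cst 0# , λ t →
    trans (p t) (trans (sym (p 0#)) (sym (trans (cong (_ +_) (zeroʳ t)) (+-identityʳ _))))
  split-0 {suc N} {g} (D.step c g′ (k , pk) pg q) = g′ , DegF.wk (ℕP.n≤1+n N) pg , λ t →
    trans (q t) (cong (_+ t * g′ t) (trans (pk t) (trans (sym (pk 0#)) (sym (trans (q 0#) (trans (cong (c 0# +_) (zeroˡ _)) (+-identityʳ _)))))))

  drop-constant : ∀ {k} → k ≡ 0# → ∀ t g p h → (k + t * g) + (t * p) * h ≡ 0# → t * (g + p * h) ≡ 0#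
  drop-constant {k} k0 t g p h e = trans
    (solve 5 (λ k t g p h → t :* (g :+ p :* h) := ((k :+ t :* g) :+ (t :* p) :* h) :+ :- k) refl k t g p h)
    (trans (cong₂ (λ u v → u + - v) e k0) (trans (+-identityˡ _) -0#≈0#))

  -- The constant terms of `g` are removed one at a time: each vanishes by evaluation at 0, and then
  -- `t` is cancelled, which needs all degrees below `q`. In the end only `t` times `h` is left.
  high-zero : ∀ {N M g h} → Deg N g → Deg M h → suc (suc N ℕ.+ M) ℕ.< size →
              (∀ t → g t + t ^ suc N * h t ≡ 0#) → ∀ t → h t ≡ 0#
  high-zero {zero} {M} {g} {h} (D.base (c , p)) ph big e =
    cancel-t ph (ℕP.<-trans (ℕP.n<1+n _) big) λ t →
      trans (sym (trans (cong₂ _+_ (trans (p t) c0) (cong (_* h t) (*-identityʳ t))) (+-identityˡ _))) (e t)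
    where
    c0 : c ≡ 0#
    c0 = trans (sym (trans (cong₂ _+_ (p 0#) (trans (cong (_* h 0#) (zeroˡ 1#)) (zeroˡ _))) (+-identityʳ c))) (e 0#)
  high-zero {suc N} {M} {g} {h} (D.step c g′ (k , pk) pg q) ph big e =
    high-zero pg ph (ℕP.<-trans (ℕP.n<1+n _) big)
      (cancel-t (DegF.add (DegF.wk (ℕP.≤-trans (ℕP.m≤m+n N M) (ℕP.n≤1+n _)) pg)
          (DegF.wk (ℕP.≤-reflexive (cong (ℕ._+ M) (ℕP.*-identityʳ (suc N)))) (DegF.mul (DegF.pow (suc N) Deg-id) ph))) (ℕP.<-trans (ℕP.n<1+n _) big) λ t →
        drop-constant k0 t (g′ t) (t ^ suc N) (h t) (trans (cong (_+ t ^ suc (suc N) * h t) (sym (gt t))) (e t)))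
    where
    gt : ∀ t → g t ≡ k + t * g′ t
    gt t = trans (q t) (cong (_+ t * g′ t) (pk t))
    k0 : k ≡ 0#
    k0 = trans (solve 4 (λ k g p h → k := (k :+ con (ℤ.+ 0) :* g) :+ (con (ℤ.+ 0) :* p) :* h) refl k (g′ 0#) (0# ^ suc N) (h 0#))
      (trans (cong (_+ 0# ^ suc (suc N) * h 0#) (sym (gt 0#))) (e 0#))
      where import Data.Integer as ℤ

  -- Functions of (m , t) that are polynomials in t and m·t, graded by the power of t.
  module G = Adjoin (pullback proj₁ D.byDegree) proj₂ 1
  module GrF = Filtration G.byDegree

  Gr-fixed : ∀ {a N g} → G.Adj a N g → ∀ m → Deg N (λ t → g (m , t))
  Gr-fixed (G.base (h , p , q)) m = D.base (h m , λ t → q (m , t))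
  Gr-fixed (G.step c g′ (h , p , r) pg q) m = D.step (λ t → c (m , t)) (λ t → g′ (m , t)) (h m , λ t → r (m , t)) (Gr-fixed pg m) (λ t → q (m , t))

  Gr-at-0 : ∀ {a N g} → G.Adj a N g → ∃ λ τ → Deg a τ × (∀ m → g (m , 0#) ≡ τ m)
  Gr-at-0 (G.base (h , p , q)) = h , p , λ m → q (m , 0#)
  Gr-at-0 (G.step c g′ (h , p , r) pg q) = h , p , λ m →
    trans (q (m , 0#)) (trans (cong (c (m , 0#) +_) (zeroˡ _)) (trans (+-identityʳ _) (r (m , 0#))))

  Gr-x : G.Adj 0 1 proj₂
  Gr-x = G.Adj-ext (λ ω → *-identityʳ _) (G.Adj-shift {N = 0} {g = λ _ → 1#} (G.Adj-cst 0 1#))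

  Gr-y : G.Adj 0 1 (λ (m , t) → m * t)
  Gr-y = G.Adj-ext (λ (m , t) → *-comm t m) (G.Adj-shift {N = 0} {g = proj₁} (G.base (id , Deg-id , λ _ → refl)))

  -- `hi` is what remains of `g` beyond its first `j` coefficients in `t`. It is chosen before `m`,
  -- while the cancellation happens on one line at a time, so that facts found on separate slopes
  -- concern one polynomial. Its value at 0 has degree at most `j + a` in the slope.
  peel : ∀ j {a M g} → G.Adj a (j ℕ.+ M) g → ∃ λ hi → G.Adj (j ℕ.+ a) M hi ×
    (∀ m {κ M′} → Deg M′ κ → M ℕ.≤ M′ → suc (j ℕ.+ M′) ℕ.< size →
     (∀ t → g (m , t) + t ^ j * κ t ≡ 0#) → ∀ t → hi (m , t) + κ t ≡ 0#)
  peel zero    {g = g} p = g , p , λ m {κ} _ _ _ e t → trans (cong (g (m , t) +_) (sym (*-identityˡ (κ t)))) (e t)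
  peel (suc j) {a} {M} {g} (G.step c g′ (h , ph , r) pg q) with peel j pg
  ... | hi , phi , rec = hi , subst (λ k → G.Adj k M hi) (ℕP.+-suc j a) phi , main
    where
    main : ∀ m {κ M′} → Deg M′ κ → M ℕ.≤ M′ → suc (suc j ℕ.+ M′) ℕ.< size →
      (∀ t → g (m , t) + t ^ suc j * κ t ≡ 0#) → ∀ t → hi (m , t) + κ t ≡ 0#
    main m {κ} {M′} pκ M≤ big e = rec m pκ M≤ (ℕP.<-trans (ℕP.n<1+n _) big)
      (cancel-t (DegF.add (DegF.wk (ℕP.+-monoʳ-≤ j M≤) (Gr-fixed pg m))
         (DegF.wk (ℕP.≤-reflexive (cong (ℕ._+ M′) (ℕP.*-identityʳ j))) (DegF.mul (DegF.pow j Deg-id) pκ)))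
       (ℕP.<-trans (ℕP.n<1+n _) big) λ t →
        drop-constant k0 t (g′ (m , t)) (t ^ j) (κ t) (trans (cong (_+ t ^ suc j * κ t) (sym (gt t))) (e t)))
      where
      gt : ∀ t → g (m , t) ≡ h m + t * g′ (m , t)
      gt t = trans (q (m , t)) (cong (_+ t * g′ (m , t)) (r (m , t)))
      k0 : h m ≡ 0#
      k0 = trans (solve 4 (λ k g p h → k := (k :+ con (ℤ.+ 0) :* g) :+ (con (ℤ.+ 0) :* p) :* h) refl (h m) (g′ (m , 0#)) (0# ^ j) (κ 0#))
        (trans (cong (_+ 0# ^ suc j * κ 0#) (sym (gt 0#))) (e 0#))
        where import Data.Integer as ℤ

-- Hensel lifting along the lines through a point.

module HenselLifting (F : FiniteField) where

  open FieldArithmetic F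
  open Polynomials F
  open Bivariate F
  open import Data.Nat as ℕ using (ℕ; zero; suc; s≤s)
  import Data.Nat.Properties as ℕP
  open import Data.Product using (∃; _×_; _,_; proj₁; proj₂)
  open import Function using (_∘_)
  open import Relation.Binary.PropositionalEquality hiding ([_])

  open FiniteField F renaming (Carrier to C)
  open FF F using (size)
  open Solver using (solve; _:+_; _:*_; :-_; _:=_; con)

  -- Newton iteration along all lines through (a₁ , a₂) at once: as the root is simple there, the next Taylor
  -- coefficient on the line of slope m is a fixed multiple of a homogeneous part of B(x, y, T), hence a polynomial in m.
  module Hensel
    {N : ℕ} (L Δ : ℕ) (B : ℕ → C → C → C) (biB : ∀ k → Bi N (B k)) (a₁ a₂ ζ : C)
    (U : C → Set) (S : C → C → C)
    (S-deg : ∀ {m} → U m → Deg Δ (S m)) (S-0 : ∀ {m} → U m → S m 0# ≡ ζ)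
    (S-root : ∀ {m} → U m → ∀ t → pev L (λ k → B k (a₁ + t) (a₂ + m * t)) (S m t) ≡ 0#)
    (simple : dev L (λ k → B k a₁ a₂) ζ ≢ 0#) where

    -- The degree bound of `κ` below, which has to stay under `q` for the low coefficients to be
    -- cancelled.
    height : ℕ → ℕ
    height i = (suc i ℕ.+ Δ) ℕ.+ ((suc i ℕ.+ Δ) ℕ.+ (N ℕ.+ L ℕ.* (suc i ℕ.+ Δ)))

    -- A single `T` serves all slopes in `U`. The error factor `h` keeps the bound `Δ` at every
    -- order, which is all that `split-0` needs.
    Approximation : ℕ → Set
    Approximation i = ∃ λ T → G.Adj 0 i T ×
      (∀ {m} → U m → ∃ λ h → Deg Δ h × (∀ t → S m t ≡ T (m , t) + t ^ suc i * h t))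

    start : Approximation 0
    start = (λ _ → ζ) , G.Adj-cst 0 ζ , λ {m} u → first u (split-0 (S-deg u))
      where
      first : ∀ {m} → U m → (∃ λ h → Deg Δ h × (∀ t → S m t ≡ S m 0# + t * h t)) →
              ∃ λ h → Deg Δ h × (∀ t → S m t ≡ ζ + t ^ 1 * h t)
      first u (h , ph , e) = h , ph , λ t → trans (e t) (cong₂ _+_ (S-0 u) (cong (_* h t) (sym (*-identityʳ t))))

    module Step (i : ℕ) (big : suc (suc i ℕ.+ height i) ℕ.< size) (T : C × C → C) (pT : G.Adj 0 i T) where

      coeff : ℕ → C × C → C
      coeff k (m , t) = B k (a₁ + t) (a₂ + m * t)

      coeff-Gr : ∀ k → G.Adj 0 N (coeff k)
      coeff-Gr k = Bi-subst G.byDegree (GrF.add (GrF.cst′ a₁) Gr-x) (GrF.add (GrF.cst′ a₂) Gr-y) (biB k)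

      W : C × C → C
      W ω = pev L (λ k → coeff k ω) (T ω)

      M : ℕ
      M = N ℕ.+ L ℕ.* i

      -- Padded by `suc i`, so that `peel` can take off `suc i` coefficients whatever `M` is.
      pW : G.Adj 0 (suc i ℕ.+ M) W
      pW = G.Adj-pad (ℕP.m≤n+m M (suc i)) (pev-class G.byDegree L coeff-Gr pT)

      δ ι : C
      δ = dev L (λ k → B k a₁ a₂) ζ
      ι = proj₁ (inverse δ simple)

      δι : δ * ι ≡ 1#
      δι = proj₂ (inverse δ simple)

      module Corrected (hi : C × C → C) (τ : C → C) (hi-0 : ∀ m → hi (m , 0#) ≡ τ m)
        (peeled : ∀ m {κ M′} → Deg M′ κ → M ℕ.≤ M′ → suc (suc i ℕ.+ M′) ℕ.< size →
                  (∀ t → W (m , t) + t ^ suc i * κ t ≡ 0#) → ∀ t → hi (m , t) + κ t ≡ 0#)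
        {m : C} (u : U m) (h : C → C) (ph : Deg Δ h) (S≡ : ∀ t → S m t ≡ T (m , t) + t ^ suc i * h t) where

        b : ℕ → C → C
        b k t = coeff k (m , t)

        pb : ∀ k → Deg N (b k)
        pb k = Gr-fixed (coeff-Gr k) m

        T₀ : C → C
        T₀ t = T (m , t)

        s : C → C
        s t = t ^ suc i * h t

        e : ℕ
        e = suc i ℕ.+ Δ

        pt^ : Deg (suc i) (λ t → t ^ suc i)
        pt^ = subst (λ k → Deg k (λ t → t ^ suc i)) (ℕP.*-identityʳ (suc i)) (DegF.pow (suc i) Deg-id)

        ps : Deg e s
        ps = DegF.mul pt^ ph

        pT₀ : Deg e T₀
        pT₀ = DegF.wk (ℕP.≤-trans (ℕP.n≤1+n i) (ℕP.m≤m+n (suc i) Δ)) (Gr-fixed pT m)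

        dv rm κ : C → C
        dv t = dev L (λ k → b k t) (T₀ t)
        rm t = remainder L (λ k → b k t) (T₀ t) (s t)
        -- The first- and second-order Taylor terms at `T₀` with increment `s`, after division by
        -- `t ^ suc i`.
        κ t  = h t * dv t + s t * (h t * rm t)

        pκ : Deg (height i) κ
        pκ = DegF.add
          (DegF.wk (ℕP.+-mono-≤ (ℕP.m≤n+m Δ (suc i)) (ℕP.m≤n+m _ e)) (DegF.mul ph (dev-class D.byDegree L pb pT₀)))
          (DegF.mul ps (DegF.wk (ℕP.+-monoˡ-≤ _ (ℕP.m≤n+m Δ (suc i))) (DegF.mul ph (remainder-class D.byDegree L pb pT₀ ps))))

        identity : ∀ t → W (m , t) + t ^ suc i * κ t ≡ 0#
        identity t = trans
          (solve 6 (λ w p h d r s → w :+ p :* (h :* d :+ s :* (h :* r)) := w :+ (p :* h) :* d :+ ((p :* h) :* s) :* r) refl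
            (W (m , t)) (t ^ suc i) (h t) (dv t) (rm t) (s t))
          (trans (sym (taylor L (λ k → b k t) (T₀ t) (s t)))
          (trans (cong (pev L (λ k → b k t)) (sym (S≡ t))) (S-root u t)))

        M≤ : M ℕ.≤ height i
        M≤ = ℕP.≤-trans (ℕP.+-monoʳ-≤ N (ℕP.*-monoʳ-≤ L (ℕP.≤-trans (ℕP.n≤1+n i) (ℕP.m≤m+n (suc i) Δ))))
               (ℕP.≤-trans (ℕP.m≤n+m _ e) (ℕP.m≤n+m _ e))

        hi+κ : ∀ t → hi (m , t) + κ t ≡ 0#
        hi+κ = peeled m pκ M≤ big identity

        0^ : ∀ x → 0# ^ suc i * x ≡ 0#
        0^ x = trans (cong (_* x) (zeroˡ _)) (zeroˡ x)

        T₀-0 : T₀ 0# ≡ ζ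
        T₀-0 = trans (sym (trans (S≡ 0#) (trans (cong (T₀ 0# +_) (0^ (h 0#))) (+-identityʳ _)))) (S-0 u)

        dv-0 : dv 0# ≡ δ
        dv-0 = trans (cong (dev L (λ k → b k 0#)) T₀-0) (dev-cong L ζ λ k →
          cong₂ (B k) (+-identityʳ a₁) (trans (cong (a₂ +_) (zeroʳ m)) (+-identityʳ a₂)))
          where
          dev-cong : ∀ L {c c′} z → (∀ k → c k ≡ c′ k) → dev L c z ≡ dev L c′ z
          dev-cong zero    z q = refl
          dev-cong (suc L) z q = cong₂ (λ x y → x + z * y) (pev-cong L z (λ k _ → q (suc k))) (dev-cong L z (q ∘ suc))

        h-0 : h 0# ≡ - ι * τ m
        h-0 = begin
          h 0#                                   ≡⟨ *-identityʳ _ ⟨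
          h 0# * 1#                              ≡⟨ cong (h 0# *_) δι ⟨
          h 0# * (δ * ι)                         ≡⟨ solve 4 (λ h d i t → h :* (d :* i) := (t :+ h :* d) :* i :+ (:- i :* t)) refl (h 0#) δ ι (τ m) ⟩
          (τ m + h 0# * δ) * ι + - ι * τ m       ≡⟨ cong (λ z → z * ι + - ι * τ m) sum0 ⟩
          0# * ι + - ι * τ m                     ≡⟨ cong (_+ - ι * τ m) (zeroˡ ι) ⟩
          0# + - ι * τ m                         ≡⟨ +-identityˡ _ ⟩
          - ι * τ m                              ∎
          where
          open ≡-Reasoning
          -- At `t = 0` the increment `s` vanishes, so `κ` reduces to `h 0# * δ`. Since `δ` does not
          -- involve `m`, the new coefficient is a constant multiple of the polynomial `τ`.
          sum0 : τ m + h 0# * δ ≡ 0#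
          sum0 = begin
            τ m + h 0# * δ                 ≡⟨ cong₂ _+_ (hi-0 m) (trans (cong (_+ s 0# * (h 0# * rm 0#)) (cong (h 0# *_) dv-0))
                                              (trans (cong (h 0# * δ +_) (trans (cong (_* (h 0# * rm 0#)) (0^ (h 0#))) (zeroˡ _))) (+-identityʳ _))) ⟨
            hi (m , 0#) + κ 0#             ≡⟨ hi+κ 0# ⟩
            0#                             ∎

        next : ∃ λ h′ → Deg Δ h′ × (∀ t → S m t ≡ (T (m , t) + t ^ suc i * (- ι * τ m)) + t ^ suc (suc i) * h′ t)
        next with split-0 ph
        ... | h′ , ph′ , e = h′ , ph′ , λ t → begin
          S m t                                                    ≡⟨ S≡ t ⟩
          T₀ t + t ^ suc i * h t                                   ≡⟨ cong (λ z → T₀ t + t ^ suc i * z) (trans (e t) (cong (_+ t * h′ t) h-0)) ⟩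
          T₀ t + t ^ suc i * (- ι * τ m + t * h′ t)                ≡⟨ solve 5 (λ T p c t h → T :+ p :* (c :+ t :* h) := (T :+ p :* c) :+ (t :* p) :* h) refl (T₀ t) (t ^ suc i) (- ι * τ m) t (h′ t) ⟩
          (T₀ t + t ^ suc i * (- ι * τ m)) + t ^ suc (suc i) * h′ t ∎
          where open ≡-Reasoning

      result : (∀ {m} → U m → ∃ λ h → Deg Δ h × (∀ t → S m t ≡ T (m , t) + t ^ suc i * h t)) → Approximation (suc i)
      result ap with peel (suc i) {M = M} pW
      ... | hi , phi , peeled with Gr-at-0 phi
      ...   | τ , pτ , hi-0 = (λ (m , t) → T (m , t) + t ^ suc i * (- ι * τ m)) ,
        GrF.add (GrF.wk (ℕP.n≤1+n i) pT)
          (G.Adj-t^ (suc i) ((λ m → - ι * τ m) ,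
            DegF.wk (ℕP.≤-reflexive (cong (ℕ._+ 0) (sym (ℕP.*-identityʳ (suc i))))) (DegF.mul (DegF.cst (- ι)) pτ) , λ _ → refl)) ,
        λ {m} u → let (h , ph , S≡) = ap u in Corrected.next hi τ hi-0 peeled u h ph S≡

    -- After order `Δ` the error is a multiple of `t ^ suc Δ`, whereas `S m` and `T` have degree at
    -- most `Δ` in `t`; so `high-zero` removes it.
    lift : suc (suc Δ ℕ.+ height Δ) ℕ.< size → ∃ λ T → G.Adj 0 Δ T × (∀ {m} → U m → ∀ t → S m t ≡ T (m , t))
    lift big with approx Δ ℕP.≤-refl
      where
      approx : ∀ i → i ℕ.≤ Δ → Approximation i
      approx zero    _  = start
      approx (suc i) le with approx i (ℕP.≤-trans (ℕP.n≤1+n i) le)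
      ... | T , pT , ap = Step.result i (ℕP.≤-<-trans (s≤s (s≤s (ℕP.+-mono-≤ i≤ mono))) big) T pT ap
        where
        i≤ = ℕP.≤-trans (ℕP.n≤1+n i) le
        e≤ = s≤s (ℕP.+-monoˡ-≤ Δ i≤)
        mono : height i ℕ.≤ height Δ
        mono = ℕP.+-mono-≤ e≤ (ℕP.+-mono-≤ e≤ (ℕP.+-monoʳ-≤ N (ℕP.*-monoʳ-≤ L e≤)))
    ... | T , pT , ap = T , pT , exact
      where
      exact : ∀ {m} → U m → ∀ t → S m t ≡ T (m , t)
      exact {m} u t with ap u
      ... | h , ph , e = trans (e t) (trans (cong (λ z → T (m , t) + t ^ suc Δ * z) (h0 t)) (trans (cong (T (m , t) +_) (zeroʳ _)) (+-identityʳ _)))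
        where
        h0 : ∀ t → h t ≡ 0#
        h0 = high-zero (DegF.sub (Gr-fixed pT m) (S-deg u)) ph
          (ℕP.≤-<-trans (s≤s (ℕP.+-monoʳ-≤ (suc Δ) (ℕP.≤-trans (ℕP.m≤n+m Δ (suc Δ)) (ℕP.m≤m+n _ _)))) big)
          λ t → trans (cong (λ z → (T (m , t) + - z) + t ^ suc Δ * h t) (e t))
            (trans (solve 2 (λ T p → (T :+ :- (T :+ p)) :+ p := con (ℤ.+ 0)) refl (T (m , t)) (t ^ suc Δ * h t)) refl)
          where import Data.Integer as ℤ

  -- With `x = t` and `y = m * t` the monomial `m^k t^a` is `x^(a−k) y^k`. The degree bound in `m`
  -- is exactly what keeps the exponent of `x` nonnegative.
  homogenize : ∀ {a τ} → Deg a τ → ∃ λ H → Bi a H × (∀ m t → H t (m * t) ≡ t ^ a * τ m)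
  homogenize (D.base (c , p)) = (λ _ _ → c) , cst c , λ m t → trans (sym (p m)) (sym (*-identityˡ _))
  homogenize {suc a} {τ} (D.step d τ′ (c , pc) pτ q) with homogenize pτ
  ... | H , pH , e = (λ x y → c * x ^ suc a + y * H x y) ,
    add (wk (ℕP.≤-reflexive (ℕP.*-identityʳ (suc a))) (mul (cst c) (BiF.pow (suc a) vx))) (mul vy pH) ,
    λ m t → trans (cong (λ z → c * t ^ suc a + (m * t) * z) (e m t))
      (trans (solve 5 (λ c t p m τ → c :* (t :* p) :+ (m :* t) :* (p :* τ) := (t :* p) :* (c :+ m :* τ)) refl c t (t ^ a) m (τ′ m))
        (cong (t ^ suc a *_) (sym (trans (q m) (cong (_+ m * τ′ m) (pc m))))))

  Gr⇒Bi : ∀ {a N T} → G.Adj a N T → ∃ λ g → Bi (a ℕ.+ N) g × (∀ m t → g t (m * t) ≡ t ^ a * T (m , t))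
  Gr⇒Bi {a} (G.base (τ , pτ , q)) with homogenize pτ
  ... | H , pH , e = H , wk (ℕP.m≤m+n a 0) pH , λ m t → trans (e m t) (cong (t ^ a *_) (sym (q (m , t))))
  Gr⇒Bi {a} {suc N} (G.step c T′ (τ , pτ , r) pT q) with homogenize pτ | Gr⇒Bi pT
  ... | H , pH , e | g , pg , e′ = (λ x y → H x y + g x y) ,
    add (wk (ℕP.m≤m+n a (suc N)) pH) (wk (ℕP.≤-reflexive (sym (ℕP.+-suc a N))) pg) ,
    λ m t → trans (cong₂ _+_ (e m t) (e′ m t))
      (trans (solve 4 (λ p τ t T → p :* τ :+ (t :* p) :* T := p :* (τ :+ t :* T)) refl (t ^ a) (τ m) t (T′ (m , t)))
        (cong (t ^ a *_) (sym (trans (q (m , t)) (cong (_+ t * T′ (m , t)) (r (m , t)))))))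

-- Frobenius powers and the descent to a separable polynomial.

module FrobeniusDescent (F : FiniteField) where

  open FiniteSums
  open FieldArithmetic F
  open Polynomials F
  open Bivariate F
  open import Data.Nat as ℕ using (ℕ; zero; suc; z≤n; s≤s; _!)
  import Data.Nat.Properties as ℕP
  open import Data.Nat.Combinatorics using (nCk≡n!/k![n-k]!; k![n∸k]!∣n!; nCn≡1) renaming (_C_ to _choose_)
  open import Data.Nat.Divisibility using (_∣_; divides; _∣?_; ∣m+n∣m⇒∣n; ∣-refl; ∣⇒≤; _∣0)
  open import Data.Nat.DivMod using (m/n*n≡m; m≡m%n+[m/n]*n; m%n<n; _/_; _%_)
  open import Data.Fin using (Fin; toℕ; fromℕ) renaming (zero to fz; suc to fs)
  import Data.Fin.Properties as FinP
  open import Data.List.Relation.Unary.All as All using (all?)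
  open import Data.List.Relation.Unary.Any using (any?)
  open import Data.List.Membership.Propositional using (find; lose)
  open import Data.Product using (∃; _×_; _,_)
  open import Data.Sum using (_⊎_; inj₁; inj₂)
  open import Data.Empty using (⊥-elim)
  open import Function using (_∘_)
  open import Relation.Nullary using (¬_; Dec; yes; no; _×-dec_; ¬?)
  open import Relation.Nullary.Decidable using (map′)
  open import Relation.Binary.PropositionalEquality hiding ([_])
  open import Algebra.Bundles using (CommutativeRing)
  import Algebra.Properties.CommutativeSemiring.Binomial
  import Algebra.Properties.Semiring.Sum
  import Algebra.Properties.Semiring.Exp
  import Algebra.Properties.Monoid.Mult

  open FiniteField F renaming (Carrier to C)
  open FF F using (size; ℕ→F; points)
  open Solver using (solve; _:+_; _:*_; :-_; _:=_; con)

  private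
    semiring = CommutativeRing.semiring ring
    module Bin = Algebra.Properties.CommutativeSemiring.Binomial (CommutativeRing.commutativeSemiring ring)
    module Sm = Algebra.Properties.Semiring.Sum semiring
    module Ex = Algebra.Properties.Semiring.Exp semiring
    module Mu = Algebra.Properties.Monoid.Mult (CommutativeRing.+-monoid ring)

  -- Stands for `n` being 1 or a power of the characteristic: it holds for 1 and for the
  -- characteristic, passes to products, and makes the n-th power a ring homomorphism.
  Additive : ℕ → Set
  Additive n = ∀ x y → (x + y) ^ n ≡ x ^ n + y ^ n

  IsChar : ℕ → Set
  IsChar p = 1 ℕ.< p × ℕ→F p ≡ 0# × (∀ j → 0 ℕ.< j → j ℕ.< p → ℕ→F j ≢ 0#)

  private
    search : ∀ b → (∃ IsChar) ⊎ (∀ j → 0 ℕ.< j → j ℕ.≤ b → ℕ→F j ≢ 0#)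
    search zero    = inj₂ λ j 0<j j≤0 → ⊥-elim (ℕP.<⇒≱ 0<j j≤0)
    search (suc b) with search b
    ... | inj₁ r = inj₁ r
    ... | inj₂ h with ℕ→F (suc b) ≟ 0#
    ...   | no ¬z = inj₂ λ j 0<j j≤ → case j 0<j (ℕP.m≤n⇒m<n∨m≡n j≤)
      where
      case : ∀ j → 0 ℕ.< j → j ℕ.< suc b ⊎ j ≡ suc b → ℕ→F j ≢ 0#
      case j 0<j (inj₁ (s≤s j≤b)) = h j 0<j j≤b
      case j 0<j (inj₂ refl)      = ¬z
    search (suc zero)    | inj₂ h | yes z = ⊥-elim (0≢1 (trans (sym z) (+-identityʳ 1#)))
    search (suc (suc b)) | inj₂ h | yes z = inj₁ (suc (suc b) , s≤s (s≤s z≤n) , z , λ j 0<j j<p → h j 0<j (ℕP.≤-pred j<p))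

  characteristic : ∀ k → ℕ→F (suc k) ≡ 0# → ∃ IsChar
  characteristic k z with search (suc k)
  ... | inj₁ r = r
  ... | inj₂ h = ⊥-elim (h (suc k) (s≤s z≤n) ℕP.≤-refl z)

  char-∣ : ∀ {p} → IsChar p → ∀ k → ℕ→F k ≡ 0# → p ∣ k
  char-∣ {suc p} (_ , pz , min) k z = divides (k / suc p) (trans (m≡m%n+[m/n]*n k (suc p)) (cong (ℕ._+ k / suc p ℕ.* suc p) r0))
    where
    rz : ℕ→F (k % suc p) ≡ 0#
    rz = begin
      ℕ→F (k % suc p)                                            ≡⟨ +-identityʳ _ ⟨
      ℕ→F (k % suc p) + 0#                                       ≡⟨ cong (ℕ→F (k % suc p) +_) (trans (cong (ℕ→F (k / suc p) *_) pz) (zeroʳ _)) ⟨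
      ℕ→F (k % suc p) + ℕ→F (k / suc p) * ℕ→F (suc p)            ≡⟨ cong (ℕ→F (k % suc p) +_) (ℕ→F-* (k / suc p) (suc p)) ⟨
      ℕ→F (k % suc p) + ℕ→F (k / suc p ℕ.* suc p)                ≡⟨ ℕ→F-+ (k % suc p) _ ⟨
      ℕ→F (k % suc p ℕ.+ k / suc p ℕ.* suc p)                    ≡⟨ cong ℕ→F (m≡m%n+[m/n]*n k (suc p)) ⟨
      ℕ→F k                                                      ≡⟨ z ⟩
      0#                                                         ∎
      where open ≡-Reasoning
    r0 : k % suc p ≡ 0
    r0 with k % suc p in eq
    ... | zero  = refl
    ... | suc r = ⊥-elim (min (suc r) (s≤s z≤n) (subst (ℕ._< suc p) eq (m%n<n k (suc p))) (subst (λ j → ℕ→F j ≡ 0#) eq rz))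

  private
    factorial≢0 : ∀ {p} → IsChar p → ∀ k → k ℕ.< p → ℕ→F (k !) ≢ 0#
    factorial≢0 ch zero    _  z = 0≢1 (trans (sym z) (+-identityʳ 1#))
    factorial≢0 ch@(_ , _ , min) (suc k) lt z with *-zero (trans (sym (ℕ→F-* (suc k) (k !))) z)
    ... | inj₁ q = min (suc k) (s≤s z≤n) lt q
    ... | inj₂ q = factorial≢0 ch k (ℕP.<-trans (ℕP.n<1+n k) lt) q

    -- The factorial of the characteristic is zero in the field, whereas those of `k` and of the
    -- complementary number are not, being products of integers below the least vanishing one.
    middle : ∀ {p} → IsChar p → ∀ k → 0 ℕ.< k → k ℕ.< p → ℕ→F (p choose k) ≡ 0#
    middle {suc p} ch@(_ , pz , _) k 0<k k<p with *-zero prod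
      where
      instance _ = k ℕP.!* (suc p ℕ.∸ k) !≢0
      prod : ℕ→F (suc p choose k) * ℕ→F (k ! ℕ.* (suc p ℕ.∸ k) !) ≡ 0#
      prod = begin
        ℕ→F (suc p choose k) * ℕ→F (k ! ℕ.* (suc p ℕ.∸ k) !)   ≡⟨ ℕ→F-* (suc p choose k) _ ⟨
        ℕ→F ((suc p choose k) ℕ.* (k ! ℕ.* (suc p ℕ.∸ k) !))   ≡⟨ cong ℕ→F (trans (cong (ℕ._* (k ! ℕ.* (suc p ℕ.∸ k) !)) (nCk≡n!/k![n-k]! (ℕP.<⇒≤ k<p)))
                                                               (m/n*n≡m (k![n∸k]!∣n! (ℕP.<⇒≤ k<p)))) ⟩
        ℕ→F (suc p ℕ.* p !)                                ≡⟨ ℕ→F-* (suc p) (p !) ⟩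
        ℕ→F (suc p) * ℕ→F (p !)                            ≡⟨ trans (cong (_* ℕ→F (p !)) pz) (zeroˡ _) ⟩
        0#                                                 ∎
        where open ≡-Reasoning
    ... | inj₁ q = q
    ... | inj₂ q with *-zero (trans (sym (ℕ→F-* (k !) ((suc p ℕ.∸ k) !))) q)
    ...   | inj₁ r = ⊥-elim (factorial≢0 ch k k<p r)
    ...   | inj₂ r = ⊥-elim (factorial≢0 ch (suc p ℕ.∸ k) (ℕP.∸-monoʳ-< 0<k (ℕP.<⇒≤ k<p)) r)

    ^-agree : ∀ x n → x ^ n ≡ x Ex.^ n
    ^-agree x zero    = refl
    ^-agree x (suc n) = cong (x *_) (^-agree x n)

    ×-agree : ∀ n x → n Mu.× x ≡ ℕ→F n * x
    ×-agree zero    x = sym (zeroˡ x)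
    ×-agree (suc n) x = trans (cong (x +_) (×-agree n x)) (sym (trans (distribʳ x 1# _) (cong (_+ ℕ→F n * x) (*-identityˡ x))))

    sum-last : ∀ n (f : Fin (suc n) → C) → (∀ i → toℕ i ≢ n → f i ≡ 0#) → Sm.sum f ≡ f (fromℕ n)
    sum-last zero    f h = +-identityʳ _
    sum-last (suc n) f h = trans (cong₂ _+_ (h fz λ ()) (sum-last n (f ∘ fs) λ i ne → h (fs i) (ne ∘ ℕP.suc-injective))) (+-identityˡ _)

  Additive-char : ∀ {p} → IsChar p → Additive p
  Additive-char {suc p} ch x y = begin
    (x + y) ^ suc p                               ≡⟨ ^-agree (x + y) (suc p) ⟩
    (x + y) Ex.^ suc p                            ≡⟨ Bin.theorem (suc p) x y ⟩
    term fz + Sm.sum (term ∘ fs)                  ≡⟨ cong₂ _+_ first (trans (sum-last p (term ∘ fs) mid) last) ⟩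
    y ^ suc p + x ^ suc p                         ≡⟨ +-comm _ _ ⟩
    x ^ suc p + y ^ suc p                         ∎
    where
    open ≡-Reasoning
    term : Fin (suc (suc p)) → C
    term = Bin.binomialTerm x y (suc p)
    term≡ : ∀ i → term i ≡ ℕ→F (suc p choose toℕ i) * (x Ex.^ toℕ i * y Ex.^ (suc p ℕ.∸ toℕ i))
    term≡ i = ×-agree (suc p choose toℕ i) _
    first : term fz ≡ y ^ suc p
    first = trans (term≡ fz) (trans (cong (_* (1# * y Ex.^ suc p)) (+-identityʳ 1#)) (trans (*-identityˡ _) (trans (*-identityˡ _) (sym (^-agree y (suc p))))))
    mid : ∀ i → toℕ i ≢ p → term (fs i) ≡ 0#
    mid i ne = trans (term≡ (fs i)) (trans (cong (_* (x Ex.^ suc (toℕ i) * y Ex.^ (p ℕ.∸ toℕ i))) (middle ch (suc (toℕ i)) (s≤s z≤n)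
      (s≤s (ℕP.≤∧≢⇒< (ℕP.≤-pred (FinP.toℕ<n i)) ne)))) (zeroˡ _))
    last : term (fs (fromℕ p)) ≡ x ^ suc p
    last = trans (term≡ (fs (fromℕ p))) (trans (cong (λ k → ℕ→F (suc p choose suc k) * (x Ex.^ suc k * y Ex.^ (p ℕ.∸ k))) (FinP.toℕ-fromℕ p))
      (trans (cong₂ (λ c e → ℕ→F c * (x Ex.^ suc p * y Ex.^ e)) (nCn≡1 (suc p)) (ℕP.n∸n≡0 p))
      (trans (cong (_* (x Ex.^ suc p * 1#)) (+-identityʳ 1#)) (trans (*-identityˡ _) (trans (*-identityʳ _) (sym (^-agree x (suc p))))))))

  Additive-1 : Additive 1
  Additive-1 x y = trans (*-identityʳ _) (sym (cong₂ _+_ (*-identityʳ x) (*-identityʳ y)))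

  Additive-* : ∀ {m n} → Additive m → Additive n → Additive (m ℕ.* n)
  Additive-* {m} {n} am an x y = trans (^-* (x + y) m n) (trans (cong (_^ n) (am x y)) (trans (an _ _) (sym (cong₂ _+_ (^-* x m n) (^-* y m n)))))

  private
    pev-head : ∀ r (b : ℕ → C) z → (∀ k → k ℕ.≤ r → k ≢ 0 → b k ≡ 0#) → pev r b z ≡ b 0
    pev-head zero    b z h = refl
    pev-head (suc r) b z h = trans (cong (λ e → b 0 + z * e)
        (trans (pev-head r (b ∘ suc) z λ k le _ → h (suc k) (s≤s le) λ ()) (h 1 (s≤s z≤n) λ ())))
      (trans (cong (b 0 +_) (zeroʳ z)) (+-identityʳ _))

    pev-shift : ∀ p M (b : ℕ → C) z → (∀ k → k ℕ.< p → b k ≡ 0#) → pev (p ℕ.+ M) b z ≡ z ^ p * pev M (b ∘ (p ℕ.+_)) z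
    pev-shift zero    M b z h = sym (*-identityˡ _)
    pev-shift (suc p) M b z h = trans (cong₂ (λ x y → x + z * y) (h 0 (s≤s z≤n)) (pev-shift p M (b ∘ suc) z λ k lt → h (suc k) (s≤s lt)))
      (trans (+-identityˡ _) (sym (*-assoc _ _ _)))

  -- Blocks of `p` coefficients are taken off, in each of which only the first can be nonzero. The
  -- last block may be cut short, after index `r`.
  decimate : ∀ {p} → 0 ℕ.< p → ∀ L′ {r} → r ℕ.< p → ∀ b z → (∀ k → k ℕ.≤ L′ ℕ.* p ℕ.+ r → ¬ p ∣ k → b k ≡ 0#) →
             pev (L′ ℕ.* p ℕ.+ r) b z ≡ pev L′ (λ j → b (j ℕ.* p)) (z ^ p)
  decimate {suc p} _ zero     {r} lt b z h = pev-head r b z λ k le ne →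
    h k le λ d → ℕP.<⇒≱ (ℕP.≤-<-trans le lt) (∣⇒≤ {{ℕ.≢-nonZero ne}} d)
  decimate {suc p} 0<p (suc L′) {r} lt b z h = trans (cong (λ k → pev (suc k) b z) (ℕP.+-assoc p (L′ ℕ.* suc p) r))
    (trans (cong (λ e → b 0 + z * e) (pev-shift p M (b ∘ suc) z λ k k<p → h (suc k) (ℕP.≤-trans k<p (ℕP.≤-trans (ℕP.m≤m+n p M) (ℕP.≤-trans (ℕP.n≤1+n _) (ℕP.≤-reflexive Leq))))
              λ d → ℕP.<⇒≱ (s≤s k<p) (∣⇒≤ d)))
    (trans (sym (cong (b 0 +_) (*-assoc z (z ^ p) _)))
    (cong (λ e → b 0 + z ^ suc p * e) (decimate 0<p L′ lt (b ∘ (suc p ℕ.+_)) z λ k le nd →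
      h (suc p ℕ.+ k) (ℕP.≤-trans (ℕP.+-monoʳ-≤ (suc p) le) (ℕP.≤-reflexive Leq)) λ d → nd (∣m+n∣m⇒∣n d ∣-refl)))))
    where
    M = L′ ℕ.* suc p ℕ.+ r
    Leq : suc p ℕ.+ M ≡ suc L′ ℕ.* suc p ℕ.+ r
    Leq = sym (ℕP.+-assoc (suc p) (L′ ℕ.* suc p) r)

  allF? : ∀ {P : C → Set} → (∀ t → Dec (P t)) → Dec (∀ t → P t)
  allF? P? = map′ (λ h t → All.lookup h (complete t)) (λ h → All.tabulate λ {t} _ → h t) (all? P? elements)

  anyF? : ∀ {P : C → Set} → (∀ t → Dec (P t)) → Dec (∃ P)
  anyF? P? = map′ (λ h → let (x , _ , p) = find h in x , p) (λ (x , p) → lose (complete x) p) (any? P? elements)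

  -- The lines of one slope meet the vertical line through `(x , y)` in distinct points, and on that
  -- vertical line `g` is a nonzero polynomial of degree at most `N`. So each slope contributes at
  -- most `N` lines.
  vanishing-lines : ∀ {N g} → Bi N g → ∀ {x y} → g x y ≢ 0# →
    {P : C × C → Set} (P? : ∀ ℓ → Dec (P ℓ)) → (∀ {m b} → P (m , b) → ∀ t → g t (m * t + b) ≡ 0#) →
    ∑ points (λ ℓ → [ P? ℓ ]) ℕ.≤ size ℕ.* N
  vanishing-lines {N} {g} pg {x} {y} nz P? van = begin
    ∑ points (λ ℓ → [ P? ℓ ])                                   ≡⟨ ∑-× (λ ℓ → [ P? ℓ ]) elements elements ⟩
    ∑ elements (λ m → ∑ elements (λ b → [ P? (m , b) ]))        ≤⟨ ∑-≤-* _ elements row ⟩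
    size ℕ.* N                                                  ∎
    where
    open ℕP.≤-Reasoning
    row : ∀ m → ∑ elements (λ b → [ P? (m , b) ]) ℕ.≤ N
    row m = ℕP.≤-trans (∑-mono elements λ b → []-mono (P? (m , b)) (g x (m * x + b) ≟ 0#) (λ p → van p x))
      (few-zeros {g = λ b → g x (m * x + b)}
        (Bi-subst D.byDegree (DegF.cst′ x) (DegF.add (DegF.cst′ (m * x)) Deg-id) pg)
        {y + - (m * x)} (nz ∘ trans (cong (g x) (solve 2 (λ c y → y := c :+ (y :+ :- c)) refl (m * x) y))))

  ∂ : (ℕ → C → C → C) → ℕ → C → C → C
  ∂ B k x y = ℕ→F (suc k) * B (suc k) x y

  Bi-∂ : ∀ {N B} → (∀ k → Bi N (B k)) → ∀ k → Bi N (∂ B k)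
  Bi-∂ pB k = mul (cst _) (pB (suc k))

  NonZero : ℕ → (ℕ → C → C → C) → Set
  NonZero L B = ∃ λ k → k ℕ.< suc L × ∃ λ x → ∃ λ y → B k x y ≢ 0#

  nonZero? : ∀ L B → Dec (NonZero L B)
  nonZero? L B = ℕP.anyUpTo? (λ k → anyF? λ x → anyF? λ y → ¬? (B k x y ≟ 0#)) (suc L)

  -- A polynomial in z has a nonzero z-derivative or is a polynomial in z^p; both cases lower its degree L, and a
  -- nonzero polynomial in x, y alone vanishes on few lines.  So one of the at most L derivatives loses many lines.
  module Descent (R : C → C → C → C) {G : C × C → Set} (G? : ∀ ℓ → Dec (G ℓ)) (N r M : ℕ) where

    Vanish : ℕ → ℕ → (ℕ → C → C → C) → C × C → Set
    Vanish n L B (m , b) = ∀ t → pev L (λ k → B k t (m * t + b)) (R m b t ^ n) ≡ 0#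

    vanish? : ∀ n L B ℓ → Dec (Vanish n L B ℓ)
    vanish? n L B (m , b) = allF? λ t → pev L (λ k → B k t (m * t + b)) (R m b t ^ n) ≟ 0#

    on : ℕ → ℕ → (ℕ → C → C → C) → ℕ
    on n L B = ∑ points (λ ℓ → [ G? ℓ ×-dec vanish? n L B ℓ ])

    -- On such a line the n-th power of `R` is a root of `B` that is simple outside the zeros of a
    -- nonzero polynomial in `t`.
    simple? : ∀ n L B ℓ → Dec ((G ℓ × Vanish n (suc L) B ℓ) × ¬ Vanish n L (∂ B) ℓ)
    simple? n L B ℓ = (G? ℓ ×-dec vanish? n (suc L) B ℓ) ×-dec ¬? (vanish? n L (∂ B) ℓ)

    record Separable : Set where
      field
        n L  : ℕ
        B    : ℕ → C → C → C
        additive : Additive n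
        n>0  : 0 ℕ.< n
        -- Passing from `z ^ p` to `z` multiplies `n` by `p` and divides the degree by `p`, rounding
        -- down. The product never grows, so the degree `d * n` of the powers stays within `d * r`.
        n*L≤ : n ℕ.* suc L ℕ.≤ r
        biB  : ∀ k → Bi N (B k)
        many : M ℕ.< ∑ points (λ ℓ → [ simple? n L B ℓ ])

    private
      only-constant : ∀ n {L B} → (∀ k → Bi N (B k)) → NonZero L B →
        (∀ k → k ℕ.≤ L → k ≢ 0 → ∀ x y → B k x y ≡ 0#) → on n L B ℕ.≤ size ℕ.* N
      only-constant n {L} {B} pB (zero , _ , x , y , nz) h = vanishing-lines (pB 0) nz (λ ℓ → G? ℓ ×-dec vanish? n L B ℓ)
        λ {m} {b} (_ , v) t → trans (sym (pev-head L _ (R m b t ^ n) λ k le ne → h k le ne t (m * t + b))) (v t)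
      only-constant n pB (suc k , s≤s le , x , y , nz) h = ⊥-elim (nz (h (suc k) le (λ ()) x y))

    -- `L * M` is a budget: a derivative step that finds at most `M` simple lines loses at most `M`
    -- lines and lowers `L` by one, while passing to `z ^ p` loses none. The term `size * N` covers
    -- the end, where `B` is free of `z`. The fuel `f` bounds `L`.
    descent : ∀ f L n B → L ℕ.≤ f → Additive n → 0 ℕ.< n → n ℕ.* L ℕ.≤ r → (∀ k → Bi N (B k)) → NonZero L B →
              size ℕ.* N ℕ.+ L ℕ.* M ℕ.< on n L B → Separable
    descent f zero n B _ adn n>0 n*L≤ pB nz big =
      ⊥-elim (ℕP.<⇒≱ big (ℕP.≤-trans (only-constant n pB nz λ k k≤0 ne → ⊥-elim (ne (ℕP.n≤0⇒n≡0 k≤0))) (ℕP.m≤m+n _ _)))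
    descent (suc f) (suc L) n B (s≤s L≤f) adn n>0 n*L≤ pB nz big with nonZero? L (∂ B)
    ... | yes nz∂ = branch (M ℕ.<? ∑ points (λ ℓ → [ simple? n L B ℓ ]))
      where
      branch : Dec (M ℕ.< ∑ points (λ ℓ → [ simple? n L B ℓ ])) → Separable
      branch (yes many) = record { n = n ; L = L ; B = B ; additive = adn ; n>0 = n>0 ; n*L≤ = n*L≤ ; biB = pB ; many = many }
      branch (no few)   = descent f L n (∂ B) L≤f adn n>0 (ℕP.≤-trans (ℕP.*-monoʳ-≤ n (ℕP.n≤1+n L)) n*L≤) (Bi-∂ pB) nz∂
        (ℕP.+-cancelˡ-< M _ _ (begin-strict
          M ℕ.+ (size ℕ.* N ℕ.+ L ℕ.* M)    ≡⟨ trans (sym (ℕP.+-assoc M (size ℕ.* N) (L ℕ.* M))) (trans (cong (ℕ._+ L ℕ.* M) (ℕP.+-comm M (size ℕ.* N))) (ℕP.+-assoc (size ℕ.* N) M (L ℕ.* M))) ⟩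
          size ℕ.* N ℕ.+ (M ℕ.+ L ℕ.* M)    <⟨ big ⟩
          on n (suc L) B                    ≤⟨ count-split (λ ℓ → G? ℓ ×-dec vanish? n (suc L) B ℓ) (vanish? n L (∂ B)) points ⟩
          ∑ points (λ ℓ → [ simple? n L B ℓ ]) ℕ.+ ∑ points (λ ℓ → [ (G? ℓ ×-dec vanish? n (suc L) B ℓ) ×-dec vanish? n L (∂ B) ℓ ])
            ≤⟨ ℕP.+-mono-≤ (ℕP.≮⇒≥ few) (∑-mono points λ ℓ → []-mono ((G? ℓ ×-dec vanish? n (suc L) B ℓ) ×-dec vanish? n L (∂ B) ℓ) (G? ℓ ×-dec vanish? n L (∂ B) ℓ) λ ((g , _) , v) → g , v) ⟩
          M ℕ.+ on n L (∂ B)                ∎))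
        where open ℕP.≤-Reasoning
    ... | no ∂0 with nonZero? L (B ∘ suc)
    ...   | no none = ⊥-elim (ℕP.<⇒≱ big (ℕP.≤-trans (only-constant n pB nz zero-above) (ℕP.m≤m+n _ _)))
      where
      zero-above : ∀ k → k ℕ.≤ suc L → k ≢ 0 → ∀ x y → B k x y ≡ 0#
      zero-above zero    _  ne = ⊥-elim (ne refl)
      zero-above (suc k) le ne x y with B (suc k) x y ≟ 0#
      ... | yes z = z
      ... | no ¬z = ⊥-elim (none (k , le , x , y , ¬z))
    -- A nonzero coefficient that disappears in `∂ B` has an index that is zero in the field. So the
    -- characteristic is positive, and every surviving index is a multiple of it.
    ...   | yes (k , k<L , x , y , bk) = reduce (characteristic k (char-zero k k<L x y bk))
      where
      char-zero : ∀ k → k ℕ.< suc L → ∀ x y → B (suc k) x y ≢ 0# → ℕ→F (suc k) ≡ 0#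
      char-zero k lt x y bk with *-zero {ℕ→F (suc k)} {B (suc k) x y} (zero-or (∂ B k x y ≟ 0#))
        where
        zero-or : Dec (∂ B k x y ≡ 0#) → ∂ B k x y ≡ 0#
        zero-or (yes z) = z
        zero-or (no ¬z) = ⊥-elim (∂0 (k , lt , x , y , ¬z))
      ... | inj₁ z = z
      ... | inj₂ z = ⊥-elim (bk z)

      reduce : ∃ IsChar → Separable
      reduce (suc p , ch@(1<p , _)) = descent f L′ (n ℕ.* suc p) (λ j → B (j ℕ.* suc p)) (ℕP.≤-trans (ℕP.≤-pred L′<) L≤f)
        (Additive-* {n} {suc p} adn (Additive-char ch)) (ℕP.*-mono-≤ n>0 (s≤s z≤n)) (ℕP.≤-trans scaled n*L≤) (λ j → pB (j ℕ.* suc p)) (index nz)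
        (ℕP.<-≤-trans (ℕP.≤-<-trans (ℕP.+-monoʳ-≤ (size ℕ.* N) (ℕP.*-monoˡ-≤ M (ℕP.<⇒≤ L′<))) big)
          (∑-mono points λ ℓ → []-mono (G? ℓ ×-dec vanish? n (suc L) B ℓ) (G? ℓ ×-dec vanish? (n ℕ.* suc p) L′ (λ j → B (j ℕ.* suc p)) ℓ)
            λ (g , v) → g , same v))
        where
        L′ = suc L / suc p
        r′ = suc L % suc p
        Leq : suc L ≡ L′ ℕ.* suc p ℕ.+ r′
        Leq = trans (m≡m%n+[m/n]*n (suc L) (suc p)) (ℕP.+-comm r′ (L′ ℕ.* suc p))
        L′p≤ : L′ ℕ.* suc p ℕ.≤ suc L
        L′p≤ = ℕP.≤-trans (ℕP.m≤m+n _ r′) (ℕP.≤-reflexive (sym Leq))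
        L′< : L′ ℕ.< suc L
        L′< with L′ in eq
        ... | zero   = s≤s z≤n
        ... | suc l  = ℕP.<-≤-trans (ℕP.m<m*n (suc l) (suc p) 1<p) (subst (λ z → z ℕ.* suc p ℕ.≤ suc L) eq L′p≤)
        scaled : n ℕ.* suc p ℕ.* L′ ℕ.≤ n ℕ.* suc L
        scaled = ℕP.≤-trans (ℕP.≤-reflexive (trans (ℕP.*-assoc n (suc p) L′) (cong (n ℕ.*_) (ℕP.*-comm (suc p) L′)))) (ℕP.*-monoʳ-≤ n L′p≤)
        sparse : ∀ k → k ℕ.≤ suc L → ¬ suc p ∣ k → ∀ x y → B k x y ≡ 0#
        sparse zero    le nd x y = ⊥-elim (nd (suc p ∣0))
        sparse (suc k) le nd x y with B (suc k) x y ≟ 0#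
        ... | yes z = z
        ... | no ¬z = ⊥-elim (nd (char-∣ ch (suc k) (char-zero k le x y ¬z)))
        same : ∀ {ℓ} → Vanish n (suc L) B ℓ → Vanish (n ℕ.* suc p) L′ (λ j → B (j ℕ.* suc p)) ℓ
        same {m , b} v t = trans (cong (pev L′ _) (^-* (R m b t) n (suc p)))
          (trans (sym (decimate (s≤s z≤n) L′ (m%n<n (suc L) (suc p)) (λ k → B k t (m * t + b)) (R m b t ^ n)
                   λ k le nd → sparse k (ℕP.≤-trans le (ℕP.≤-reflexive (sym Leq))) nd t (m * t + b)))
          (trans (cong (λ l → pev l (λ k → B k t (m * t + b)) (R m b t ^ n)) (sym Leq)) (v t)))
        index : NonZero (suc L) B → NonZero L′ (λ j → B (j ℕ.* suc p))
        index (k , s≤s k≤ , x , y , bk) with suc p ∣? k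
        ... | no nd = ⊥-elim (bk (sparse k k≤ nd x y))
        ... | yes (divides j refl) = j , ℕP.*-cancelʳ-< (suc p) j (suc L′) lt , x , y , bk
          where
          lt : j ℕ.* suc p ℕ.< suc L′ ℕ.* suc p
          lt = ℕP.≤-<-trans k≤ (ℕP.≤-<-trans (ℕP.≤-reflexive (trans Leq (ℕP.+-comm _ r′))) (ℕP.+-monoˡ-< (L′ ℕ.* suc p) (m%n<n (suc L) (suc p))))

-- Linear dependence and interpolation.

module LinearAlgebra (F : FiniteField) where

  open FieldArithmetic F
  open Polynomials F
  open Bivariate F
  open FrobeniusDescent F
  open import Data.Nat as ℕ using (ℕ; zero; suc; s≤s)
  import Data.Nat.Properties as ℕP
  open import Data.Fin using (Fin; toℕ; combine; remQuot; punchIn; _↑ˡ_; _↑ʳ_) renaming (zero to fz; suc to fs)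
  import Data.Fin.Properties as FinP
  open import Data.List using (List; []; _∷_; length)
  open import Data.List.Membership.Propositional using (_∈_)
  open import Data.List.Relation.Unary.Any using (here; there)
  open import Data.Vec.Functional using (insertAt)
  open import Data.Vec.Functional.Properties using (insertAt-lookup; insertAt-punchIn)
  open import Data.Product using (∃; _×_; _,_; proj₁; proj₂)
  open import Data.Empty using (⊥-elim)
  open import Function using (_∘_)
  open import Relation.Nullary using (Dec; yes; no; ¬?)
  open import Relation.Binary.PropositionalEquality hiding ([_]; J)
  open import Algebra.Bundles using (CommutativeRing)
  import Algebra.Properties.Semiring.Sum

  open FiniteField F renaming (Carrier to C)
  open FF F using (size)
  open Solver using (solve; _:+_; _:*_; :-_; _:=_; con)
  open Algebra.Properties.Semiring.Sum (CommutativeRing.semiring ring) using (sum; sum-cong-≗; sum-remove; ∑-distrib-+; *-distribˡ-sum; *-distribʳ-sum)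

  private
    sum-0 : ∀ n {f : Fin n → C} → (∀ i → f i ≡ 0#) → sum f ≡ 0#
    sum-0 zero    h = refl
    sum-0 (suc n) h = trans (cong₂ _+_ (h fz) (sum-0 n (h ∘ fs))) (+-identityˡ 0#)

  -- Gaussian elimination, one condition at a time: a vector that is nonzero at `ω` is the pivot,
  -- multiples of it are subtracted from the others, and its own coefficient is restored afterwards.
  linear-dependence : ∀ {Ω : Set} (ωs : List Ω) n (v : Fin n → Ω → C) → length ωs ℕ.< n →
    ∃ λ (c : Fin n → C) → (∃ λ i → c i ≢ 0#) × (∀ {ω} → ω ∈ ωs → sum (λ i → c i * v i ω) ≡ 0#)
  linear-dependence []       (suc n) v lt = (λ _ → 1#) , (fz , 0≢1 ∘ sym) , λ ()
  linear-dependence (ω ∷ ωs) (suc n) v (s≤s lt) with FinP.any? (λ i → ¬? (v i ω ≟ 0#))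
  ... | no none with linear-dependence ωs (suc n) v (ℕP.m≤n⇒m≤1+n lt)
  ...   | c , nz , h = c , nz , λ { (here refl) → sum-0 (suc n) λ i → trans (cong (c i *_) (at i)) (zeroʳ (c i)) ; (there p) → h p }
    where
    at : ∀ i → v i ω ≡ 0#
    at i with v i ω ≟ 0#
    ... | yes z = z
    ... | no ¬z = ⊥-elim (none (i , ¬z))
  linear-dependence (ω ∷ ωs) (suc n) v (s≤s lt) | yes (j , vj) = eliminate (linear-dependence ωs n v′ lt)
    where
    κ = proj₁ (inverse (v j ω) vj)
    w : Fin n → _ → C
    w i = v (punchIn j i)
    v′ : Fin n → _ → C
    v′ i ω′ = w i ω′ + - (w i ω * κ) * v j ω′
    v′-ω : ∀ i → v′ i ω ≡ 0#
    v′-ω i = trans (solve 3 (λ w k x → w :+ :- (w :* k) :* x := w :+ :- (w :* (x :* k))) refl (w i ω) κ (v j ω))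
      (trans (cong (λ z → w i ω + - (w i ω * z)) (proj₂ (inverse (v j ω) vj)))
      (trans (cong (λ z → w i ω + - z) (*-identityʳ _)) (-‿inverseʳ _)))
    eliminate : (∃ λ (c : Fin n → C) → (∃ λ i → c i ≢ 0#) × (∀ {ω} → ω ∈ ωs → sum (λ i → c i * v′ i ω) ≡ 0#)) →
      ∃ λ (c : Fin (suc n) → C) → (∃ λ i → c i ≢ 0#) × (∀ {ω′} → ω′ ∈ ω ∷ ωs → sum (λ i → c i * v i ω′) ≡ 0#)
    eliminate (c′ , (i , nz) , h) = c , (punchIn j i , nz ∘ trans (sym (insertAt-punchIn c′ j cj i))) ,
      λ { (here refl) → trans (same ω) (sum-0 n λ i → trans (cong (c′ i *_) (v′-ω i)) (zeroʳ _))
        ; (there p)   → trans (same _) (h p) }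
      where
      cj = sum (λ i → c′ i * - (w i ω * κ))
      c = insertAt c′ j cj
      same : ∀ ω′ → sum (λ i → c i * v i ω′) ≡ sum (λ i → c′ i * v′ i ω′)
      same ω′ = begin
        sum (λ i → c i * v i ω′)                                              ≡⟨ sum-remove {i = j} (λ i → c i * v i ω′) ⟩
        c j * v j ω′ + sum (λ i → c (punchIn j i) * w i ω′)                   ≡⟨ cong₂ (λ x y → x * v j ω′ + y) (insertAt-lookup c′ j cj) (sum-cong-≗ λ i → cong (_* w i ω′) (insertAt-punchIn c′ j cj i)) ⟩
        cj * v j ω′ + sum (λ i → c′ i * w i ω′)                               ≡⟨ cong (_+ sum (λ i → c′ i * w i ω′)) (*-distribʳ-sum (v j ω′) (λ i → c′ i * - (w i ω * κ))) ⟩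
        sum (λ i → c′ i * - (w i ω * κ) * v j ω′) + sum (λ i → c′ i * w i ω′) ≡⟨ ∑-distrib-+ (λ i → c′ i * - (w i ω * κ) * v j ω′) (λ i → c′ i * w i ω′) ⟨
        sum (λ i → c′ i * - (w i ω * κ) * v j ω′ + c′ i * w i ω′)             ≡⟨ sum-cong-≗ (λ i → solve 4 (λ c n x w → c :* n :* x :+ c :* w := c :* (w :+ n :* x)) refl (c′ i) (- (w i ω * κ)) (v j ω′) (w i ω′)) ⟩
        sum (λ i → c′ i * v′ i ω′)                                            ∎
        where open ≡-Reasoning

  extend : ∀ {n} → (Fin n → C) → ℕ → C
  extend {zero}  c k       = 0#
  extend {suc n} c zero    = c fz
  extend {suc n} c (suc k) = extend (c ∘ fs) k

  extend-toℕ : ∀ {n} (c : Fin n → C) i → extend c (toℕ i) ≡ c i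
  extend-toℕ c fz     = refl
  extend-toℕ c (fs i) = extend-toℕ (c ∘ fs) i

  pev-sum : ∀ r (c : Fin (suc r) → C) z → sum (λ k → z ^ toℕ k * c k) ≡ pev r (extend c) z
  pev-sum zero    c z = trans (+-identityʳ _) (*-identityˡ _)
  pev-sum (suc r) c z = cong₂ _+_ (*-identityˡ _) (trans (sum-cong-≗ λ k → *-assoc z (z ^ toℕ k) (c (fs k)))
    (trans (sym (*-distribˡ-sum z λ k → z ^ toℕ k * c (fs k))) (cong (z *_) (pev-sum r (c ∘ fs) z))))

  extend-class : ∀ {Ω} (𝒢 : Filtration Ω) {N n} {g : Fin n → Ω → C} →
    (∀ i → Filtration.𝓕 𝒢 N (g i)) → ∀ k → Filtration.𝓕 𝒢 N (λ ω → extend (λ i → g i ω) k)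
  extend-class 𝒢 {n = zero}  p k       = Filtration.cst′ 𝒢 0#
  extend-class 𝒢 {n = suc n} p zero    = p fz
  extend-class 𝒢 {n = suc n} p (suc k) = extend-class 𝒢 (p ∘ fs) k

  private
    sum-+ : ∀ m n (f : Fin (m ℕ.+ n) → C) → sum f ≡ sum (λ i → f (i ↑ˡ n)) + sum (λ j → f (m ↑ʳ j))
    sum-+ zero    n f = sym (+-identityˡ _)
    sum-+ (suc m) n f = trans (cong (f fz +_) (sum-+ m n (f ∘ fs))) (sym (+-assoc _ _ _))

    sum-combine : ∀ m n (f : Fin (m ℕ.* n) → C) → sum f ≡ sum (λ (i : Fin m) → sum (λ (j : Fin n) → f (combine i j)))
    sum-combine zero    n f = refl
    sum-combine (suc m) n f = trans (sum-+ n (m ℕ.* n) f) (cong (sum (λ j → f (j ↑ˡ m ℕ.* n)) +_) (sum-combine m n (λ i → f (n ↑ʳ i))))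

  module _ (I r : ℕ) (I<q : suc I ℕ.< size) where
    private
      J = suc I ℕ.* suc I

      monomial : Fin (suc r) → Fin (suc I) → Fin (suc I) → C × C × C → C
      monomial k i j (x , y , z) = z ^ toℕ k * (x ^ toℕ i * y ^ toℕ j)

      atIndices : C × C × C → Fin (suc r) → Fin (suc I) × Fin (suc I) → C
      atIndices ω k (i , j) = monomial k i j ω

      atIndex : C × C × C → Fin (suc r) × Fin J → C
      atIndex ω (k , ij) = atIndices ω k (remQuot (suc I) ij)

      v : Fin (suc r ℕ.* J) → C × C × C → C
      v idx ω = atIndex ω (remQuot J idx)

      v-combine : ∀ k i j ω → v (combine k (combine i j)) ω ≡ monomial k i j ω
      v-combine k i j ω = trans (cong (atIndex ω) (FinP.remQuot-combine {suc r} {J} k (combine i j)))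
        (cong (atIndices ω k) (FinP.remQuot-combine {suc I} {suc I} i j))

      inner : (Fin (suc r ℕ.* J) → C) → Fin (suc r) → Fin (suc I) → C → C
      inner c k i y = pev I (extend λ j → c (combine k (combine i j))) y

      slice : (Fin (suc r ℕ.* J) → C) → Fin (suc r) → C → C → C
      slice c k x y = pev I (extend λ i → inner c k i y) x

      slice-Bi : ∀ c k → Bi (I ℕ.* 1 ℕ.+ I ℕ.* 1) (slice c k)
      slice-Bi c k = pev-class bivariate I {b = λ i ω → extend {suc I} (λ i′ → inner c k i′ (proj₂ ω)) i}
        (extend-class bivariate inner-Bi) vx
        where
        inner-Bi : ∀ (i : Fin (suc I)) → Bi (I ℕ.* 1) (λ x y → inner c k i y)
        inner-Bi i = pev-class bivariate {N = 0} I {b = λ j ω → extend {suc I} (λ j′ → c (combine k (combine i j′))) j}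
          (extend-class bivariate {n = suc I} {g = λ j′ ω → c (combine k (combine i j′))} λ j → cst _) vy

      slice-sum : ∀ c x y z → sum (λ idx → c idx * v idx (x , y , z)) ≡ pev r (extend λ k → slice c k x y) z
      slice-sum c x y z = begin
        sum term
          ≡⟨ sum-combine (suc r) J term ⟩
        sum (λ (k : Fin (suc r)) → sum (λ (ij : Fin J) → term (combine k ij)))
          ≡⟨ sum-cong-≗ row ⟩
        sum (λ (k : Fin (suc r)) → z ^ toℕ k * slice c k x y)
          ≡⟨ pev-sum r (λ k → slice c k x y) z ⟩
        pev r (extend λ k → slice c k x y) z ∎
        where
        open ≡-Reasoning
        term : Fin (suc r ℕ.* J) → C
        term idx = c idx * v idx (x , y , z)
        entry : Fin (suc r) → Fin (suc I) → Fin (suc I) → C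
        entry k i j = c (combine k (combine i j))
        cell : ∀ k i → sum (λ (j : Fin (suc I)) → term (combine k (combine i j))) ≡ z ^ toℕ k * (x ^ toℕ i * inner c k i y)
        cell k i = begin
          sum (λ (j : Fin (suc I)) → term (combine k (combine i j)))
            ≡⟨ sum-cong-≗ {suc I} (λ j → trans (cong (entry k i j *_) (v-combine k i j (x , y , z)))
               (solve 4 (λ c z x y → c :* (z :* (x :* y)) := (z :* x) :* (y :* c)) refl (entry k i j) (z ^ toℕ k) (x ^ toℕ i) (y ^ toℕ j))) ⟩
          sum (λ (j : Fin (suc I)) → (z ^ toℕ k * x ^ toℕ i) * (y ^ toℕ j * entry k i j))
            ≡⟨ *-distribˡ-sum {suc I} (z ^ toℕ k * x ^ toℕ i) (λ j → y ^ toℕ j * entry k i j) ⟨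
          (z ^ toℕ k * x ^ toℕ i) * sum (λ (j : Fin (suc I)) → y ^ toℕ j * entry k i j)
            ≡⟨ trans (cong ((z ^ toℕ k * x ^ toℕ i) *_) (pev-sum I (entry k i) y)) (*-assoc _ _ _) ⟩
          z ^ toℕ k * (x ^ toℕ i * inner c k i y) ∎
        row : ∀ k → sum (λ (ij : Fin J) → term (combine k ij)) ≡ z ^ toℕ k * slice c k x y
        row k = begin
          sum (λ (ij : Fin J) → term (combine k ij))
            ≡⟨ sum-combine (suc I) (suc I) (λ ij → term (combine k ij)) ⟩
          sum (λ (i : Fin (suc I)) → sum (λ (j : Fin (suc I)) → term (combine k (combine i j))))
            ≡⟨ sum-cong-≗ {suc I} (cell k) ⟩
          sum (λ (i : Fin (suc I)) → z ^ toℕ k * (x ^ toℕ i * inner c k i y))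
            ≡⟨ *-distribˡ-sum {suc I} (z ^ toℕ k) (λ i → x ^ toℕ i * inner c k i y) ⟨
          z ^ toℕ k * sum (λ (i : Fin (suc I)) → x ^ toℕ i * inner c k i y)
            ≡⟨ cong (z ^ toℕ k *_) (pev-sum I (λ i → inner c k i y) x) ⟩
          z ^ toℕ k * slice c k x y ∎

      slice-zero : ∀ c k → (∀ x y → slice c k x y ≡ 0#) → ∀ i j → c (combine k (combine i j)) ≡ 0#
      slice-zero c k h i j = trans (sym (extend-toℕ _ j)) (pev-zero I _ I<q
        (λ y → trans (sym (extend-toℕ _ i)) (pev-zero I _ I<q (λ x → h x y) (toℕ i) (ℕP.≤-pred (FinP.toℕ<n i))))
        (toℕ j) (ℕP.≤-pred (FinP.toℕ<n j)))

    -- The exponents of `x` and `y` are bounded separately, so that coefficients can be recovered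
    -- one variable at a time. The total degree in `x` and `y` is still at most `I + I`.
    interpolate : (ωs : List (C × C × C)) → length ωs ℕ.< suc r ℕ.* J →
      ∃ λ B → (∀ k → Bi (I ℕ.+ I) (B k)) × NonZero r B × (∀ {x y z} → (x , y , z) ∈ ωs → pev r (λ k → B k x y) z ≡ 0#)
    interpolate ωs lt with linear-dependence ωs (suc r ℕ.* J) v lt
    ... | c , (idx , nz) , h = B , (λ k → wk (ℕP.≤-reflexive (cong₂ ℕ._+_ (ℕP.*-identityʳ I) (ℕP.*-identityʳ I))) (extend-class bivariate (slice-Bi c) k)) ,
          decide (nonZero? r B) , λ {x} {y} {z} p → trans (sym (slice-sum c x y z)) (h p)
      where
      B : ℕ → C → C → C
      B k x y = extend (λ k′ → slice c k′ x y) k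
      k₀ = proj₁ (remQuot {suc r} J idx)
      ij = proj₂ (remQuot {suc r} J idx)
      decide : Dec (NonZero r B) → NonZero r B
      decide (yes p)   = p
      -- A nonzero vector of coefficients gives a nonzero function because `I` is small compared
      -- with `q`: otherwise `slice-zero` would kill each coefficient.
      decide (no none) = ⊥-elim (nz (trans (cong c (sym idx≡)) (slice-zero c k₀ all0 (proj₁ (remQuot {suc I} (suc I) ij)) (proj₂ (remQuot {suc I} (suc I) ij)))))
        where
        idx≡ : combine k₀ (combine (proj₁ (remQuot {suc I} (suc I) ij)) (proj₂ (remQuot {suc I} (suc I) ij))) ≡ idx
        idx≡ = trans (cong (combine k₀) (FinP.combine-remQuot {suc I} (suc I) ij)) (FinP.combine-remQuot {suc r} J idx)
        all0 : ∀ x y → slice c k₀ x y ≡ 0#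
        all0 x y with slice c k₀ x y ≟ 0#
        ... | yes z = z
        ... | no ¬z = ⊥-elim (none (toℕ k₀ , FinP.toℕ<n k₀ , x , y , ¬z ∘ trans (sym (extend-toℕ (λ k′ → slice c k′ x y) k₀))))

-- Extraction of n-th roots of bivariate polynomials.

module RootExtraction (F : FiniteField) where

  open FiniteSums
  open FieldArithmetic F
  open Polynomials F
  open Bivariate F
  open FrobeniusDescent F
  open import Data.Nat as ℕ using (ℕ; zero; suc; z≤n; s≤s)
  import Data.Nat.Properties as ℕP
  open import Data.Nat.Divisibility using (_∣_; divides; _∣?_)
  open import Data.Product using (∃; _×_; _,_; proj₁; proj₂)
  open import Data.Empty using (⊥-elim)
  open import Function using (_∘_; id)
  open import Relation.Nullary using (¬_; Dec; yes; no; _×-dec_; ¬?)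
  open import Relation.Binary.PropositionalEquality hiding ([_])

  open FiniteField F renaming (Carrier to C)
  open FF F using (size)
  open Solver using (solve; _:+_; _:*_; :-_; _:=_; con)

  module Box = Adjoin (pullback {Ω′ = C × C} proj₂ D.byDegree) proj₁ 0

  Box⇒pev : ∀ {N M g} → Box.Adj N M g → ∃ λ c → ∀ x y → g (x , y) ≡ pev M (λ i → pev N (c i) y) x
  Box⇒pev (Box.base (h , ph , q)) with Deg⇒pev ph
  ... | c , e = (λ _ → c) , λ x y → trans (q (x , y)) (e y)
  Box⇒pev {N} {suc M} (Box.step d g′ (h , ph , r) pg q) with Deg⇒pev ph | Box⇒pev pg
  ... | c , e | c′ , e′ = prepend c c′ , λ x y →
    trans (q (x , y)) (cong₂ (λ u v → u + x * v) (trans (r (x , y)) (e y)) (e′ x y))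

  Bi⇒pev : ∀ {N g} → Bi N g → ∃ λ c → ∀ x y → g x y ≡ pev N (λ i → pev N (c i) y) x
  Bi⇒pev p = Box⇒pev (Bi-subst Box.byBox
    (Box.step (λ _ → 0#) (λ _ → 1#) ((λ _ → 0#) , DegF.cst′ 0# , λ _ → refl) (Box.Adj-cst 0 1#) (λ (x , _) → sym (trans (+-identityˡ _) (*-identityʳ x))))
    (Box.Adj-embed 1 (id , Deg-id , λ _ → refl)) p)

  pev-linear : ∀ N (a b : ℕ → C) x y → pev N (λ j → a j + x * b j) y ≡ pev N a y + x * pev N b y
  pev-linear zero    a b x y = refl
  pev-linear (suc N) a b x y = trans (cong (λ z → (a 0 + x * b 0) + y * z) (pev-linear N (a ∘ suc) (b ∘ suc) x y))
    (solve 6 (λ a b x y e f → (a :+ x :* b) :+ y :* (e :+ x :* f) := (a :+ y :* e) :+ x :* (b :+ y :* f)) refl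
      (a 0) (b 0) x y (pev N (a ∘ suc) y) (pev N (b ∘ suc) y))

  pev-swap : ∀ M N (c : ℕ → ℕ → C) x y → pev M (λ i → pev N (c i) y) x ≡ pev N (λ j → pev M (λ i → c i j) x) y
  pev-swap zero    N c x y = refl
  pev-swap (suc M) N c x y = trans (cong (λ z → pev N (c 0) y + x * z) (pev-swap M N (c ∘ suc) x y))
    (sym (pev-linear N (c 0) (λ j → pev M (λ i → c (suc i) j) x) x y))

  Deg-shift : ∀ {N g} b → Deg N g → Deg N (λ t → g (t + b))
  Deg-shift {N} b p with Deg⇒pev p
  ... | c , e = DegF.ext (λ t → sym (e (t + b)))
    (DegF.wk (ℕP.≤-reflexive (ℕP.*-identityʳ N)) (pev-class D.byDegree {N = 0} N {b = λ k _ → c k} (λ k → DegF.cst (c k)) (DegF.add Deg-id (DegF.cst′ b))))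

  -- `τ` is a right inverse, so `σ` is onto: every counted `x` is the image of some `y`, and
  -- different `x` need different `y`.
  reindex : {P : C → Set} (P? : ∀ x → Dec (P x)) (σ τ : C → C) → (∀ x → σ (τ x) ≡ x) →
    ∑ elements (λ x → [ P? x ]) ℕ.≤ ∑ elements (λ y → [ P? (σ y) ])
  reindex {P} P? σ τ inv = begin
    ∑ elements (λ x → [ P? x ])                                                ≤⟨ ∑-mono elements (λ x → []-≤ (P? x) λ p →
      ℕP.≤-trans (ℕP.≤-reflexive (sym ([]-yes (term x (τ x)) (inv x , subst P (sym (inv x)) p)))) (∑-∈ (λ y → [ term x y ]) (complete (τ x)))) ⟩
    ∑ elements (λ x → ∑ elements (λ y → [ term x y ]))                         ≡⟨ ∑-swap _ elements elements ⟩
    ∑ elements (λ y → ∑ elements (λ x → [ term x y ]))                         ≤⟨ ∑-mono elements (λ y → col y (P? (σ y))) ⟩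
    ∑ elements (λ y → [ P? (σ y) ])                                            ∎
    where
    open ℕP.≤-Reasoning
    term : ∀ x y → Dec (σ y ≡ x × P (σ y))
    term x y = (σ y ≟ x) ×-dec P? (σ y)
    col : ∀ y (d : Dec (P (σ y))) → ∑ elements (λ x → [ term x y ]) ℕ.≤ [ d ]
    col y (yes _) = at-most-one (λ x → term x y) unique λ (p , _) (q , _) → trans (sym p) q
    col y (no ¬p) = ℕP.≤-reflexive (trans (∑-cong elements λ x → []-no (term x y) (¬p ∘ proj₂)) (∑-0 elements))

  module Frobenius (n : ℕ) (n>0 : 0 ℕ.< n) (additive : Additive n) where

    -- Additivity is applied to `(x + - y) + y`, which avoids a discussion of the sign of
    -- `(- 1) ^ n`.
    injective : ∀ {x y} → x ^ n ≡ y ^ n → x ≡ y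
    injective {x} {y} p = difference-0 (^-zero n (begin
      (x + - y) ^ n                     ≡⟨ solve 2 (λ a b → a := (a :+ b) :+ :- b) refl ((x + - y) ^ n) (y ^ n) ⟩
      ((x + - y) ^ n + y ^ n) + - (y ^ n) ≡⟨ cong (_+ - (y ^ n)) (additive (x + - y) y) ⟨
      ((x + - y) + y) ^ n + - (y ^ n)     ≡⟨ cong (λ z → z ^ n + - (y ^ n)) (solve 2 (λ a b → (a :+ :- b) :+ b := a) refl x y) ⟩
      x ^ n + - (y ^ n)                   ≡⟨ cong (_+ - (y ^ n)) p ⟩
      y ^ n + - (y ^ n)                   ≡⟨ -‿inverseʳ _ ⟩
      0#                                ∎))
      where open ≡-Reasoning

    -- An injective map of a finite set to itself is onto: if `y` were missed, all `size` arguments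
    -- would have to take distinct values among the remaining elements.
    root : ∀ y → ∃ λ x → x ^ n ≡ y
    root y with anyF? (λ x → (x ^ n) ≟ y)
    ... | yes r = r
    ... | no none = ⊥-elim (ℕP.<-irrefl refl (begin-strict
      size                                                                                  ≡⟨ ℕP.*-identityʳ size ⟨
      size ℕ.* 1                                                                            ≡⟨ ∑-const 1 elements ⟨
      ∑ elements (λ x → 1)                                                                  ≤⟨ ∑-mono elements (λ x → ℕP.≤-trans (ℕP.≤-reflexive (sym ([]-yes ((x ^ n) ≟ (x ^ n)) refl)))
                                                                                                 (∑-∈ (λ z → [ (x ^ n) ≟ z ]) (complete (x ^ n)))) ⟩
      ∑ elements (λ x → ∑ elements (λ z → [ (x ^ n) ≟ z ]))                                   ≡⟨ ∑-swap _ elements elements ⟩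
      ∑ elements (λ z → ∑ elements (λ x → [ (x ^ n) ≟ z ]))                                   ≤⟨ ∑-mono elements fibre ⟩
      ∑ elements (λ z → [ ¬? (z ≟ y) ])                                                     <⟨ ℕP.≤-refl ⟩
      1 ℕ.+ ∑ elements (λ z → [ ¬? (z ≟ y) ])                                               ≤⟨ ℕP.+-monoˡ-≤ _ (ℕP.≤-trans (ℕP.≤-reflexive (sym ([]-yes (y ≟ y) refl))) (∑-∈ (λ z → [ z ≟ y ]) (complete y))) ⟩
      ∑ elements (λ z → [ z ≟ y ]) ℕ.+ ∑ elements (λ z → [ ¬? (z ≟ y) ])                     ≡⟨ ∑-+ elements ⟨
      ∑ elements (λ z → [ z ≟ y ] ℕ.+ [ ¬? (z ≟ y) ])                                        ≡⟨ ∑-cong elements (λ z → excluded (z ≟ y)) ⟩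
      ∑ elements (λ z → 1)                                                                  ≡⟨ ∑-const 1 elements ⟩
      size ℕ.* 1                                                                            ≡⟨ ℕP.*-identityʳ size ⟩
      size                                                                                  ∎))
      where
      open ℕP.≤-Reasoning
      excluded : ∀ {P : Set} (d : Dec P) → [ d ] ℕ.+ [ ¬? d ] ≡ 1
      excluded (yes _) = refl
      excluded (no _)  = refl
      fibre : ∀ z → ∑ elements (λ x → [ (x ^ n) ≟ z ]) ℕ.≤ [ ¬? (z ≟ y) ]
      fibre z with z ≟ y
      ... | yes refl = ℕP.≤-reflexive (trans (∑-cong elements λ x → []-no ((x ^ n) ≟ z) λ e → none (x , e)) (∑-0 elements))
      ... | no _     = at-most-one (λ x → (x ^ n) ≟ z) unique λ p q → injective (trans p (sym q))

    pev-^ : ∀ N c t → pev N c t ^ n ≡ pev N (λ k → c k ^ n) (t ^ n)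
    pev-^ zero    c t = refl
    pev-^ (suc N) c t = trans (additive _ _) (cong (c 0 ^ n +_) (trans (^-distrib-* t _ n) (cong (t ^ n *_) (pev-^ N (c ∘ suc) t))))

    private
      stretch : (ℕ → C) → ∀ k → Dec (n ∣ k) → C
      stretch u k (yes (divides j _)) = u j
      stretch u k (no _)              = 0#

      stretch-no : ∀ u k d → ¬ n ∣ k → stretch u k d ≡ 0#
      stretch-no u k (yes d) nd = ⊥-elim (nd d)
      stretch-no u k (no _)  _  = refl

      stretch-* : ∀ u j d → stretch u (j ℕ.* n) d ≡ u j
      stretch-* u j (yes (divides i e)) = cong u (sym (ℕP.*-cancelʳ-≡ j i n {{ℕ.>-nonZero n>0}} e))
      stretch-* u j (no nd)             = ⊥-elim (nd (divides j refl))

    -- By additivity `V ^ n` has the n-th powers of the coefficients of `V` at multiples of `n` and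
    -- zeros elsewhere; as the degree is below `q`, these are its only coefficients.
    sparse-power : ∀ {d V c} → suc (d ℕ.* n) ℕ.< size → Deg d V → (∀ t → pev (d ℕ.* n) c t ≡ V t ^ n) →
                   ∀ k → k ℕ.≤ d ℕ.* n → ¬ n ∣ k → c k ≡ 0#
    sparse-power {d} {V} {c} big pV e k k≤ nd with Deg⇒pev pV
    ... | v , ev = trans (difference-0 {c k} {u k} (trans (cong (c k +_) (sym (-1*x (u k)))) (pev-zero (d ℕ.* n) _ big zero-diff k k≤))) (stretch-no _ k (n ∣? k) nd)
      where
      -1*x : ∀ x → - 1# * x ≡ - x
      -1*x x = trans (sym (-‿distribˡ-* 1# x)) (cong -_ (*-identityˡ x))
      u : ℕ → C
      u k = stretch (λ j → v j ^ n) k (n ∣? k)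
      upow : ∀ t → pev (d ℕ.* n) u t ≡ V t ^ n
      upow t = trans (cong (λ l → pev l u t) (sym (ℕP.+-identityʳ (d ℕ.* n))))
        (trans (decimate n>0 d n>0 u t λ k _ nd → stretch-no _ k (n ∣? k) nd)
        (trans (pev-cong d (t ^ n) λ j _ → stretch-* _ j (n ∣? (j ℕ.* n)))
        (trans (sym (pev-^ d v t)) (cong (_^ n) (sym (ev t))))))
      zero-diff : ∀ t → pev (d ℕ.* n) (λ k → c k + - 1# * u k) t ≡ 0#
      zero-diff t = trans (pev-linear (d ℕ.* n) c u (- 1#) t)
        (trans (cong₂ (λ a b → a + - 1# * b) (e t) (upow t)) (trans (cong (V t ^ n +_) (-1*x _)) (-‿inverseʳ _)))

    module _ {d : ℕ} {Q̃ : C → C → C} (biQ̃ : Bi (d ℕ.* n) Q̃) (big : suc (d ℕ.* n) ℕ.< size)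
             (R : C → C → C → C) (degR : ∀ m b → Deg d (R m b))
             {Good : C → C → Set} (Good? : ∀ m b → Dec (Good m b))
             (good : ∀ {m b} → Good m b → ∀ t → Q̃ t (m * t + b) ≡ R m b t ^ n)
             {m₁ m₂ : C} (m₁≢m₂ : m₁ ≢ m₂)
             (many₁ : d ℕ.* n ℕ.< ∑ elements (λ b → [ Good? m₁ b ]))
             (many₂ : d ℕ.* n ℕ.< ∑ elements (λ b → [ Good? m₂ b ])) where
      -- In the coordinates (α , β) along the slopes m₁ and m₂, many rows and many columns of Q̃ are n-th powers,
      -- so only monomials with both exponents divisible by n occur.
      private
        Δ = d ℕ.* n

        μ : C
        μ = m₂ + - m₁

        μ≢0 : μ ≢ 0#
        μ≢0 z = m₁≢m₂ (sym (difference-0 z))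

        κ : C
        κ = proj₁ (inverse μ μ≢0)

        μκ : μ * κ ≡ 1#
        μκ = proj₂ (inverse μ μ≢0)

        Q̂ : C → C → C
        Q̂ α β = Q̃ (α + β) (m₁ * α + m₂ * β)

        biQ̂ : Bi Δ Q̂
        biQ̂ = Bi-subst bivariate (add vx vy) (add (mul (cst m₁) vx) (mul (cst m₂) vy)) biQ̃

        row : ∀ β → Good m₁ (μ * β) → ∀ α → Q̂ α β ≡ R m₁ (μ * β) (α + β) ^ n
        row β g α = trans (cong (Q̃ (α + β)) (solve 4 (λ a b m k → m :* a :+ k :* b := m :* (a :+ b) :+ (k :+ :- m) :* b) refl α β m₁ m₂)) (good g (α + β))

        column : ∀ α → Good m₂ (- μ * α) → ∀ β → Q̂ α β ≡ R m₂ (- μ * α) (β + α) ^ n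
        column α g β = trans (cong₂ Q̃ (+-comm α β) (solve 4 (λ a b m k → m :* a :+ k :* b := k :* (b :+ a) :+ (:- (k :+ :- m)) :* a) refl α β m₁ m₂)) (good g (β + α))

        vanish : ∀ c {P : C → Set} (P? : ∀ x → Dec (P x)) → Δ ℕ.< ∑ elements (λ x → [ P? x ]) → (∀ x → P x → pev Δ c x ≡ 0#) → ∀ k → k ℕ.≤ Δ → c k ≡ 0#
        vanish c P? lt h = pev-zero Δ c big (many-zeros (Deg-pev Δ c) (ℕP.<-≤-trans lt (∑-mono elements λ x → []-mono (P? x) (pev Δ c x ≟ 0#) (h x))))

      module _ (c : ℕ → ℕ → C) (c≡ : ∀ α β → Q̂ α β ≡ pev Δ (λ i → pev Δ (c i) β) α) where
        private
          -- For every good `β` the row is an n-th power, so the polynomial in `β` with coefficients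
          -- `c i` vanishes there. The good `β` outnumber its degree.
          sparse₁ : ∀ i → i ℕ.≤ Δ → ¬ n ∣ i → ∀ j → j ℕ.≤ Δ → c i j ≡ 0#
          sparse₁ i i≤ nd = vanish (c i) (λ β → Good? m₁ (μ * β))
            (ℕP.<-≤-trans many₁ (reindex (Good? m₁) (μ *_) (κ *_) λ x → trans (sym (*-assoc μ κ x)) (trans (cong (_* x) μκ) (*-identityˡ x))))
            λ β g → sparse-power {c = λ i → pev Δ (c i) β} big (Deg-shift β (degR m₁ (μ * β))) (λ α → trans (sym (c≡ α β)) (row β g α)) i i≤ nd

          sparse₂ : ∀ j → j ℕ.≤ Δ → ¬ n ∣ j → ∀ i → i ℕ.≤ Δ → c i j ≡ 0#
          sparse₂ j j≤ nd = vanish (λ i → c i j) (λ α → Good? m₂ (- μ * α))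
            (ℕP.<-≤-trans many₂ (reindex (Good? m₂) (- μ *_) (- κ *_) λ x →
              trans (solve 3 (λ m k x → (:- m) :* ((:- k) :* x) := (m :* k) :* x) refl μ κ x) (trans (cong (_* x) μκ) (*-identityˡ x))))
            λ α g → sparse-power {c = λ j → pev Δ (λ i → c i j) α} big (Deg-shift α (degR m₂ (- μ * α)))
              (λ β → trans (sym (trans (c≡ α β) (pev-swap Δ Δ c α β))) (column α g β)) j j≤ nd

          ψ : C → C
          ψ x = proj₁ (root x)

          -- The root is taken coefficient by coefficient, every field element being an n-th power.
          -- The degree is at most `d` in each of `α` and `β`, whence the total degree `d + d`.
          Q′ : C → C → C
          Q′ α β = pev d (λ i → pev d (λ j → ψ (c (i ℕ.* n) (j ℕ.* n))) β) α

          pev-decimate : ∀ b z → (∀ k → k ℕ.≤ Δ → ¬ n ∣ k → b k ≡ 0#) → pev Δ b z ≡ pev d (λ j → b (j ℕ.* n)) (z ^ n)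
          pev-decimate b z h = trans (cong (λ l → pev l b z) (sym (ℕP.+-identityʳ Δ)))
            (decimate n>0 d n>0 b z λ k le → h k (ℕP.≤-trans le (ℕP.≤-reflexive (ℕP.+-identityʳ Δ))))

          pev-0 : ∀ N b t → (∀ k → k ℕ.≤ N → b k ≡ 0#) → pev N b t ≡ 0#
          pev-0 zero    b t h = h 0 z≤n
          pev-0 (suc N) b t h = trans (cong₂ (λ x y → x + t * y) (h 0 z≤n) (pev-0 N (b ∘ suc) t λ k le → h (suc k) (s≤s le))) (trans (+-identityˡ _) (zeroʳ t))

          Q′-power : ∀ α β → Q′ α β ^ n ≡ Q̂ α β
          Q′-power α β = begin
            Q′ α β ^ n
              ≡⟨ pev-^ d _ α ⟩
            pev d (λ i → pev d (λ j → ψ (c (i ℕ.* n) (j ℕ.* n))) β ^ n) (α ^ n)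
              ≡⟨ pev-cong d (α ^ n) (λ i i≤ → trans (pev-^ d _ β) (trans (pev-cong d (β ^ n) λ j _ → proj₂ (root _))
                   (sym (pev-decimate (c (i ℕ.* n)) β λ j j≤ nd → sparse₂ j j≤ nd (i ℕ.* n) (ℕP.*-monoˡ-≤ n i≤))))) ⟩
            pev d (λ i → pev Δ (c (i ℕ.* n)) β) (α ^ n)
              ≡⟨ pev-decimate (λ i → pev Δ (c i) β) α (λ i i≤ nd → pev-0 Δ (c i) β (sparse₁ i i≤ nd)) ⟨
            pev Δ (λ i → pev Δ (c i) β) α
              ≡⟨ c≡ α β ⟨
            Q̂ α β ∎
            where open ≡-Reasoning

          Β Α : C → C → C
          Β x y = κ * (y + - m₁ * x)
          Α x y = x + - 1# * Β x y

          biΒ : Bi 1 Β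
          biΒ = mul (cst κ) (add vy (mul (cst (- m₁)) vx))

          biΑ : Bi 1 Α
          biΑ = add vx (mul (cst (- 1#)) biΒ)

        root-of-coefficients : ∃ λ Q → Bi (d ℕ.+ d) Q × (∀ x y → Q x y ^ n ≡ Q̃ x y)
        root-of-coefficients = (λ x y → Q′ (Α x y) (Β x y)) ,
          wk (ℕP.≤-reflexive (cong₂ ℕ._+_ (ℕP.*-identityʳ d) (ℕP.*-identityʳ d)))
            (pev-class bivariate d {b = λ i ω → pev d (λ j → ψ (c (i ℕ.* n) (j ℕ.* n))) (Β (proj₁ ω) (proj₂ ω))} {Z = λ ω → Α (proj₁ ω) (proj₂ ω)}
              (λ i → pev-class bivariate {N = 0} d {b = λ j ω → ψ (c (i ℕ.* n) (j ℕ.* n))} (λ j → cst _) biΒ) biΑ) ,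
          λ x y → trans (Q′-power (Α x y) (Β x y)) (cong₂ Q̃ (first x (Β x y)) (second x y))
          where
          -1*b : ∀ b → - 1# * b ≡ - b
          -1*b b = trans (sym (-‿distribˡ-* 1# b)) (cong -_ (*-identityˡ b))
          first : ∀ x b → (x + - 1# * b) + b ≡ x
          first x b = trans (cong (λ z → (x + z) + b) (-1*b b)) (solve 2 (λ x b → (x :+ :- b) :+ b := x) refl x b)
          second : ∀ x y → m₁ * Α x y + m₂ * Β x y ≡ y
          second x y = begin
            m₁ * (x + - 1# * Β x y) + m₂ * Β x y        ≡⟨ cong (λ z → m₁ * (x + z) + m₂ * Β x y) (-1*b (Β x y)) ⟩
            m₁ * (x + - Β x y) + m₂ * Β x y             ≡⟨ solve 5 (λ m k x y κ → m :* (x :+ :- (κ :* (y :+ (:- m) :* x))) :+ k :* (κ :* (y :+ (:- m) :* x))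
                                                                := m :* x :+ ((k :+ :- m) :* κ) :* (y :+ (:- m) :* x)) refl m₁ m₂ x y κ ⟩
            m₁ * x + (μ * κ) * (y + - m₁ * x)           ≡⟨ cong (λ z → m₁ * x + z * (y + - m₁ * x)) μκ ⟩
            m₁ * x + 1# * (y + - m₁ * x)                ≡⟨ cong (m₁ * x +_) (*-identityˡ _) ⟩
            m₁ * x + (y + - m₁ * x)                     ≡⟨ solve 3 (λ m x y → m :* x :+ (y :+ (:- m) :* x) := y) refl m₁ x y ⟩
            y                                           ∎
            where open ≡-Reasoning

      nth-root : ∃ λ Q → Bi (d ℕ.+ d) Q × (∀ x y → Q x y ^ n ≡ Q̃ x y)
      nth-root = let (c , c≡) = Bi⇒pev biQ̂ in root-of-coefficients c c≡

-- The numerical parameters and the inequalities between them.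

module Constants where

  open import Data.Nat
  open import Data.Nat.Properties
  open import Data.Nat.Solver using (module +-*-Solver)
  open import Relation.Binary.PropositionalEquality
  open ≤-Reasoning

  private
    module S = +-*-Solver
    open S using (solve; _:+_; _:*_; _:=_; con)

  -- Points and lines of the core have degree above `w`. The interpolated `B` has degree `r` in `z`,
  -- `I` in `x` and in `y`, and at most `D` on the graph over a line; `K` lines are interpolated.
  -- More than `v * v` lines carry a simple root, more than `u` of them pass through the centre of
  -- the lifting, and `ν` is half of `w`.
  record Numbers (d q : ℕ) : Set where
    field
      u r K v ν w : ℕ

    I : ℕ
    I = d * r

    D : ℕ
    D = (I + I) + r * d

    field
      unknowns       : K * suc D < suc r * (suc I * suc I)
      K≤w            : K ≤ w
      suc-I≤w        : suc I ≤ w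
      suc-D≤w        : suc D ≤ w
      hensel-bound   : ∀ {n L Δ} → 0 < n → n * suc L ≤ r → Δ ≡ d * n →
        suc (suc Δ + ((suc Δ + Δ) + ((suc Δ + Δ) + ((I + I) + suc L * (suc Δ + Δ))))) ≤ w
      room           : ν + D ≤ suc w
      pencil-bound   : ∀ {x} → K * (w * w) ≤ (q * q) * D + K * x → w * w ≤ 2 * x
      descent-bound  : ∀ {x} → w * w ≤ 2 * x → q * (I + I) + r * (v * v) < x
      popular-bound  : ∀ {x} → v * v < x → (q * q) * u < x * ν
      star-bound     : ∀ {Δ x} → Δ ≤ I → suc u * w ≤ x → (q * q) * Δ < x * ν
      slopes-bound   : ∀ {Δ x y} → Δ ≤ I → suc u * w ≤ x → x * w ≤ (q * q) * Δ + y * q → q * Δ + q < y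
      final-bound    : ∀ {c x} → suc w ≤ ν + c → c * w ≤ x → w * w ≤ 2 * x

  -- E is 1/ε up to a constant factor, and w is the minimal degree of the core, so q ≤ E·w.
  module Parameters (d E u q : ℕ) (0<d : 0 < d) (0<E : 0 < E) where

    g e h r I D K v ν w : ℕ
    e = E * E
    g = d * e
    h = g * e
    -- With `r = c * e`, the leading terms in `unknowns` are `18 c² d² e³` on the left and
    -- `c³ d² e³` on the right. At `c = 18` they balance and the lower terms decide.
    r = 18 * e
    I = d * r
    D = (I + I) + r * d
    -- As `q * q` is at most `e * (w * w)`, the loss `q * q * D` in `pencil-bound` is at most half
    -- of `K * (w * w)`.
    K = 2 * (e * D)
    -- Chosen for `popular-bound`: the upper bound `e * (w * w) * u` for `q * q * u` is then exactly
    -- `v * v * ν`.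
    v = 24 * (E * (e * u))
    ν = 6 * (E * v)
    w = 12 * (E * v)

    private
      1≤e : 1 ≤ e
      1≤e = *-mono-≤ 0<E 0<E

      1≤g : 1 ≤ g
      1≤g = *-mono-≤ 0<d 1≤e

      grow : ∀ {x} y → 1 ≤ y → x ≤ y * x
      grow {x} y le = ≤-trans (≤-reflexive (sym (*-identityˡ x))) (*-monoˡ-≤ x le)

      g≤h : g ≤ h
      g≤h = ≤-trans (grow e 1≤e) (≤-reflexive (*-comm e g))

      I≡ : I ≡ 18 * g
      I≡ = solve 2 (λ d e → d :* (con 18 :* e) := con 18 :* (d :* e)) refl d e

      D≡ : D ≡ 54 * g
      D≡ = solve 2 (λ d e → (d :* (con 18 :* e) :+ d :* (con 18 :* e)) :+ (con 18 :* e) :* d := con 54 :* (d :* e)) refl d e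

      K≡ : K ≡ 108 * h
      K≡ = solve 2 (λ d e → con 2 :* (e :* ((d :* (con 18 :* e) :+ d :* (con 18 :* e)) :+ (con 18 :* e) :* d)) := con 108 :* ((d :* e) :* e)) refl d e

      2ν≡w : 2 * ν ≡ w
      2ν≡w = solve 1 (λ x → con 2 :* (con 6 :* x) := con 12 :* x) refl (E * v)

      u≤v/24 : 24 * u ≤ v
      u≤v/24 = *-monoʳ-≤ 24 (≤-trans (grow e 1≤e) (grow E 0<E))

      u≤v : u ≤ v
      u≤v = ≤-trans (grow 24 (s≤s z≤n)) u≤v/24

      v≤Ev : v ≤ E * v
      v≤Ev = grow E 0<E

      v≤w : v ≤ w
      v≤w = ≤-trans v≤Ev (grow 12 (s≤s z≤n))

      24u≤w : 24 * u ≤ w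
      24u≤w = ≤-trans u≤v/24 v≤w

    w²≡ : w * w ≡ (e * (v * v)) * 144
    w²≡ = solve 2 (λ E v → (con 12 :* (E :* v)) :* (con 12 :* (E :* v)) := ((E :* E) :* (v :* v)) :* con 144) refl E v

    unknowns : K * suc D < suc r * (suc I * suc I)
    unknowns = begin-strict
      K * suc D                     ≡⟨ cong₂ (λ a b → a * suc b) K≡ D≡ ⟩
      (108 * h) * suc (54 * g)      <⟨ s≤s (m≤m+n _ (540 * (e * g) + 18 * e + 324 * (g * g) + 36 * g)) ⟩
      suc ((108 * h) * suc (54 * g) + (540 * (e * g) + 18 * e + 324 * (g * g) + 36 * g))
        ≡⟨ solve 2 (λ e g → con 1 :+ ((con 108 :* (g :* e)) :* (con 1 :+ con 54 :* g) :+ (con 540 :* (e :* g) :+ con 18 :* e :+ con 324 :* (g :* g) :+ con 36 :* g))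
               := (con 1 :+ con 18 :* e) :* ((con 1 :+ con 18 :* g) :* (con 1 :+ con 18 :* g))) refl e g ⟩
      suc (18 * e) * (suc (18 * g) * suc (18 * g)) ≡⟨ cong (λ a → suc r * (suc a * suc a)) I≡ ⟨
      suc r * (suc I * suc I)       ∎

    module _ (u-big : 38 * h ≤ u) where

      private
        g≤u/38 : 38 * g ≤ u
        g≤u/38 = ≤-trans (*-monoʳ-≤ 38 g≤h) u-big

        1≤u : 1 ≤ u
        1≤u = ≤-trans (≤-trans 1≤g (grow 38 (s≤s z≤n))) g≤u/38

        1≤v : 1 ≤ v
        1≤v = ≤-trans 1≤u u≤v

      K≤w : K ≤ w
      K≤w = begin
        K            ≡⟨ K≡ ⟩
        108 * h      ≤⟨ *-monoˡ-≤ h (m≤m+n 108 6) ⟩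
        114 * h      ≡⟨ solve 1 (λ h → con 114 :* h := con 3 :* (con 38 :* h)) refl h ⟩
        3 * (38 * h) ≤⟨ *-monoʳ-≤ 3 u-big ⟩
        3 * u        ≤⟨ *-monoˡ-≤ u (m≤m+n 3 21) ⟩
        24 * u       ≤⟨ 24u≤w ⟩
        w            ∎

      private
        -- `w` is at least `24 * u`, and `u` is at least `38 * g`.
        small : ∀ a b → a + b ≤ 38 * 24 → a * g + b ≤ w
        small a b le = begin
          a * g + b          ≤⟨ +-monoʳ-≤ (a * g) (≤-trans (≤-reflexive (sym (*-identityʳ b))) (*-monoʳ-≤ b 1≤g)) ⟩
          a * g + b * g      ≡⟨ *-distribʳ-+ g a b ⟨
          (a + b) * g        ≤⟨ *-monoˡ-≤ g le ⟩
          (38 * 24) * g      ≡⟨ solve 1 (λ g → con (38 * 24) :* g := con 24 :* (con 38 :* g)) refl g ⟩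
          24 * (38 * g)      ≤⟨ *-monoʳ-≤ 24 g≤u/38 ⟩
          24 * u             ≤⟨ 24u≤w ⟩
          w                  ∎

      suc-I≤w : suc I ≤ w
      suc-I≤w = ≤-trans (≤-reflexive (trans (cong suc I≡) (+-comm 1 (18 * g)))) (small 18 1 (m≤m+n 19 893))

      suc-D≤w : suc D ≤ w
      suc-D≤w = ≤-trans (≤-reflexive (trans (cong suc D≡) (+-comm 1 (54 * g)))) (small 54 1 (m≤m+n 55 857))

      hensel-bound : ∀ {n L Δ} → 0 < n → n * suc L ≤ r → Δ ≡ d * n →
        suc (suc Δ + ((suc Δ + Δ) + ((suc Δ + Δ) + ((I + I) + suc L * (suc Δ + Δ))))) ≤ w
      hensel-bound {n} {L} {Δ} 0<n nL refl = begin
        suc (suc Δ + ((suc Δ + Δ) + ((suc Δ + Δ) + ((I + I) + suc L * (suc Δ + Δ)))))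
          ≡⟨ solve 4 (λ d n I l → con 2 :+ d :* n :+ ((con 1 :+ d :* n :+ d :* n) :+ ((con 1 :+ d :* n :+ d :* n) :+ ((I :+ I) :+ l :* (con 1 :+ d :* n :+ d :* n))))
                := con 5 :* (d :* n) :+ con 4 :+ con 2 :* I :+ con 2 :* (d :* (n :* l)) :+ l) refl d n I (suc L) ⟩
        5 * Δ + 4 + 2 * I + 2 * (d * (n * suc L)) + suc L
          ≤⟨ +-mono-≤ (+-mono-≤ (+-monoˡ-≤ (2 * I) (+-monoˡ-≤ 4 (*-monoʳ-≤ 5 Δ≤I))) (*-monoʳ-≤ 2 (*-monoʳ-≤ d nL))) L≤I ⟩
        5 * I + 4 + 2 * I + 2 * I + suc I
          ≡⟨ solve 1 (λ I → con 5 :* I :+ con 4 :+ con 2 :* I :+ con 2 :* I :+ (con 1 :+ I) := con 10 :* I :+ con 5) refl I ⟩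
        10 * I + 5
          ≡⟨ cong (λ z → 10 * z + 5) I≡ ⟩
        10 * (18 * g) + 5
          ≡⟨ cong (_+ 5) (sym (*-assoc 10 18 g)) ⟩
        180 * g + 5
          ≤⟨ small 180 5 (m≤m+n 185 727) ⟩
        w ∎
        where
        Δ≤I : d * n ≤ I
        Δ≤I = *-monoʳ-≤ d (≤-trans (≤-trans (≤-reflexive (sym (*-identityʳ n))) (*-monoʳ-≤ n (s≤s z≤n))) nL)
        L≤I : suc L ≤ suc I
        L≤I = ≤-trans (≤-trans (grow n 0<n) (≤-trans nL (grow d 0<d))) (n≤1+n I)

      room : ν + D ≤ suc w
      room = begin
        ν + D       ≡⟨ cong (ν +_) D≡ ⟩
        ν + 54 * g  ≤⟨ +-monoʳ-≤ ν bound ⟩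
        ν + ν       ≡⟨ trans (cong (ν +_) (sym (+-identityʳ ν))) 2ν≡w ⟩
        w           ≤⟨ n≤1+n w ⟩
        suc w       ∎
        where
        bound : 54 * g ≤ ν
        bound = begin
          54 * g       ≤⟨ *-monoˡ-≤ g (m≤m+n 54 22) ⟩
          76 * g       ≡⟨ *-assoc 2 38 g ⟩
          2 * (38 * g) ≤⟨ *-monoʳ-≤ 2 g≤u/38 ⟩
          2 * u        ≤⟨ *-monoˡ-≤ u (m≤m+n 2 4) ⟩
          6 * u        ≤⟨ *-monoʳ-≤ 6 (≤-trans u≤v v≤Ev) ⟩
          ν            ∎

      module _ (q-small : q ≤ E * w) where

        private
          q²≤ : q * q ≤ e * (w * w)
          q²≤ = begin
            q * q               ≤⟨ *-mono-≤ q-small q-small ⟩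
            (E * w) * (E * w)   ≡⟨ solve 2 (λ E w → (E :* w) :* (E :* w) := (E :* E) :* (w :* w)) refl E w ⟩
            e * (w * w)         ∎

        pencil-bound : ∀ {x} → K * (w * w) ≤ (q * q) * D + K * x → w * w ≤ 2 * x
        pencil-bound {x} le = *-cancelˡ-≤ (e * D) {{>-nonZero (*-mono-≤ 1≤e (≤-trans 1≤g (≤-trans (grow 54 (s≤s z≤n)) (≤-reflexive (sym D≡)))))}}
          (+-cancelˡ-≤ ((e * D) * (w * w)) _ _ (begin
            (e * D) * (w * w) + (e * D) * (w * w)  ≡⟨ solve 2 (λ a b → a :* b :+ a :* b := (con 2 :* a) :* b) refl (e * D) (w * w) ⟩
            K * (w * w)                            ≤⟨ le ⟩
            (q * q) * D + K * x                    ≤⟨ +-monoˡ-≤ (K * x) (*-monoˡ-≤ D q²≤) ⟩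
            (e * (w * w)) * D + K * x              ≡⟨ solve 4 (λ e W D x → (e :* W) :* D :+ (con 2 :* (e :* D)) :* x := (e :* D) :* W :+ (e :* D) :* (con 2 :* x)) refl e (w * w) D x ⟩
            (e * D) * (w * w) + (e * D) * (2 * x)  ∎))

        descent-bound : ∀ {x} → w * w ≤ 2 * x → q * (I + I) + r * (v * v) < x
        descent-bound {x} le = *-cancelˡ-< 2 _ _ (<-≤-trans (begin-strict
          2 * (q * (I + I) + r * (v * v))                   ≤⟨ *-monoʳ-≤ 2 (+-monoˡ-≤ (r * (v * v)) first) ⟩
          2 * (e * (v * v) + r * (v * v))                   ≡⟨ solve 2 (λ e V → con 2 :* (e :* V :+ (con 18 :* e) :* V) := (e :* V) :* con 38) refl e (v * v) ⟩
          (e * (v * v)) * 38                                <⟨ *-monoʳ-< (e * (v * v)) {{>-nonZero (*-mono-≤ 1≤e (*-mono-≤ 1≤v 1≤v))}} (m≤m+n 39 105) ⟩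
          (e * (v * v)) * 144                               ≡⟨ w²≡ ⟨
          w * w                                             ∎) le)
          where
          first : q * (I + I) ≤ e * (v * v)
          first = begin
            q * (I + I)                    ≤⟨ *-monoˡ-≤ (I + I) q-small ⟩
            (E * w) * (I + I)              ≡⟨ cong (λ z → (E * w) * (z + z)) I≡ ⟩
            (E * (12 * (E * v))) * (18 * g + 18 * g) ≡⟨ solve 3 (λ E v g → (E :* (con 12 :* (E :* v))) :* (con 18 :* g :+ con 18 :* g) := ((E :* E) :* v) :* (con 432 :* g)) refl E v g ⟩
            (e * v) * (432 * g)            ≤⟨ *-monoʳ-≤ (e * v) (*-monoˡ-≤ g (m≤m+n 432 480)) ⟩
            (e * v) * (912 * g)            ≡⟨ cong ((e * v) *_) (*-assoc 24 38 g) ⟩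
            (e * v) * (24 * (38 * g))      ≤⟨ *-monoʳ-≤ (e * v) (≤-trans (*-monoʳ-≤ 24 g≤u/38) u≤v/24) ⟩
            (e * v) * v                    ≡⟨ *-assoc e v v ⟩
            e * (v * v)                    ∎

        popular-bound : ∀ {x} → v * v < x → (q * q) * u < x * ν
        popular-bound {x} lt = begin-strict
          (q * q) * u                        ≤⟨ *-monoˡ-≤ u q²≤ ⟩
          (e * (w * w)) * u                  ≡⟨ cong (λ z → (e * z) * u) w²≡ ⟩
          (e * ((e * (v * v)) * 144)) * u    ≡⟨ solve 3 (λ E V u → ((E :* E) :* (((E :* E) :* V) :* con 144)) :* u := V :* (con 6 :* (E :* (con 24 :* (E :* ((E :* E) :* u)))))) refl E (v * v) u ⟩
          (v * v) * ν                        <⟨ *-monoˡ-< ν {{>-nonZero (≤-trans 1≤v (≤-trans v≤Ev (grow 6 (s≤s z≤n))))}} lt ⟩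
          x * ν                              ∎

        private
          q²Δ≤ : ∀ {Δ} → Δ ≤ I → (q * q) * Δ ≤ (w * w) * (18 * h)
          q²Δ≤ {Δ} le = begin
            (q * q) * Δ             ≤⟨ *-mono-≤ q²≤ le ⟩
            (e * (w * w)) * I       ≡⟨ cong ((e * (w * w)) *_) I≡ ⟩
            (e * (w * w)) * (18 * g) ≡⟨ solve 3 (λ e W g → (e :* W) :* (con 18 :* g) := W :* (con 18 :* (g :* e))) refl e (w * w) g ⟩
            (w * w) * (18 * h)      ∎

          1≤w² : 1 ≤ w * w
          1≤w² = *-mono-≤ (≤-trans 1≤v v≤w) (≤-trans 1≤v v≤w)

        star-bound : ∀ {Δ x} → Δ ≤ I → suc u * w ≤ x → (q * q) * Δ < x * ν
        star-bound {Δ} {x} le le′ = *-cancelˡ-< 2 _ _ (begin-strict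
          2 * ((q * q) * Δ)         ≤⟨ *-monoʳ-≤ 2 (q²Δ≤ le) ⟩
          2 * ((w * w) * (18 * h))  ≡⟨ solve 2 (λ W h → con 2 :* (W :* (con 18 :* h)) := W :* (con 36 :* h)) refl (w * w) h ⟩
          (w * w) * (36 * h)        ≤⟨ *-monoʳ-≤ (w * w) (≤-trans (*-monoˡ-≤ h (m≤m+n 36 2)) u-big) ⟩
          (w * w) * u               <⟨ *-monoʳ-< (w * w) {{>-nonZero 1≤w²}} (n<1+n u) ⟩
          (w * w) * suc u           ≡⟨ solve 2 (λ w u → (w :* w) :* u := (u :* w) :* w) refl w (suc u) ⟩
          (suc u * w) * w           ≤⟨ *-monoˡ-≤ w le′ ⟩
          x * w                     ≡⟨ cong (x *_) (sym 2ν≡w) ⟩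
          x * (2 * ν)               ≡⟨ solve 2 (λ x n → x :* (con 2 :* n) := con 2 :* (x :* n)) refl x ν ⟩
          2 * (x * ν)               ∎)

        -- This inequality asks most of `u`: twice `18 * h` for the two terms with `Δ`, and another
        -- `h` for `q * q`. The resulting 37 lies behind the assumption `38 * h ≤ u`.
        slopes-bound : ∀ {Δ x y} → Δ ≤ I → suc u * w ≤ x → x * w ≤ (q * q) * Δ + y * q → q * Δ + q < y
        slopes-bound {Δ} {x} {y} le le′ le″ = ≰⇒> λ few → <⇒≱ (begin-strict
          (q * q) * Δ + y * q                    ≤⟨ +-monoʳ-≤ ((q * q) * Δ) (*-monoˡ-≤ q few) ⟩
          (q * q) * Δ + (q * Δ + q) * q          ≡⟨ solve 2 (λ q D → (q :* q) :* D :+ (q :* D :+ q) :* q := con 2 :* ((q :* q) :* D) :+ q :* q) refl q Δ ⟩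
          2 * ((q * q) * Δ) + q * q              ≤⟨ +-mono-≤ (*-monoʳ-≤ 2 (q²Δ≤ le)) q²≤ ⟩
          2 * ((w * w) * (18 * h)) + e * (w * w) ≤⟨ +-monoʳ-≤ (2 * ((w * w) * (18 * h))) (*-monoˡ-≤ (w * w) (grow g 1≤g)) ⟩
          2 * ((w * w) * (18 * h)) + h * (w * w) ≡⟨ solve 2 (λ W h → con 2 :* (W :* (con 18 :* h)) :+ h :* W := W :* (con 37 :* h)) refl (w * w) h ⟩
          (w * w) * (37 * h)                     ≤⟨ *-monoʳ-≤ (w * w) (≤-trans (*-monoˡ-≤ h (m≤m+n 37 1)) u-big) ⟩
          (w * w) * u                            <⟨ *-monoʳ-< (w * w) {{>-nonZero 1≤w²}} (n<1+n u) ⟩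
          (w * w) * suc u                        ≡⟨ solve 2 (λ w u → (w :* w) :* u := (u :* w) :* w) refl w (suc u) ⟩
          (suc u * w) * w                        ≤⟨ *-monoˡ-≤ w le′ ⟩
          x * w                                  ∎) le″

      final-bound : ∀ {c x} → suc w ≤ ν + c → c * w ≤ x → w * w ≤ 2 * x
      final-bound {c} {x} le le′ = begin
        w * w         ≤⟨ *-monoˡ-≤ w w≤2c ⟩
        (2 * c) * w   ≡⟨ *-assoc 2 c w ⟩
        2 * (c * w)   ≤⟨ *-monoʳ-≤ 2 le′ ⟩
        2 * x         ∎
        where
        ν≤c : ν ≤ c
        ν≤c = +-cancelˡ-≤ ν ν c (≤-trans (≤-reflexive (trans (cong (ν +_) (sym (+-identityʳ ν))) 2ν≡w)) (≤-trans (n≤1+n w) le))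
        w≤2c : w ≤ 2 * c
        w≤2c = ≤-trans (≤-reflexive (sym 2ν≡w)) (*-monoʳ-≤ 2 ν≤c)

    numbers : 38 * h ≤ u → q ≤ E * w → Numbers d q
    numbers big small = record
      { u = u ; r = r ; K = K ; v = v ; ν = ν ; w = w
      ; unknowns = unknowns ; K≤w = K≤w big ; suc-I≤w = suc-I≤w big ; suc-D≤w = suc-D≤w big
      ; hensel-bound = hensel-bound big ; room = room big
      ; pencil-bound = pencil-bound big small ; descent-bound = descent-bound big small
      ; popular-bound = popular-bound big small ; star-bound = star-bound big small
      ; slopes-bound = slopes-bound big small ; final-bound = final-bound big }

-- From a dense core to a polynomial that agrees with f.

module Geometry (F : FiniteField) where

  open FiniteSums
  open Incidences
  open FieldArithmetic F
  open Polynomials F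
  open Bivariate F
  open HenselLifting F
  open FrobeniusDescent F
  open LinearAlgebra F
  open RootExtraction F
  open Constants
  open import Data.Bool using (Bool; T)
  open import Data.Nat as ℕ using (ℕ; suc; z≤n; s≤s)
  import Data.Nat.Properties as ℕP
  open import Data.List using (List; []; _∷_; length; take; filter; cartesianProductWith; map; _++_)
  open import Data.List.Properties using (length-take; length-map; length-++)
  open import Data.List.Membership.Propositional using (_∈_)
  open import Data.List.Membership.Propositional.Properties using (∈-cartesianProductWith⁺; ∈-cartesianProduct⁺)
  open import Data.List.Relation.Unary.All as All using (All)
  open import Data.List.Relation.Unary.All.Properties using (all-filter) renaming (take⁺ to All-take⁺)
  open import Data.List.Relation.Unary.Unique.Propositional using (Unique)
  open import Data.List.Relation.Unary.Unique.Propositional.Properties using (cartesianProduct⁺; take⁺; filter⁺)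
  open import Data.Product using (∃; _×_; _,_; proj₁; proj₂)
  open import Data.Product.Properties using (≡-dec)
  open import Function using (_∘_; id; flip)
  open import Relation.Nullary using (¬_; Dec; yes; no; _×-dec_; ¬?)
  open import Relation.Binary.Definitions using (DecidableEquality)
  open import Relation.Binary.PropositionalEquality hiding ([_])

  open FiniteField F renaming (Carrier to C)
  open FF F using (size; points)
  open Solver using (solve; _:+_; _:*_; :-_; _:=_; con)

  _≟P_ : DecidableEquality (C × C)
  _≟P_ = ≡-dec _≟_ _≟_

  points-unique : Unique points
  points-unique = cartesianProduct⁺ unique unique

  points-complete : ∀ x → x ∈ points
  points-complete (x , y) = ∈-cartesianProduct⁺ (complete x) (complete y)

  length-product : ∀ {A B D : Set} (f : A → B → D) xs ys → length (cartesianProductWith f xs ys) ≡ length xs ℕ.* length ys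
  length-product f []       ys = refl
  length-product f (x ∷ xs) ys = trans (length-++ (map (f x) ys)) (cong₂ ℕ._+_ (length-map (f x) ys) (length-product f xs ys))

  length-points : length points ≡ size ℕ.* size
  length-points = length-product _,_ elements elements

  on-line : ∀ {P : C × C → Set} (P? : ∀ x → Dec (P x)) {Z : C → Set} (Z? : ∀ x → Dec (Z x)) m b →
    (∀ {x y} → P (x , y) → y ≡ m * x + b × Z x) → ∑ points (λ x → [ P? x ]) ℕ.≤ ∑ elements (λ x → [ Z? x ])
  on-line P? Z? m b h = ℕP.≤-trans (ℕP.≤-reflexive (∑-× (λ x → [ P? x ]) elements elements))
    (∑-mono elements λ x → count-≤[] (λ y → P? (x , y)) unique
      (λ _ _ p q → trans (proj₁ (h p)) (sym (proj₁ (h q)))) (Z? x) (λ _ p → proj₂ (h p)))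

  -- Averaging gives one slope with more than `Δ` lines. Dropping it loses at most `size` lines,
  -- which the second summand of the hypothesis covers, so averaging applies again.
  two-slopes : ∀ {P : C → C → Set} (P? : ∀ m b → Dec (P m b)) Δ →
    size ℕ.* Δ ℕ.+ size ℕ.< ∑ points (λ ℓ → [ P? (proj₁ ℓ) (proj₂ ℓ) ]) →
    ∃ λ m₁ → ∃ λ m₂ → m₁ ≢ m₂ × Δ ℕ.< ∑ elements (λ b → [ P? m₁ b ]) × Δ ℕ.< ∑ elements (λ b → [ P? m₂ b ])
  two-slopes P? Δ big with pigeonhole c elements Δ (ℕP.≤-<-trans (ℕP.m≤m+n _ size) big′)
    where
    c : C → ℕ
    c m = ∑ elements (λ b → [ P? m b ])
    big′ : size ℕ.* Δ ℕ.+ size ℕ.< ∑ elements c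
    big′ = ℕP.<-≤-trans big (ℕP.≤-reflexive (∑-× (λ ℓ → [ P? (proj₁ ℓ) (proj₂ ℓ) ]) elements elements))
  ... | m₁ , _ , lt₁ with pigeonhole c′ elements Δ (ℕP.+-cancelʳ-< size _ _ (ℕP.<-≤-trans big (ℕP.≤-trans (ℕP.≤-reflexive (∑-× (λ ℓ → [ P? (proj₁ ℓ) (proj₂ ℓ) ]) elements elements)) drop)))
    where
    c c′ : C → ℕ
    c m  = ∑ elements (λ b → [ P? m b ])
    c′ m = [ ¬? (m ≟ m₁) ] ℕ.* c m
    c≤ : ∀ m → c m ℕ.≤ c′ m ℕ.+ [ m ≟ m₁ ] ℕ.* size
    c≤ m with m ≟ m₁
    ... | yes _ = ℕP.≤-trans (∑-≤-* _ elements λ b → []≤1 (P? m b)) (ℕP.≤-reflexive (trans (ℕP.*-identityʳ size) (sym (ℕP.*-identityˡ size))))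
    ... | no _  = ℕP.≤-trans (ℕP.≤-reflexive (sym (ℕP.*-identityˡ (c m)))) (ℕP.m≤m+n _ _)
    drop : ∑ elements c ℕ.≤ ∑ elements c′ ℕ.+ size
    drop = begin
      ∑ elements c                                             ≤⟨ ∑-mono elements c≤ ⟩
      ∑ elements (λ m → c′ m ℕ.+ [ m ≟ m₁ ] ℕ.* size)           ≡⟨ ∑-+ elements ⟩
      ∑ elements c′ ℕ.+ ∑ elements (λ m → [ m ≟ m₁ ] ℕ.* size)  ≡⟨ cong (∑ elements c′ ℕ.+_) (∑-*ʳ size _ elements) ⟩
      ∑ elements c′ ℕ.+ ∑ elements (λ m → [ m ≟ m₁ ]) ℕ.* size  ≤⟨ ℕP.+-monoʳ-≤ (∑ elements c′) (ℕP.*-monoˡ-≤ size (at-most-one (_≟ m₁) unique λ p q → trans p (sym q))) ⟩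
      ∑ elements c′ ℕ.+ 1 ℕ.* size                              ≡⟨ cong (∑ elements c′ ℕ.+_) (ℕP.*-identityˡ size) ⟩
      ∑ elements c′ ℕ.+ size                                    ∎
      where open ℕP.≤-Reasoning
  ...   | m₂ , _ , lt₂ = m₁ , m₂ , distinct , lt₁ , ℕP.<-≤-trans lt₂ (ℕP.≤-trans (ℕP.*-monoˡ-≤ (∑ elements (λ b → [ P? m₂ b ])) ([]≤1 (¬? (m₂ ≟ m₁)))) (ℕP.≤-reflexive (ℕP.*-identityˡ _)))
    where
    distinct : m₁ ≢ m₂
    distinct refl = ℕP.n≮0 (ℕP.<-≤-trans lt₂ (ℕP.≤-reflexive (cong (ℕ._* ∑ elements (λ b → [ P? m₂ b ])) ([]-no (¬? (m₂ ≟ m₂)) λ ne → ne refl))))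

  module Plane
    (d : ℕ) (f : C × C → C) (R : C → C → C → C) (degR : ∀ m b → Deg d (R m b))
    (e : C × C → C × C → Bool)
    (sound : ∀ {x y m b} → T (e (x , y) (m , b)) → y ≡ m * x + b × R m b x ≡ f (x , y))
    (w : ℕ)
    (rich-point : ∀ {x ℓ} → T (e x ℓ) → suc w ℕ.≤ deg points e x)
    (rich-line  : ∀ {x ℓ} → T (e x ℓ) → suc w ℕ.≤ deg points (flip e) ℓ) where

    linear : ∀ {x x′ ℓ ℓ′} → T (e x ℓ) → T (e x ℓ′) → T (e x′ ℓ) → T (e x′ ℓ′) → x ≢ x′ → ℓ ≡ ℓ′
    linear {x , y} {x′ , y′} {m , b} {m′ , b′} p q p′ q′ ne with sound p | sound q | sound p′ | sound q′
    ... | s , _ | t , _ | s′ , _ | t′ , _ = cong₂ _,_ m≡ b≡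
      where
      x≢ : x + - x′ ≢ 0#
      x≢ z = ne (cong₂ _,_ x≡ (trans s (trans (cong (λ u → m * u + b) x≡) (sym s′))))
        where
        x≡ : x ≡ x′
        x≡ = difference-0 z
      m≡ : m ≡ m′
      m≡ = difference-0 (*-cancel-0 (trans
        (solve 6 (λ x x′ m m′ b b′ → (x :+ :- x′) :* (m :+ :- m′) := ((m :* x :+ b) :+ :- (m′ :* x :+ b′)) :+ :- ((m :* x′ :+ b) :+ :- (m′ :* x′ :+ b′))) refl x x′ m m′ b b′)
        (trans (cong₂ (λ u v → u + - v) (trans (cong₂ (λ u v → u + - v) (sym s) (sym t)) (-‿inverseʳ y)) (trans (cong₂ (λ u v → u + - v) (sym s′) (sym t′)) (-‿inverseʳ y′)))
          (-‿inverseʳ 0#))) x≢)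
      b≡ : b ≡ b′
      b≡ = trans (solve 3 (λ m x b → b := (m :* x :+ b) :+ :- (m :* x)) refl m x b)
        (trans (cong₂ (λ u v → u + - (v * x)) (trans (sym s) t) m≡) (solve 3 (λ m x b → (m :* x :+ b) :+ :- (m :* x) := b) refl m′ x b′))

    open Incidence _≟P_ _≟P_ points points points-unique points-unique e linear w rich-point rich-line public

    point-edge : ∀ {x} → 0 ℕ.< deg points e x → ∃ λ ℓ → T (e x ℓ)
    point-edge {x} p = let (ℓ , _ , q) = ∑-pos (λ ℓ → [ e? x ℓ ]) points p in ℓ , []-pos (e? x ℓ) q

    line-edge : ∀ {ℓ} → 0 ℕ.< deg points (flip e) ℓ → ∃ λ x → T (e x ℓ)
    line-edge {ℓ} p = let (x , _ , q) = ∑-pos (λ x → [ e? x ℓ ]) points p in x , []-pos (e? x ℓ) q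

    point-pos : ∀ {x ℓ} → T (e x ℓ) → 0 ℕ.< deg points e x
    point-pos t = ℕP.≤-trans (s≤s z≤n) (rich-point t)

    -- Restricted to points that still carry an edge: these have many accepting lines, and they will
    -- form the set `S`.
    agree? : ∀ (Q : C → C → C) x → Dec (0 ℕ.< deg points e x × Q (proj₁ x) (proj₂ x) ≡ f x)
    agree? Q x = (0 ℕ.<? deg points e x) ×-dec (Q (proj₁ x) (proj₂ x) ≟ f x)

    Agreement : Set
    Agreement = ∃ λ Q → Bi (d ℕ.+ d) Q × w ℕ.* w ℕ.≤ 2 ℕ.* ∑ points (λ x → [ agree? Q x ])

    thin : ∀ ℓ → deg points (flip e) ℓ ℕ.≤ size
    thin (m , b) = ℕP.≤-trans (on-line (λ x → e? x (m , b)) (λ x → x ≟ x) m b λ t → proj₁ (sound t) , refl)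
      (ℕP.≤-trans (∑-≤-* _ elements λ x → []≤1 (x ≟ x)) (ℕP.≤-reflexive (ℕP.*-identityʳ size)))

    w<size : ∀ {x ℓ} → T (e x ℓ) → w ℕ.< size
    w<size t = ℕP.≤-trans (rich-line t) (thin _)

    -- Each `R m b` is constant, so `f` takes the value `f x₀` at all core points on good lines
    -- through `x₀`, and `star` counts these.
    constant-agreement : d ≡ 0 → ∀ {x ℓ} → T (e x ℓ) → Agreement
    constant-agreement refl {x₀} t₀ = (λ _ _ → f x₀) , cst (f x₀) , (begin
      w ℕ.* w                                           ≤⟨ ℕP.*-monoˡ-≤ w (ℕP.≤-trans (ℕP.n≤1+n w) (rich-point t₀)) ⟩
      deg points e x₀ ℕ.* w                             ≤⟨ star x₀ (e? x₀) (agree? (λ _ _ → f x₀)) id (λ t t′ → point-pos t′ , same t t′) ⟩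
      ∑ points (λ x → [ agree? (λ _ _ → f x₀) x ])      ≤⟨ ℕP.m≤m+n _ _ ⟩
      2 ℕ.* ∑ points (λ x → [ agree? (λ _ _ → f x₀) x ]) ∎)
      where
      open ℕP.≤-Reasoning
      same : ∀ {ℓ x} → T (e x₀ ℓ) → T (e x ℓ) → f x₀ ≡ f x
      same {m , b} t t′ with degR m b
      ... | D.base (c , p) = trans (sym (proj₂ (sound t))) (trans (p _) (trans (sym (p _)) (proj₂ (sound t′))))

  module Large
    (d : ℕ) (numbers : Numbers d size)
    (f : C × C → C) (R : C → C → C → C) (degR : ∀ m b → Deg d (R m b))
    (e : C × C → C × C → Bool)
    (sound : ∀ {x y m b} → T (e (x , y) (m , b)) → y ≡ m * x + b × R m b x ≡ f (x , y))
    (rich-point : ∀ {x ℓ} → T (e x ℓ) → suc (Numbers.w numbers) ℕ.≤ deg points e x)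
    (rich-line  : ∀ {x ℓ} → T (e x ℓ) → suc (Numbers.w numbers) ℕ.≤ deg points (flip e) ℓ) where

    private module N = Numbers numbers
    open N using (u; r; I; D; K; v; ν; w)
    open Plane d f R degR e sound w rich-point rich-line

    edge? : ∀ ℓ → Dec (0 ℕ.< deg points (flip e) ℓ)
    edge? ℓ = 0 ℕ.<? deg points (flip e) ℓ

    open Descent R edge? (I ℕ.+ I) r (v ℕ.* v)

    on-line-deg : ∀ {N} {B : ℕ → C → C → C} n L m b → (∀ k → Bi N (B k)) →
      Deg (N ℕ.+ L ℕ.* (n ℕ.* d)) (λ t → pev L (λ k → B k t (m * t + b)) (R m b t ^ n))
    on-line-deg {N} {B} n L m b pB = pev-class D.byDegree L {b = λ k t → B k t (m * t + b)} (λ k → Bi-line m b (pB k)) (DegF.pow n (degR m b))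

    module Interpolation {x₀ ℓ₀} (t₀ : T (e x₀ ℓ₀)) where

      Ls : List (C × C)
      Ls = take K (filter (e? x₀) points)

      uLs : Unique Ls
      uLs = take⁺ K (filter⁺ (e? x₀) points-unique)

      through : ∀ {ℓ} → ℓ ∈ Ls → T (e x₀ ℓ)
      through = All.lookup (All-take⁺ K (all-filter (e? x₀) points))

      length-Ls : length Ls ≡ K
      length-Ls = trans (length-take K (filter (e? x₀) points)) (ℕP.m≤n⇒m⊓n≡m
        (ℕP.≤-trans (N.K≤w) (ℕP.≤-trans (ℕP.n≤1+n w) (ℕP.≤-trans (rich-point t₀) (ℕP.≤-reflexive (sym (∑-filter (e? x₀) points)))))))

      ts : List C
      -- One parameter more than the degree of the restriction of `B`, so that `B` vanishes on the
      -- whole graph.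
      ts = take (suc D) elements

      length-ts : length ts ≡ suc D
      length-ts = trans (length-take (suc D) elements) (ℕP.m≤n⇒m⊓n≡m (ℕP.≤-trans (N.suc-D≤w) (ℕP.<⇒≤ (w<size t₀))))

      node : C × C → C → C × C × C
      -- The exponent 1 is the `n` with which `descent` starts.
      node (m , b) t = t , m * t + b , R m b t ^ 1

      nodes : List (C × C × C)
      nodes = cartesianProductWith node Ls ts

      module _ (B : ℕ → C → C → C) (pB : ∀ k → Bi (I ℕ.+ I) (B k))
               (zero-at : ∀ {x y z} → (x , y , z) ∈ nodes → pev r (λ k → B k x y) z ≡ 0#) where

        degD : ∀ m b → Deg D (λ t → pev r (λ k → B k t (m * t + b)) (R m b t ^ 1))
        degD m b = DegF.wk (ℕP.≤-reflexive (cong (λ z → I ℕ.+ I ℕ.+ r ℕ.* z) (ℕP.*-identityˡ d))) (on-line-deg 1 r m b pB)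

        on-Ls : ∀ {ℓ} → ℓ ∈ Ls → Vanish 1 r B ℓ
        on-Ls {m , b} ℓ∈ = many-zeros (degD m b) (begin-strict
          D                                                     <⟨ ℕP.n<1+n D ⟩
          suc D                                                 ≡⟨ length-ts ⟨
          length ts                                             ≡⟨ ∑-all zero? ts (λ t∈ → zero-at (∈-cartesianProductWith⁺ node ℓ∈ t∈)) ⟨
          ∑ ts (λ t → [ zero? t ])                              ≤⟨ ∑-take _ (suc D) elements ⟩
          ∑ elements (λ t → [ zero? t ])                        ∎)
          where
          open ℕP.≤-Reasoning
          zero? : ∀ t → Dec (pev r (λ k → B k t (m * t + b)) (R m b t ^ 1) ≡ 0#)
          zero? t = pev r (λ k → B k t (m * t + b)) (R m b t ^ 1) ≟ 0#

        Z? : ∀ x → Dec (pev r (λ k → B k (proj₁ x) (proj₂ x)) (f x ^ 1) ≡ 0#)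
        Z? x = pev r (λ k → B k (proj₁ x) (proj₂ x)) (f x ^ 1) ≟ 0#

        inZ : ∀ {x ℓ} → ℓ ∈ Ls → T (e x ℓ) → pev r (λ k → B k (proj₁ x) (proj₂ x)) (f x ^ 1) ≡ 0#
        inZ {x , y} {m , b} ℓ∈ t with sound t
        ... | y≡ , R≡ = trans (cong₂ (λ u z → pev r (λ k → B k x u) (z ^ 1)) y≡ (sym R≡)) (on-Ls ℓ∈ x)

        inG : ∀ ℓ → D ℕ.< ∑ points (λ x → [ e? x ℓ ×-dec Z? x ]) → 0 ℕ.< deg points (flip e) ℓ × Vanish 1 r B ℓ
        inG (m , b) lt = ℕP.≤-<-trans z≤n (ℕP.<-≤-trans lt (∑-mono points λ x → []-mono (e? x (m , b) ×-dec Z? x) (e? x (m , b)) proj₁)) ,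
          many-zeros (degD m b) (ℕP.<-≤-trans lt (on-line (λ x → e? x (m , b) ×-dec Z? x) (λ t → pev r (λ k → B k t (m * t + b)) (R m b t ^ 1) ≟ 0#) m b
            λ {x} (t , z) → let (y≡ , R≡) = sound t in y≡ , trans (cong₂ (λ u s → pev r (λ k → B k x u) (s ^ 1)) (sym y≡) R≡) z))

        enough : w ℕ.* w ℕ.≤ 2 ℕ.* on 1 r B
        enough = N.pencil-bound (subst₂ (λ k l → k ℕ.* (w ℕ.* w) ℕ.≤ l ℕ.* D ℕ.+ k ℕ.* on 1 r B) length-Ls length-points
          (pencil x₀ uLs through Z? inZ D (λ ℓ → edge? ℓ ×-dec vanish? 1 r B ℓ) inG))

      fits : length nodes ℕ.< suc r ℕ.* (suc I ℕ.* suc I)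
      fits = ℕP.≤-<-trans (ℕP.≤-reflexive (trans (length-product node Ls ts) (cong₂ ℕ._*_ length-Ls length-ts))) N.unknowns

      separable : Separable
      separable = let (B , pB , nz , zero-at) = interpolate I r (ℕP.≤-<-trans N.suc-I≤w (w<size t₀)) nodes fits in
        descent r r 1 B ℕP.≤-refl Additive-1 (s≤s z≤n) (ℕP.≤-reflexive (ℕP.*-identityˡ r)) pB nz
          (N.descent-bound (enough B pB zero-at))

    module Lifting {x₀ ℓ₀} (t₀ : T (e x₀ ℓ₀)) (n L : ℕ) (B : ℕ → C → C → C) (n>0 : 0 ℕ.< n) (nL : n ℕ.* suc L ℕ.≤ r)
                   (pB : ∀ k → Bi (I ℕ.+ I) (B k)) (many : v ℕ.* v ℕ.< ∑ points (λ ℓ → [ simple? n L B ℓ ])) where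

      bad? : ∀ x → Dec (pev L (λ k → ∂ B k (proj₁ x) (proj₂ x)) (f x ^ n) ≡ 0#)
      bad? x = pev L (λ k → ∂ B k (proj₁ x) (proj₂ x)) (f x ^ n) ≟ 0#

      degD : ∀ m b → Deg D (λ t → pev L (λ k → ∂ B k t (m * t + b)) (R m b t ^ n))
      degD m b = DegF.wk (ℕP.+-monoʳ-≤ (I ℕ.+ I) (ℕP.≤-trans (ℕP.≤-reflexive (sym (ℕP.*-assoc L n d)))
        (ℕP.*-monoˡ-≤ d (ℕP.≤-trans (ℕP.≤-trans (ℕP.≤-reflexive (ℕP.*-comm L n)) (ℕP.*-monoʳ-≤ n (ℕP.n≤1+n L))) nL)))) (on-line-deg n L m b (Bi-∂ pB))

      -- At an edge `f x` is the value of `R` on the line, so a bad point is a zero of the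
      -- restricted derivative, which is not identically zero and has degree at most `D`.
      few : ∀ {ℓ} → (0 ℕ.< deg points (flip e) ℓ × Vanish n (suc L) B ℓ) × ¬ Vanish n L (∂ B) ℓ →
            ∑ points (λ x → [ e? x ℓ ×-dec bad? x ]) ℕ.≤ D
      few {m , b} (_ , nv) = ℕP.≮⇒≥ λ lt → nv (many-zeros (degD m b) (ℕP.<-≤-trans lt
        (on-line (λ x → e? x (m , b) ×-dec bad? x) (λ t → pev L (λ k → ∂ B k t (m * t + b)) (R m b t ^ n) ≟ 0#) m b
          λ {x} (t , z) → let (y≡ , R≡) = sound t in y≡ , trans (cong₂ (λ u s → pev L (λ k → ∂ B k x u) (s ^ n)) (sym y≡) R≡) z)))

      centre : ∃ λ x → ¬ (pev L (λ k → ∂ B k (proj₁ x) (proj₂ x)) (f x ^ n) ≡ 0#) × u ℕ.< ∑ points (λ ℓ → [ simple? n L B ℓ ×-dec e? x ℓ ])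
      centre = popular-point (simple? n L B) bad? {D} {ν} {u} (λ ((p , _) , _) → line-edge p) few (N.room)
        (subst (λ l → l ℕ.* u ℕ.< ∑ points (λ ℓ → [ simple? n L B ℓ ]) ℕ.* ν) (sym length-points) (N.popular-bound many))

      power? : ∀ (Q : C → C → C) x → Dec (0 ℕ.< deg points e x × Q (proj₁ x) (proj₂ x) ≡ f x ^ n)
      power? Q x = (0 ℕ.<? deg points e x) ×-dec (Q (proj₁ x) (proj₂ x) ≟ (f x ^ n))

      module At (a₁ a₂ : C) (simple : ¬ (pev L (λ k → ∂ B k a₁ a₂) (f (a₁ , a₂) ^ n) ≡ 0#))
                (popular : u ℕ.< ∑ points (λ ℓ → [ simple? n L B ℓ ×-dec e? (a₁ , a₂) ℓ ])) where

        icept : C → C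
        icept m = a₂ + - (m * a₁)

        -- A non-vertical line through the centre is determined by its slope; shifting the parameter
        -- by `a₁` in `S` puts the centre at `t = 0` on all of them.
        U : C → Set
        U m = Vanish n (suc L) B (m , icept m) × T (e (a₁ , a₂) (m , icept m))

        S : C → C → C
        S m t = R m (icept m) (t + a₁) ^ n

        S-deg : ∀ {m} → U m → Deg (d ℕ.* n) (S m)
        S-deg {m} _ = DegF.wk (ℕP.≤-reflexive (ℕP.*-comm n d)) (DegF.pow n (Deg-shift a₁ (degR m (icept m))))

        S-0 : ∀ {m} → U m → S m 0# ≡ f (a₁ , a₂) ^ n
        S-0 {m} (_ , t) = cong (_^ n) (trans (cong (R m (icept m)) (+-identityˡ a₁)) (proj₂ (sound t)))

        S-root : ∀ {m} → U m → ∀ t → pev (suc L) (λ k → B k (a₁ + t) (a₂ + m * t)) (S m t) ≡ 0#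
        S-root {m} (van , _) t = trans (cong₂ (λ x y → pev (suc L) (λ k → B k x y) (S m t)) (+-comm a₁ t)
          (solve 4 (λ a b m t → b :+ m :* t := m :* (t :+ a) :+ (b :+ :- (m :* a))) refl a₁ a₂ m t)) (van (t + a₁))

        lifted : ∃ λ T′ → G.Adj 0 (d ℕ.* n) T′ × (∀ {m} → U m → ∀ t → S m t ≡ T′ (m , t))
        lifted = Hensel.lift (suc L) (d ℕ.* n) B pB a₁ a₂ (f (a₁ , a₂) ^ n) U S S-deg S-0 S-root
          (simple ∘ trans (pev-∂ L (λ k → B k a₁ a₂) (f (a₁ , a₂) ^ n)))
          (ℕP.≤-<-trans (N.hensel-bound n>0 nL refl) (w<size t₀))

        module _ (T′ : C × C → C) (lift : ∀ {m} → U m → ∀ t → S m t ≡ T′ (m , t))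
                 (g : C → C → C) (g≡ : ∀ m t → g t (m * t) ≡ t ^ 0 * T′ (m , t)) where

          Q̃ : C → C → C
          Q̃ x y = g (x + - a₁) (y + - a₂)

          Q̃-on : ∀ {m b} → Vanish n (suc L) B (m , b) → T (e (a₁ , a₂) (m , b)) → ∀ x → Q̃ x (m * x + b) ≡ R m b x ^ n
          Q̃-on {m} {b} van t x = begin
            g (x + - a₁) ((m * x + b) + - a₂)                 ≡⟨ cong (g (x + - a₁)) (trans (cong (λ z → (m * x + z) + - a₂) b≡)
                                                                   (solve 4 (λ a b m x → (m :* x :+ (b :+ :- (m :* a))) :+ :- b := m :* (x :+ :- a)) refl a₁ a₂ m x)) ⟩
            g (x + - a₁) (m * (x + - a₁))                     ≡⟨ g≡ m (x + - a₁) ⟩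
            1# * T′ (m , x + - a₁)                            ≡⟨ *-identityˡ _ ⟩
            T′ (m , x + - a₁)                                 ≡⟨ lift (subst (λ z → Vanish n (suc L) B (m , z)) b≡ van , subst (λ z → T (e (a₁ , a₂) (m , z))) b≡ t) (x + - a₁) ⟨
            R m (icept m) ((x + - a₁) + a₁) ^ n               ≡⟨ cong₂ (λ z s → R m z s ^ n) (sym b≡) (solve 2 (λ x a → (x :+ :- a) :+ a := x) refl x a₁) ⟩
            R m b x ^ n                                       ∎
            where
            open ≡-Reasoning
            b≡ : b ≡ icept m
            b≡ = trans (solve 3 (λ m a b → b := (m :* a :+ b) :+ :- (m :* a)) refl m a₁ b) (cong (_+ - (m * a₁)) (sym (proj₁ (sound t))))

          starred : suc u ℕ.* w ℕ.≤ ∑ points (λ x → [ power? Q̃ x ])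
          starred = ℕP.≤-trans (ℕP.*-monoˡ-≤ w popular)
            (star (a₁ , a₂) (λ ℓ → simple? n L B ℓ ×-dec e? (a₁ , a₂) ℓ) (power? Q̃) proj₂
              λ { {x , y} {m , b} (((_ , van) , _) , t) t′ → point-pos t′ ,
                  trans (cong (Q̃ x) (proj₁ (sound t′))) (trans (Q̃-on van t x) (cong (_^ n) (proj₂ (sound t′)))) })

        result : ∃ λ Q̃ → Bi (d ℕ.* n) Q̃ × suc u ℕ.* w ℕ.≤ ∑ points (λ x → [ power? Q̃ x ])
        result = let (T′ , pT , lift) = lifted ; (g , pg , g≡) = Gr⇒Bi pT in
          Q̃ T′ lift g g≡ , Bi-subst bivariate (add vx (BiF.cst′ (- a₁))) (add vy (BiF.cst′ (- a₂))) pg , starred T′ lift g g≡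

      lifted-power : ∃ λ Q̃ → Bi (d ℕ.* n) Q̃ × suc u ℕ.* w ℕ.≤ ∑ points (λ x → [ power? Q̃ x ])
      lifted-power = let ((a₁ , a₂) , simple , popular) = centre in At.result a₁ a₂ simple popular

      module Descend (additive : Additive n) (Q̃ : C → C → C) (pQ̃ : Bi (d ℕ.* n) Q̃) (plenty : suc u ℕ.* w ℕ.≤ ∑ points (λ x → [ power? Q̃ x ])) where

        open Frobenius n n>0 additive

        Δ : ℕ
        Δ = d ℕ.* n

        Δ≤I : Δ ℕ.≤ I
        Δ≤I = ℕP.*-monoʳ-≤ d (ℕP.≤-trans (ℕP.≤-trans (ℕP.≤-reflexive (sym (ℕP.*-identityʳ n))) (ℕP.*-monoʳ-≤ n (s≤s z≤n))) nL)

        Restricts : C → C → Set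
        Restricts m b = ∀ t → Q̃ t (m * t + b) ≡ R m b t ^ n

        restricts? : ∀ m b → Dec (Restricts m b)
        restricts? m b = allF? λ t → Q̃ t (m * t + b) ≟ (R m b t ^ n)

        line? : ∀ ℓ → Dec (Restricts (proj₁ ℓ) (proj₂ ℓ))
        line? ℓ = restricts? (proj₁ ℓ) (proj₂ ℓ)

        inG : ∀ ℓ → Δ ℕ.< ∑ points (λ x → [ e? x ℓ ×-dec power? Q̃ x ]) → Restricts (proj₁ ℓ) (proj₂ ℓ)
        inG (m , b) lt t = difference-0 (many-zeros {g = λ t → Q̃ t (m * t + b) + - (R m b t ^ n)}
          (DegF.sub (Bi-line m b pQ̃) (DegF.wk (ℕP.≤-reflexive (ℕP.*-comm n d)) (DegF.pow n (degR m b))))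
          (ℕP.<-≤-trans lt (on-line (λ x → e? x (m , b) ×-dec power? Q̃ x) (λ t → (Q̃ t (m * t + b) + - (R m b t ^ n)) ≟ 0#) m b
            λ {x} (t , _ , z) → let (y≡ , R≡) = sound t in y≡ ,
              trans (cong₂ (λ p s → p + - (s ^ n)) (trans (cong (Q̃ x) (sym y≡)) z) R≡) (-‿inverseʳ _))) t)

        lines : size ℕ.* Δ ℕ.+ size ℕ.< ∑ points (λ ℓ → [ line? ℓ ])
        lines = N.slopes-bound Δ≤I plenty
          (subst (λ l → ∑ points (λ x → [ power? Q̃ x ]) ℕ.* w ℕ.≤ l ℕ.* Δ ℕ.+ ∑ points (λ ℓ → [ line? ℓ ]) ℕ.* size) length-points
            (many-lines (power? Q̃) line? (point-edge ∘ proj₁) inG thin))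

        final-star : ∃ λ x → (0 ℕ.< deg points e x × Q̃ (proj₁ x) (proj₂ x) ≡ f x ^ n) × suc w ℕ.≤ ν ℕ.+ ∑ points (λ ℓ → [ e? x ℓ ×-dec line? ℓ ])
        final-star = popular-star (power? Q̃) line? (point-edge ∘ proj₁) inG {ν}
          (subst (λ l → l ℕ.* Δ ℕ.< ∑ points (λ x → [ power? Q̃ x ]) ℕ.* ν) (sym length-points) (N.star-bound Δ≤I plenty))

        root-exists : ∃ λ Q → Bi (d ℕ.+ d) Q × (∀ x y → Q x y ^ n ≡ Q̃ x y)
        root-exists = let (m₁ , m₂ , ne , many₁ , many₂) = two-slopes restricts? Δ lines in
          nth-root {d} {Q̃} pQ̃ (ℕP.≤-<-trans (ℕP.≤-trans (s≤s Δ≤I) N.suc-I≤w) (w<size t₀)) R degR restricts? id ne many₁ many₂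

        -- The star of the first centre gives only about `u * w` points. At the second centre all
        -- but `ν` of more than `w` lines restrict correctly, and its star has at least half of
        -- `w * w` points.
        agreement : Agreement
        agreement = let (Q , pQ , Q^) = root-exists ; (x₂ , _ , big) = final-star in
          Q , pQ , N.final-bound big
          (star x₂ (λ ℓ → e? x₂ ℓ ×-dec line? ℓ) (agree? Q) proj₁ λ { {x , y} {m , b} (_ , on) t → point-pos t ,
            injective (trans (Q^ x y) (trans (cong (Q̃ x) (proj₁ (sound t))) (trans (on x) (cong (_^ n) (proj₂ (sound t)))))) })

    agreement : ∀ {x ℓ} → T (e x ℓ) → Agreement
    agreement t₀ = continue (Interpolation.separable t₀)
      where
      continue : Separable → Agreement
      continue s = let (Q̃ , pQ̃ , plenty) = L.lifted-power in L.Descend.agreement S.additive Q̃ pQ̃ plenty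
        where
        module S = Separable s
        module L = Lifting t₀ S.n S.L S.B S.n>0 S.n*L≤ S.biB S.many

-- Rational numbers as fractions of natural numbers.

module Fractions where

  open import Defs using (ℕtoℚ; _^ℚ_; sumℚ)
  open import Data.Nat as ℕ using (ℕ; zero; suc; z≤n; s≤s)
  import Data.Nat.Properties as ℕP
  open import Data.Integer as ℤ using (ℤ; +_; -[1+_])
  import Data.Integer.Properties as ℤP
  open import Data.Rational
  open import Data.Rational.Properties
  open import Data.Rational.Unnormalised.Base as ℚᵘ using (ℚᵘ; mkℚᵘ; *≡*; *≤*)
  import Data.Rational.Unnormalised.Properties as ℚᵘP
  open import Data.List using (List; []; _∷_; map)
  open import Data.Product using (∃; _×_; _,_)
  open import Relation.Nullary using (¬_)
  open import Relation.Binary.PropositionalEquality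

  open FiniteSums using (∑)

  private
    raw : ∀ n → toℚᵘ (ℕtoℚ n) ℚᵘ.≃ mkℚᵘ (+ n) 0
    raw n = toℚᵘ-fromℚᵘ (mkℚᵘ (+ n) 0)

  ι-* : ∀ m n → ℕtoℚ (m ℕ.* n) ≡ ℕtoℚ m * ℕtoℚ n
  ι-* m n = toℚᵘ-injective (ℚᵘP.≃-trans (raw (m ℕ.* n)) (ℚᵘP.≃-sym (ℚᵘP.≃-trans (toℚᵘ-homo-* (ℕtoℚ m) (ℕtoℚ n))
    (ℚᵘP.≃-trans (ℚᵘP.*-cong (raw m) (raw n)) (*≡* (cong (ℤ._* (+ 1)) (sym (ℤP.pos-* m n))))))))

  ι-+ : ∀ m n → ℕtoℚ (m ℕ.+ n) ≡ ℕtoℚ m + ℕtoℚ n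
  ι-+ m n = toℚᵘ-injective (ℚᵘP.≃-trans (raw (m ℕ.+ n)) (ℚᵘP.≃-sym (ℚᵘP.≃-trans (toℚᵘ-homo-+ (ℕtoℚ m) (ℕtoℚ n))
    (ℚᵘP.≃-trans (ℚᵘP.+-cong (raw m) (raw n)) (*≡* (cong (ℤ._* (+ 1)) (cong₂ ℤ._+_ (ℤP.*-identityʳ (+ m)) (ℤP.*-identityʳ (+ n)))))))))

  ι-mono-≤ : ∀ {m n} → m ℕ.≤ n → ℕtoℚ m ≤ ℕtoℚ n
  ι-mono-≤ {m} {n} le = toℚᵘ-cancel-≤ (ℚᵘP.≤-respˡ-≃ (ℚᵘP.≃-sym (raw m)) (ℚᵘP.≤-respʳ-≃ (ℚᵘP.≃-sym (raw n))
    (*≤* (ℤP.*-monoʳ-≤-nonNeg (+ 1) (ℤ.+≤+ le)))))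

  ι-cancel-≤ : ∀ {m n} → ℕtoℚ m ≤ ℕtoℚ n → m ℕ.≤ n
  ι-cancel-≤ {m} {n} le with ℚᵘP.≤-respˡ-≃ (raw m) (ℚᵘP.≤-respʳ-≃ (raw n) (toℚᵘ-mono-≤ le))
  ... | *≤* p = ℤP.drop‿+≤+ (subst₂ ℤ._≤_ (ℤP.*-identityʳ (+ m)) (ℤP.*-identityʳ (+ n)) p)

  ι-mono-< : ∀ {m n} → m ℕ.< n → ℕtoℚ m < ℕtoℚ n
  ι-mono-< {m} {n} lt = ≰⇒> λ le → ℕP.<⇒≱ lt (ι-cancel-≤ le)

  -- The fraction need not be reduced, so products and sums act directly on numerators and
  -- denominators, and each comparison of rationals becomes one of natural numbers.
  record Fraction (x : ℚ) (m k : ℕ) : Set where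
    constructor frac
    field
      positive-den : 0 ℕ.< k
      cleared      : x * ℕtoℚ k ≡ ℕtoℚ m

  Fraction-/ : ∀ m n → Fraction (+ m / suc n) m (suc n)
  Fraction-/ m n = frac (s≤s z≤n) (toℚᵘ-injective (ℚᵘP.≃-trans (toℚᵘ-homo-* (+ m / suc n) (ℕtoℚ (suc n)))
    (ℚᵘP.≃-trans (ℚᵘP.*-cong (toℚᵘ-fromℚᵘ (mkℚᵘ (+ m) n)) (raw (suc n)))
    (ℚᵘP.≃-trans (*≡* (trans (ℤP.*-identityʳ (+ m ℤ.* + suc n)) (cong (λ z → + m ℤ.* (+ z)) (sym (ℕP.*-identityʳ (suc n)))))) (ℚᵘP.≃-sym (raw m))))))

  Fraction-ℕ : ∀ n → Fraction (ℕtoℚ n) n 1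
  Fraction-ℕ n = Fraction-/ n 0

  private
    interchange : ∀ x y a b → (x * y) * (a * b) ≡ (x * a) * (y * b)
    interchange x y a b = trans (*-assoc x y (a * b)) (trans (cong (x *_)
      (trans (sym (*-assoc y a b)) (trans (cong (_* b) (*-comm y a)) (*-assoc a y b)))) (sym (*-assoc x a (y * b))))

  Fraction-* : ∀ {x y m n k l} → Fraction x m k → Fraction y n l → Fraction (x * y) (m ℕ.* n) (k ℕ.* l)
  Fraction-* {x} {y} {m} {n} {k} {l} (frac pk p) (frac pl q) = frac (ℕP.*-mono-≤ pk pl) (begin
    (x * y) * ℕtoℚ (k ℕ.* l)        ≡⟨ cong ((x * y) *_) (ι-* k l) ⟩
    (x * y) * (ℕtoℚ k * ℕtoℚ l)     ≡⟨ interchange x y (ℕtoℚ k) (ℕtoℚ l) ⟩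
    (x * ℕtoℚ k) * (y * ℕtoℚ l)     ≡⟨ cong₂ _*_ p q ⟩
    ℕtoℚ m * ℕtoℚ n                 ≡⟨ ι-* m n ⟨
    ℕtoℚ (m ℕ.* n)                  ∎)
    where open ≡-Reasoning

  Fraction-+ : ∀ {x y m n k} → Fraction x m k → Fraction y n k → Fraction (x + y) (m ℕ.+ n) k
  Fraction-+ {x} {y} {m} {n} {k} (frac pk p) (frac _ q) = frac pk
    (trans (*-distribʳ-+ (ℕtoℚ k) x y) (trans (cong₂ _+_ p q) (sym (ι-+ m n))))

  Fraction-^ : ∀ {x m k} n → Fraction x m k → Fraction (x ^ℚ n) (m ℕ.^ n) (k ℕ.^ n)
  Fraction-^ zero    p = Fraction-ℕ 1
  Fraction-^ (suc n) p = Fraction-* p (Fraction-^ n p)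

  Fraction-sum : ∀ {A : Set} (g : A → ℕ) k (xs : List A) → Fraction (sumℚ (map (λ x → + g x / suc k) xs)) (∑ xs g) (suc k)
  Fraction-sum g k []       = frac (s≤s z≤n) (*-zeroˡ (ℕtoℚ (suc k)))
  Fraction-sum g k (x ∷ xs) = Fraction-+ (Fraction-/ (g x) k) (Fraction-sum g k xs)

  private
    common : ∀ {x m k} → Fraction x m k → ∀ l → x * ℕtoℚ (k ℕ.* l) ≡ ℕtoℚ (m ℕ.* l)
    common {x} {m} {k} (frac _ p) l = trans (cong (x *_) (ι-* k l)) (trans (sym (*-assoc x (ℕtoℚ k) (ℕtoℚ l))) (trans (cong (_* ℕtoℚ l) p) (sym (ι-* m l))))

    common′ : ∀ {y n l} → Fraction y n l → ∀ k → y * ℕtoℚ (k ℕ.* l) ≡ ℕtoℚ (n ℕ.* k)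
    common′ {y} {n} {l} q k = trans (cong (λ z → y * ℕtoℚ z) (ℕP.*-comm k l)) (common q k)

    ι-pos : ∀ {k} → 0 ℕ.< k → Positive (ℕtoℚ k)
    ι-pos lt = positive (ι-mono-< lt)

  module _ {x y m n k l} (p : Fraction x m k) (q : Fraction y n l) where
    private
      kl>0 : Positive (ℕtoℚ (k ℕ.* l))
      kl>0 = ι-pos (ℕP.*-mono-≤ (Fraction.positive-den p) (Fraction.positive-den q))

    Fraction-≤→ : x ≤ y → m ℕ.* l ℕ.≤ n ℕ.* k
    Fraction-≤→ le = ι-cancel-≤ (subst₂ _≤_ (common p l) (common′ q k)
      (*-monoʳ-≤-nonNeg (ℕtoℚ (k ℕ.* l)) {{pos⇒nonNeg (ℕtoℚ (k ℕ.* l)) {{kl>0}}}} le))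

    Fraction-≤← : m ℕ.* l ℕ.≤ n ℕ.* k → x ≤ y
    Fraction-≤← le = *-cancelʳ-≤-pos (ℕtoℚ (k ℕ.* l)) {{kl>0}} (subst₂ _≤_ (sym (common p l)) (sym (common′ q k)) (ι-mono-≤ le))

    Fraction-<→ : x < y → m ℕ.* l ℕ.< n ℕ.* k
    Fraction-<→ lt = ℕP.≰⇒> λ le → <⇒≱ (subst₂ _<_ (common p l) (common′ q k)
      (*-monoˡ-<-pos (ℕtoℚ (k ℕ.* l)) {{kl>0}} lt)) (ι-mono-≤ le)
      where
      <⇒≱ : ∀ {a b} → a < b → ¬ b ≤ a
      <⇒≱ a<b b≤a = <-irrefl refl (<-≤-trans a<b b≤a)

  as-fraction : ∀ ε → 0ℚ < ε → ∃ λ a → ∃ λ b → 0 ℕ.< a × Fraction ε a b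
  as-fraction ε 0<ε with ε | ↥p/↧p≡p ε | drop-*<* 0<ε
  ... | mkℚ (+ zero)  b c | _  | ℤ.+<+ ()
  ... | mkℚ (+ suc a) b c | eq | _ = suc a , suc b , s≤s z≤n , subst (λ x → Fraction x (suc a) (suc b)) eq (Fraction-/ (suc a) b)
  ... | mkℚ -[1+ a ]  b c | _  | ()

-- From ε to integer parameters.

module Scaling where

  open Constants
  open import Data.Nat
  open import Data.Nat.Properties
  open import Data.Nat.DivMod
  open import Data.Nat.Solver using (module +-*-Solver)
  open import Data.Product using (∃; _×_; _,_)
  open import Relation.Binary.PropositionalEquality
  open ≤-Reasoning
  open +-*-Solver using (solve; _:+_; _:*_; _:=_; con; _:^_)

  private
    ^-distribʳ-* : ∀ k m n → (m * n) ^ k ≡ m ^ k * n ^ k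
    ^-distribʳ-* zero    m n = refl
    ^-distribʳ-* (suc k) m n = trans (cong (m * n *_) (^-distribʳ-* k m n))
      (solve 4 (λ m n x y → m :* n :* (x :* y) := m :* x :* (n :* y)) refl m n (m ^ k) (n ^ k))

    regroup₃ : ∀ c₁ c₂ c₃ c₄ k d e → c₁ * e * (c₂ * ((k * e) * (c₃ * ((k * e) * ((k * e) * (k * e)))))) * (c₄ * ((d * ((k * e) * (k * e))) * ((k * e) * (k * e))))
             ≡ c₁ * c₂ * c₃ * c₄ * k ^ 8 * (d * e ^ 9)
    regroup₃ = solve 7 (λ c₁ c₂ c₃ c₄ k d e → c₁ :* e :* (c₂ :* ((k :* e) :* (c₃ :* ((k :* e) :* ((k :* e) :* (k :* e)))))) :* (c₄ :* ((d :* ((k :* e) :* (k :* e))) :* ((k :* e) :* (k :* e))))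
             := c₁ :* c₂ :* c₃ :* c₄ :* k :^ 8 :* (d :* e :^ 9)) refl

  abstract
    threshold : ℕ
    -- `4 * 12 * 24` belongs to `Θ` and 38 to the lower bound on `u`. `E = 8 * E₀` occurs four times
    -- in `Θ` and four times in `h`; with the separate factor `E₀` of `Θ` this makes the exponent 9.
    threshold = 4 * 12 * 24 * 38 * 8 ^ 8

    threshold-suffices : ∀ d e → 4 * e * (12 * ((8 * e) * (24 * ((8 * e) * ((8 * e) * (8 * e)))))) * (38 * ((d * ((8 * e) * (8 * e))) * ((8 * e) * (8 * e))))
                       ≡ threshold * (d * e ^ 9)
    threshold-suffices = regroup₃ 4 12 24 38 8

  -- With ε = a/b, the integer E₀ replaces 1/ε at the cost of a factor 2.
  module Scale (a b q : ℕ) (0<a : 0 < a) (a≤b : a ≤ b) where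

    private instance
      a≢0 : NonZero a
      a≢0 = >-nonZero 0<a

    E₀ : ℕ
    E₀ = suc (b / a)

    b≤aE₀ : b ≤ a * E₀
    b≤aE₀ = begin
      b                     ≡⟨ m≡m%n+[m/n]*n b a ⟩
      b % a + b / a * a     ≤⟨ +-monoˡ-≤ (b / a * a) (<⇒≤ (m%n<n b a)) ⟩
      a + b / a * a         ≡⟨ *-comm E₀ a ⟩
      a * E₀                ∎

    aE₀≤2b : a * E₀ ≤ 2 * b
    aE₀≤2b = begin
      a * E₀                ≡⟨ *-comm a E₀ ⟩
      a + b / a * a         ≤⟨ +-mono-≤ a≤b (≤-trans (m/n*n≤m b a) (≤-reflexive (sym (+-identityʳ b)))) ⟩
      2 * b                 ∎

    degree-bound : ∀ {t} → a * q ≤ 4 * b * t → q ≤ 4 * E₀ * t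
    degree-bound {t} le = *-cancelˡ-≤ a (begin
      a * q                 ≤⟨ le ⟩
      4 * b * t             ≤⟨ *-monoˡ-≤ t (*-monoʳ-≤ 4 b≤aE₀) ⟩
      4 * (a * E₀) * t      ≡⟨ solve 3 (λ a e t → con 4 :* (a :* e) :* t := a :* (con 4 :* e :* t)) refl a E₀ t ⟩
      a * (4 * E₀ * t)      ∎)

    rich : ∀ {t w} → 4 * E₀ * w < q → a * q ≤ 4 * b * t → suc w ≤ t
    rich {t} {w} lt le = ≰⇒> λ t≤w → <⇒≱ lt (≤-trans (degree-bound le) (*-monoʳ-≤ (4 * E₀) t≤w))

    size-bound : ∀ {w x} → q ≤ 8 * E₀ * w → w * w ≤ 2 * x → (a * q) * (a * q) ≤ 10000 * (b * b) * x
    size-bound {w} {x} le le′ = begin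
      (a * q) * (a * q)                 ≤⟨ *-mono-≤ aq≤ aq≤ ⟩
      (16 * b * w) * (16 * b * w)       ≡⟨ solve 2 (λ b w → (con 16 :* b :* w) :* (con 16 :* b :* w) := (con 256 :* (b :* b)) :* (w :* w)) refl b w ⟩
      (256 * (b * b)) * (w * w)         ≤⟨ *-monoʳ-≤ (256 * (b * b)) le′ ⟩
      (256 * (b * b)) * (2 * x)         ≡⟨ solve 2 (λ b x → (con 256 :* b) :* (con 2 :* x) := (con 512 :* b) :* x) refl (b * b) x ⟩
      -- Here 512 suffices; 10000 is imposed by the case `tiny`, where `S` is a single point.
      512 * (b * b) * x                 ≤⟨ *-monoˡ-≤ x (*-monoˡ-≤ (b * b) (m≤m+n 512 9488)) ⟩
      10000 * (b * b) * x               ∎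
      where
      aq≤ : a * q ≤ 16 * b * w
      aq≤ = begin
        a * q                   ≤⟨ *-monoʳ-≤ a le ⟩
        a * (8 * E₀ * w)        ≡⟨ solve 3 (λ a e w → a :* (con 8 :* e :* w) := con 8 :* (a :* e) :* w) refl a E₀ w ⟩
        8 * (a * E₀) * w        ≤⟨ *-monoˡ-≤ w (*-monoʳ-≤ 8 aE₀≤2b) ⟩
        8 * (2 * b) * w         ≡⟨ cong (_* w) (sym (*-assoc 8 2 b)) ⟩
        16 * b * w              ∎

    module Fit (Θ : ℕ) (0<Θ : 0 < Θ) (q′ : ℕ) (q≡ : q ≡ suc q′) where
      private instance
        Θ≢0 : NonZero Θ
        Θ≢0 = >-nonZero 0<Θ

      -- The largest integer with `Θ * u < q`: the inequality is strict, hence the predecessor of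
      -- `q`.
      u : ℕ
      u = q′ / Θ

      lower : Θ * u < q
      lower = ≤-trans (s≤s (≤-trans (≤-reflexive (*-comm Θ u)) (m/n*n≤m q′ Θ))) (≤-reflexive (sym q≡))

      at-least : ∀ {k} → Θ * k < q → k ≤ u
      at-least {k} lt = ≤-trans (≤-reflexive (sym (m*n/n≡m k Θ))) (/-monoˡ-≤ Θ (≤-trans (≤-reflexive (*-comm k Θ)) (s≤s⁻¹ (≤-trans lt (≤-reflexive q≡)))))

      upper : 0 < u → q ≤ 2 * (Θ * u)
      upper 0<u = begin
        q                               ≡⟨ q≡ ⟩
        suc q′                          ≡⟨ cong suc (m≡m%n+[m/n]*n q′ Θ) ⟩
        suc (q′ % Θ) + u * Θ            ≤⟨ +-monoˡ-≤ (u * Θ) (m%n<n q′ Θ) ⟩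
        Θ + u * Θ                       ≤⟨ +-monoˡ-≤ (u * Θ) (≤-trans (≤-reflexive (sym (*-identityˡ Θ))) (*-monoˡ-≤ Θ 0<u)) ⟩
        u * Θ + u * Θ                   ≡⟨ solve 2 (λ u t → u :* t :+ u :* t := con 2 :* (t :* u)) refl u Θ ⟩
        2 * (Θ * u)                     ∎

    small-w : 100 * b ≤ a * q → ∀ q′ → q ≡ suc q′ → ∃ λ w → 4 * E₀ * w < q × q ≤ 8 * E₀ * w
    small-w large q′ q≡ = u , lower , ≤-trans (upper (at-least enough)) (≤-reflexive (solve 2 (λ e u → con 2 :* ((con 4 :* e) :* u) := con 8 :* e :* u) refl E₀ u))
      where
      open Fit (4 * E₀) (s≤s z≤n) q′ q≡
      enough : 4 * E₀ * 1 < q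
      enough = begin-strict
        4 * E₀ * 1     ≡⟨ *-identityʳ (4 * E₀) ⟩
        4 * E₀         <⟨ *-monoˡ-< E₀ (m≤m+n 5 45) ⟩
        50 * E₀        ≤⟨ *-cancelˡ-≤ a (begin
          a * (50 * E₀)   ≡⟨ solve 2 (λ a e → a :* (con 50 :* e) := con 50 :* (a :* e)) refl a E₀ ⟩
          50 * (a * E₀)   ≤⟨ *-monoʳ-≤ 50 aE₀≤2b ⟩
          50 * (2 * b)    ≡⟨ *-assoc 50 2 b ⟨
          100 * b         ≤⟨ large ⟩
          a * q           ∎) ⟩
        q              ∎

    -- `a * E₀ ≤ 2 * b` is used to the ninth power, and `512 = 2 ^ 9`.
    field-large : ∀ {c d} → 512 * c * d * b ^ 9 < q * a ^ 9 → c * (d * E₀ ^ 9) < q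
    field-large {c} {d} lt = ≰⇒> λ q≤ → <⇒≱ lt (begin
      q * a ^ 9                           ≤⟨ *-monoˡ-≤ (a ^ 9) q≤ ⟩
      c * (d * E₀ ^ 9) * a ^ 9            ≡⟨ regroup₁ c d (E₀ ^ 9) (a ^ 9) ⟩
      c * d * (a ^ 9 * E₀ ^ 9)            ≡⟨ cong (c * d *_) (sym (^-distribʳ-* 9 a E₀)) ⟩
      c * d * (a * E₀) ^ 9                ≤⟨ *-monoʳ-≤ (c * d) (^-monoˡ-≤ 9 aE₀≤2b) ⟩
      c * d * (2 * b) ^ 9                 ≡⟨ cong (c * d *_) (^-distribʳ-* 9 2 b) ⟩
      c * d * (2 ^ 9 * b ^ 9)             ≡⟨ regroup₂ (2 ^ 9) c d (b ^ 9) ⟩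
      512 * c * d * b ^ 9                 ∎)
      where
      regroup₁ : ∀ c d e a → c * (d * e) * a ≡ c * d * (a * e)
      regroup₁ = solve 4 (λ c d e a → c :* (d :* e) :* a := c :* d :* (a :* e)) refl
      regroup₂ : ∀ k c d b → c * d * (k * b) ≡ k * c * d * b
      regroup₂ = solve 4 (λ k c d b → c :* d :* (k :* b) := k :* c :* d :* b) refl

    E : ℕ
    E = 8 * E₀

    module _ {d : ℕ} (0<d : 0 < d) (large : threshold * (d * E₀ ^ 9) < q) (q′ : ℕ) (q≡ : q ≡ suc q′) where
      private
        0<E : 0 < E
        0<E = s≤s z≤n

        Θ : ℕ
        Θ = 4 * E₀ * (12 * (E * (24 * (E * (E * E)))))

        open Fit Θ (s≤s z≤n) q′ q≡
        module N = Parameters d E u q 0<d 0<E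

        Θu≡ : Θ * u ≡ 4 * E₀ * N.w
        Θu≡ = solve 3 (λ e E u → con 4 :* e :* (con 12 :* (E :* (con 24 :* (E :* (E :* E))))) :* u
                               := con 4 :* e :* (con 12 :* (E :* (con 24 :* (E :* ((E :* E) :* u)))))) refl E₀ E u

        Θh≡ : Θ * (38 * N.h) ≡ threshold * (d * E₀ ^ 9)
        Θh≡ = threshold-suffices d E₀

        u-big : 38 * N.h ≤ u
        u-big = at-least (≤-<-trans (≤-reflexive Θh≡) large)

        0<u : 0 < u
        0<u = ≤-trans (*-mono-≤ {1} {38} (s≤s z≤n) (*-mono-≤ (*-mono-≤ 0<d (*-mono-≤ 0<E 0<E)) (*-mono-≤ 0<E 0<E))) u-big

        2Θu≡ : 2 * (Θ * u) ≡ E * N.w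
        2Θu≡ = trans (cong (2 *_) Θu≡) (solve 2 (λ e w → con 2 :* (con 4 :* e :* w) := con 8 :* e :* w) refl E₀ N.w)

      abstract
        large-numbers : Numbers d q
        large-numbers = N.numbers u-big (≤-trans (upper 0<u) (≤-reflexive 2Θu≡))

        large-lower : 4 * E₀ * Numbers.w large-numbers < q
        large-lower = ≤-<-trans (≤-reflexive (sym Θu≡)) lower

        large-upper : q ≤ 8 * E₀ * Numbers.w large-numbers
        large-upper = ≤-trans (upper 0<u) (≤-reflexive 2Θu≡)

-- From the low-degree test to its incidence graph.

module LowDegreeTest (F : FiniteField) where

  open FiniteSums
  open Incidences
  open FieldArithmetic F
  open Polynomials F
  open Bivariate F
  open Constants
  open Geometry F
  open Scaling
  open import Data.Bool using (Bool; T)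
  open import Data.Bool.Properties using (T?)
  open import Data.Nat as ℕ using (ℕ; suc; z≤n; s≤s)
  import Data.Nat.Properties as ℕP
  open import Data.Nat.Solver using (module +-*-Solver)
  open import Data.List using ([]; _∷_; length)
  open import Data.List.Properties using (map-∘)
  open import Data.List.Membership.Propositional using (_∈_)
  open import Data.Vec using ([]; _∷_)
  open import Data.Nat.ListAction using (sum)
  open import Data.Product using (∃; _×_; _,_; proj₁; proj₂)
  open import Data.Empty using (⊥-elim)
  open import Function using (_∘_; flip)
  open import Relation.Nullary using (¬_; Dec; yes; no; does; _×-dec_)
  open import Relation.Binary.PropositionalEquality hiding ([_])

  open FiniteField F renaming (Carrier to C)
  open FF F
  open Solver using (solve; _:+_; _:*_; :-_; _:=_; con)

  T-does⁻ : ∀ {P : Set} (d : Dec P) → T (does d) → P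
  T-does⁻ (yes p) _ = p

  T-does⁺ : ∀ {P : Set} (d : Dec P) → P → T (does d)
  T-does⁺ (yes _) _ = _
  T-does⁺ (no ¬p) p = ⊥-elim (¬p p)

  Deg-evalU : ∀ {d} (p : UPoly d) → Deg d (evalU p)
  Deg-evalU (c ∷ [])         = D.base (c , λ t → trans (cong (c +_) (zeroʳ t)) (+-identityʳ c))
  Deg-evalU (c ∷ p@(_ ∷ _)) = D.step (λ _ → c) (evalU p) (c , λ _ → refl) (Deg-evalU p) (λ _ → refl)

  size-pred : ∃ λ q′ → size ≡ suc q′
  size-pred with elements | complete 0#
  ... | _ ∷ xs | _ = length xs , refl

  module Test {d : ℕ} (f : C × C → C) (P : Line → UPoly d) where

    R : C → C → C → C
    R m b = evalU (P (slope m b))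

    slope? : ∀ x m → Dec (evalU (P (slope m (proj₂ x + - (m * proj₁ x)))) (proj₁ x) ≡ f x)
    slope? x m = evalU (P (slope m (proj₂ x + - (m * proj₁ x)))) (proj₁ x) ≟ f x

    slopes : C × C → ℕ
    slopes x = ∑ elements (λ m → [ slope? x m ])

    goodLines≡ : ∀ x → goodLines P f x ≡ [ evalU (P (vert (proj₁ x))) (proj₂ x) ≟ f x ] ℕ.+ slopes x
    goodLines≡ (x , y) = trans (∑-filter (λ ℓ → evalU (P ℓ) (paramOf ℓ (x , y)) ≟ f (x , y)) (linesThrough (x , y)))
      (cong (λ s → [ evalU (P (vert x)) y ≟ f (x , y) ] ℕ.+ sum s) (sym (map-∘ elements)))

    e₀? : ∀ (x ℓ : C × C) → Dec (proj₂ x ≡ proj₁ ℓ * proj₁ x + proj₂ ℓ × R (proj₁ ℓ) (proj₂ ℓ) (proj₁ x) ≡ f x)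
    e₀? (x , y) (m , b) = (y ≟ (m * x + b)) ×-dec (R m b x ≟ f (x , y))

    e₀ : C × C → C × C → Bool
    e₀ x ℓ = does (e₀? x ℓ)

    -- The 1 pays for the vertical line through the point, which is not a vertex of the graph.
    few-good : ∀ x → goodLines P f x ℕ.≤ suc (deg points e₀ x)
    few-good (x , y) = begin
      goodLines P f (x , y)                                                  ≡⟨ goodLines≡ (x , y) ⟩
      [ evalU (P (vert x)) y ≟ f (x , y) ] ℕ.+ slopes (x , y)                ≤⟨ ℕP.+-mono-≤ ([]≤1 (evalU (P (vert x)) y ≟ f (x , y))) (∑-mono elements row) ⟩
      suc (∑ elements (λ m → ∑ elements (λ b → [ T? (e₀ (x , y) (m , b)) ]))) ≡⟨ cong suc (∑-× (λ ℓ → [ T? (e₀ (x , y) ℓ) ]) elements elements) ⟨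
      suc (deg points e₀ (x , y))                                            ∎
      where
      open ℕP.≤-Reasoning
      row : ∀ m → [ slope? (x , y) m ] ℕ.≤ ∑ elements (λ b → [ T? (e₀ (x , y) (m , b)) ])
      row m = []-≤ (slope? (x , y) m) λ g → ℕP.≤-trans
        (ℕP.≤-reflexive (sym ([]-yes (T? (e₀ (x , y) (m , y + - (m * x)))) (T-does⁺ (e₀? (x , y) (m , y + - (m * x)))
          (solve 2 (λ y c → y := c :+ (y :+ :- c)) refl y (m * x) , g)))))
        (∑-∈ (λ b → [ T? (e₀ (x , y) (m , b)) ]) (complete (y + - (m * x))))

    many-good : ∀ {e} → e ⊑ e₀ → ∀ x → deg points e x ℕ.≤ goodLines P f x
    many-good {e} sub (x , y) = begin
      deg points e (x , y)                                            ≡⟨ ∑-× (λ ℓ → [ T? (e (x , y) ℓ) ]) elements elements ⟩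
      ∑ elements (λ m → ∑ elements (λ b → [ T? (e (x , y) (m , b)) ])) ≤⟨ ∑-mono elements (λ m → count-≤[] (λ b → T? (e (x , y) (m , b))) unique
                                                                          (λ _ _ s t → trans (b≡ s) (sym (b≡ t))) (slope? (x , y) m)
                                                                          (λ _ s → trans (cong (λ b → R m b x) (sym (b≡ s))) (proj₂ (on s)))) ⟩
      slopes (x , y)                                                  ≤⟨ ℕP.m≤n+m _ _ ⟩
      [ evalU (P (vert x)) y ≟ f (x , y) ] ℕ.+ slopes (x , y)         ≡⟨ goodLines≡ (x , y) ⟨
      goodLines P f (x , y)                                           ∎
      where
      open ℕP.≤-Reasoning
      on : ∀ {m b} → T (e (x , y) (m , b)) → y ≡ m * x + b × R m b x ≡ f (x , y)
      on {m} {b} t = T-does⁻ (e₀? (x , y) (m , b)) (sub (x , y) (m , b) t)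
      b≡ : ∀ {m b} → T (e (x , y) (m , b)) → b ≡ y + - (m * x)
      b≡ {m} {b} t = trans (solve 2 (λ c b → b := (c :+ b) :+ :- c) refl (m * x) b) (cong (_+ - (m * x)) (sym (proj₁ (on t))))

    record Outcome (a b : ℕ) : Set where
      field
        Q      : C → C → C
        biQ    : Bi (d ℕ.+ d) Q
        S      : C × C → Bool
        heavy  : ∀ x → T (S x) → a ℕ.* suc size ℕ.≤ 2 ℕ.* b ℕ.* goodLines P f x
        agrees : ∀ x → T (S x) → Q (proj₁ x) (proj₂ x) ≡ f x
        large  : (a ℕ.* size) ℕ.* (a ℕ.* size) ℕ.≤ 10000 ℕ.* (b ℕ.* b) ℕ.* ∑ points (λ x → [ T? (S x) ])

    module _ (a b : ℕ) (0<a : 0 ℕ.< a) (a≤b : a ℕ.≤ b)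
             (pass : a ℕ.* (size ℕ.* size) ℕ.* suc size ℕ.≤ b ℕ.* ∑ points (goodLines P f)) where

      private
        q′ = proj₁ size-pred
        q≡ = proj₂ size-pred

        0<q : 0 ℕ.< size
        0<q = subst (0 ℕ.<_) (sym q≡) (s≤s z≤n)

        W = size ℕ.* size

        0<W : 0 ℕ.< W
        0<W = ℕP.*-mono-≤ 0<q 0<q

      -- With `ε = a / b` the hypothesis says that `ε q` is below 100, so one point outweighs
      -- `ε² q² / 10000`. Averaging finds a point with the required share of good lines, and `Q` is
      -- constant.
      tiny : a ℕ.* size ℕ.< 100 ℕ.* b → Outcome a b
      tiny lt with pigeonhole (λ x → 2 ℕ.* b ℕ.* goodLines P f x) points (a ℕ.* suc size) (begin-strict
          length points ℕ.* (a ℕ.* suc size)                        ≡⟨ cong (ℕ._* (a ℕ.* suc size)) length-points ⟩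
          W ℕ.* (a ℕ.* suc size)                                    ≡⟨ N.solve 3 (λ W a s → W N.:* (a N.:* s) N.:= a N.:* W N.:* s) refl W a (suc size) ⟩
          a ℕ.* W ℕ.* suc size                                      <⟨ ℕP.m<m+n (a ℕ.* W ℕ.* suc size) (ℕP.*-mono-≤ (ℕP.*-mono-≤ 0<a 0<W) (s≤s z≤n)) ⟩
          a ℕ.* W ℕ.* suc size ℕ.+ a ℕ.* W ℕ.* suc size             ≤⟨ ℕP.+-mono-≤ pass pass ⟩
          b ℕ.* total ℕ.+ b ℕ.* total                               ≡⟨ N.solve 2 (λ b t → b N.:* t N.:+ b N.:* t N.:= N.con 2 N.:* b N.:* t) refl b total ⟩
          2 ℕ.* b ℕ.* total                                         ≡⟨ ∑-*ˡ (2 ℕ.* b) (goodLines P f) points ⟨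
          ∑ points (λ x → 2 ℕ.* b ℕ.* goodLines P f x)              ∎)
        where
        open ℕP.≤-Reasoning
        module N = +-*-Solver
        total = ∑ points (goodLines P f)
      ... | x₀ , x₀∈ , big = record
        { Q = λ _ _ → f x₀ ; biQ = wk z≤n (cst (f x₀))
        ; S = λ x → does (x ≟P x₀)
        ; heavy = λ x t → subst (λ x → a ℕ.* suc size ℕ.≤ 2 ℕ.* b ℕ.* goodLines P f x) (sym (T-does⁻ (x ≟P x₀) t)) (ℕP.<⇒≤ big)
        ; agrees = λ x t → cong f (sym (T-does⁻ (x ≟P x₀) t))
        ; large = begin
            (a ℕ.* size) ℕ.* (a ℕ.* size)              ≤⟨ ℕP.*-mono-≤ (ℕP.<⇒≤ lt) (ℕP.<⇒≤ lt) ⟩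
            (100 ℕ.* b) ℕ.* (100 ℕ.* b)                ≡⟨ N.solve 1 (λ b → (N.con 100 N.:* b) N.:* (N.con 100 N.:* b) N.:= N.con 10000 N.:* (b N.:* b) N.:* N.con 1) refl b ⟩
            10000 ℕ.* (b ℕ.* b) ℕ.* 1                  ≤⟨ ℕP.*-monoʳ-≤ (10000 ℕ.* (b ℕ.* b)) (ℕP.≤-trans (ℕP.≤-reflexive (sym ([]-yes (T? (does (x₀ ≟P x₀))) (T-does⁺ (x₀ ≟P x₀) refl))))
                                                            (∑-∈ (λ x → [ T? (does (x ≟P x₀)) ]) x₀∈)) ⟩
            10000 ℕ.* (b ℕ.* b) ℕ.* ∑ points (λ x → [ T? (does (x ≟P x₀)) ]) ∎
        }
        where
        open ℕP.≤-Reasoning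
        module N = +-*-Solver

      module _ (big : 100 ℕ.* b ℕ.≤ a ℕ.* size) where

        private
          α β κ : ℕ
          -- For `ε = a / b`, the core degrees are at least `α / κ = ε (q + 1) / 2` at points,
          -- exactly the share of lines claimed in the theorem, and `β / κ = ε q / 4` on lines.
          α = 2 ℕ.* (a ℕ.* suc size)
          β = a ℕ.* size
          κ = 4 ℕ.* b

          supp≤ : ∀ (e : C × C → C × C → Bool) → supp points points e ℕ.≤ W
          supp≤ e = ℕP.≤-trans (∑-≤-* _ points λ x → ℕP.m⊓n≤m 1 _) (ℕP.≤-reflexive (trans (ℕP.*-identityʳ _) length-points))

          good≤ : ∑ points (goodLines P f) ℕ.≤ W ℕ.+ edges points points e₀
          good≤ = begin
            ∑ points (goodLines P f)                     ≤⟨ ∑-mono points few-good ⟩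
            ∑ points (λ x → 1 ℕ.+ deg points e₀ x)       ≡⟨ ∑-+ points ⟩
            ∑ points (λ _ → 1) ℕ.+ edges points points e₀ ≡⟨ cong (ℕ._+ edges points points e₀) (trans (∑-const 1 points) (trans (ℕP.*-identityʳ _) length-points)) ⟩
            W ℕ.+ edges points points e₀                 ∎
            where open ℕP.≤-Reasoning

          -- Per point of the plane, passing provides `4 a (q + 1)`. Points cost `2 a (q + 1)`,
          -- lines `a q`, and the omitted vertical lines `4 b`, which is at most `a q` by `big`. The
          -- remainder `2 a` makes the inequality strict.
          start : α ℕ.* supp points points e₀ ℕ.+ β ℕ.* supp points points (flip e₀) ℕ.< κ ℕ.* edges points points e₀
          start = ℕP.+-cancelˡ-< (κ ℕ.* W) _ _ (begin-strict
            κ ℕ.* W ℕ.+ (α ℕ.* supp points points e₀ ℕ.+ β ℕ.* supp points points (flip e₀))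
              ≤⟨ ℕP.+-monoʳ-≤ (κ ℕ.* W) (ℕP.+-mono-≤ (ℕP.*-monoʳ-≤ α (supp≤ e₀)) (ℕP.*-monoʳ-≤ β (supp≤ (flip e₀)))) ⟩
            κ ℕ.* W ℕ.+ (α ℕ.* W ℕ.+ β ℕ.* W)
              ≡⟨ N.solve 4 (λ k a b w → k N.:* w N.:+ (a N.:* w N.:+ b N.:* w) N.:= w N.:* (k N.:+ (a N.:+ b))) refl κ α β W ⟩
            W ℕ.* (κ ℕ.+ (α ℕ.+ β))
              <⟨ ℕP.*-monoʳ-< W {{ℕ.>-nonZero 0<W}} (begin-strict
                   κ ℕ.+ (α ℕ.+ β)                       ≤⟨ ℕP.+-monoˡ-≤ (α ℕ.+ β) (ℕP.≤-trans (ℕP.*-monoˡ-≤ b (ℕP.m≤m+n 4 96)) big) ⟩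
                   β ℕ.+ (α ℕ.+ β)                       <⟨ ℕP.m<m+n (β ℕ.+ (α ℕ.+ β)) (ℕP.*-mono-≤ {1} {2} (s≤s z≤n) 0<a) ⟩
                   β ℕ.+ (α ℕ.+ β) ℕ.+ 2 ℕ.* a           ≡⟨ N.solve 2 (λ a s → a N.:* s N.:+ (N.con 2 N.:* (a N.:* (N.con 1 N.:+ s)) N.:+ a N.:* s) N.:+ N.con 2 N.:* a
                                                              N.:= N.con 4 N.:* (a N.:* (N.con 1 N.:+ s))) refl a size ⟩
                   4 ℕ.* (a ℕ.* suc size)                ∎) ⟩
            W ℕ.* (4 ℕ.* (a ℕ.* suc size))
              ≡⟨ N.solve 3 (λ a w s → w N.:* (N.con 4 N.:* (a N.:* s)) N.:= N.con 4 N.:* (a N.:* w N.:* s)) refl a W (suc size) ⟩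
            4 ℕ.* (a ℕ.* W ℕ.* suc size)
              ≤⟨ ℕP.*-monoʳ-≤ 4 pass ⟩
            4 ℕ.* (b ℕ.* ∑ points (goodLines P f))
              ≤⟨ ℕP.*-monoʳ-≤ 4 (ℕP.*-monoʳ-≤ b good≤) ⟩
            4 ℕ.* (b ℕ.* (W ℕ.+ edges points points e₀))
              ≡⟨ N.solve 3 (λ b w e → N.con 4 N.:* (b N.:* (w N.:+ e)) N.:= N.con 4 N.:* b N.:* w N.:+ N.con 4 N.:* b N.:* e) refl b W (edges points points e₀) ⟩
            κ ℕ.* W ℕ.+ κ ℕ.* edges points points e₀ ∎)
            where
            open ℕP.≤-Reasoning
            module N = +-*-Solver

        module FromCore (e : C × C → C × C → Bool) (sub : e ⊑ e₀)
            (dense : ∀ x ℓ → T (e x ℓ) → α ℕ.≤ κ ℕ.* deg points e x × β ℕ.≤ κ ℕ.* deg points (flip e) ℓ)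
            {x₀ ℓ₀} (t₀ : T (e x₀ ℓ₀)) where

          open Scale a b size 0<a a≤b

          sound : ∀ {x y m b} → T (e (x , y) (m , b)) → y ≡ m * x + b × R m b x ≡ f (x , y)
          sound {x} {y} {m} {b} t = T-does⁻ (e₀? (x , y) (m , b)) (sub (x , y) (m , b) t)

          rich-point : ∀ {w} → 4 ℕ.* E₀ ℕ.* w ℕ.< size → ∀ {x ℓ} → T (e x ℓ) → suc w ℕ.≤ deg points e x
          rich-point lt {x} {ℓ} t = rich lt (ℕP.≤-trans (ℕP.≤-trans (ℕP.*-monoʳ-≤ a (ℕP.n≤1+n size)) (ℕP.m≤m+n (a ℕ.* suc size) (a ℕ.* suc size ℕ.+ 0))) (proj₁ (dense x ℓ t)))

          rich-line : ∀ {w} → 4 ℕ.* E₀ ℕ.* w ℕ.< size → ∀ {x ℓ} → T (e x ℓ) → suc w ℕ.≤ deg points (flip e) ℓ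
          rich-line lt {x} {ℓ} t = rich lt (proj₂ (dense x ℓ t))

          outcome : ∀ {w} (lt : 4 ℕ.* E₀ ℕ.* w ℕ.< size) → size ℕ.≤ 8 ℕ.* E₀ ℕ.* w →
            Plane.Agreement d f R (λ m b → Deg-evalU (P (slope m b))) e sound w (rich-point lt) (rich-line lt) → Outcome a b
          outcome {w} lt le (Q , biQ , enough) = record
            { Q = Q ; biQ = biQ ; S = λ x → does (agree? Q x)
            ; heavy = λ x t → let (ℓ , s) = point-edge (proj₁ (T-does⁻ (agree? Q x) t)) in
                ℕP.*-cancelˡ-≤ 2 (ℕP.≤-trans (ℕP.≤-trans (proj₁ (dense x ℓ s)) (ℕP.*-monoʳ-≤ κ (many-good sub x)))
                  (ℕP.≤-reflexive (N.solve 2 (λ b g → N.con 4 N.:* b N.:* g N.:= N.con 2 N.:* (N.con 2 N.:* b N.:* g)) refl b (goodLines P f x))))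
            ; agrees = λ x t → proj₂ (T-does⁻ (agree? Q x) t)
            ; large = size-bound {w} le (ℕP.≤-trans enough (ℕP.*-monoʳ-≤ 2 (∑-mono points λ x → []-mono (agree? Q x) (T? (does (agree? Q x))) (T-does⁺ (agree? Q x)))))
            }
            where
            module N = +-*-Solver
            open Plane d f R (λ m b → Deg-evalU (P (slope m b))) e sound w (rich-point lt) (rich-line lt)

          constant-outcome : d ≡ 0 → Outcome a b
          constant-outcome d≡0 = let (w , lt , le) = small-w big q′ q≡ in
            outcome lt le (Plane.constant-agreement d f R (λ m b → Deg-evalU (P (slope m b))) e sound w (rich-point lt) (rich-line lt) d≡0 t₀)

          large-outcome : 0 ℕ.< d → threshold ℕ.* (d ℕ.* E₀ ℕ.^ 9) ℕ.< size → Outcome a b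
          large-outcome 0<d big-field = outcome {Numbers.w (large-numbers 0<d big-field q′ q≡)} lt (large-upper 0<d big-field q′ q≡)
            (Large.agreement d (large-numbers 0<d big-field q′ q≡) f R (λ m b → Deg-evalU (P (slope m b))) e sound (rich-point lt) (rich-line lt) t₀)
            where
            lt = large-lower 0<d big-field q′ q≡

        ample : 512 ℕ.* threshold ℕ.* d ℕ.* b ℕ.^ 9 ℕ.< size ℕ.* a ℕ.^ 9 → Outcome a b
        ample field-big = let (e , sub , dense , (x₀ , ℓ₀ , t₀)) = core _≟P_ _≟P_ points points points-unique points-unique points-complete points-complete α β κ e₀ start in
          finish e sub dense t₀ (d ℕ.≟ 0)
          where
          finish : ∀ e (sub : e ⊑ e₀) (dense : ∀ x ℓ → T (e x ℓ) → α ℕ.≤ κ ℕ.* deg points e x × β ℕ.≤ κ ℕ.* deg points (flip e) ℓ)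
            {x₀ ℓ₀} (t₀ : T (e x₀ ℓ₀)) → Dec (d ≡ 0) → Outcome a b
          finish e sub dense t₀ (yes d≡0) = FromCore.constant-outcome e sub dense t₀ d≡0
          finish e sub dense t₀ (no d≢0)  = FromCore.large-outcome e sub dense t₀ (ℕP.n≢0⇒n>0 d≢0) (Scale.field-large a b size 0<a a≤b {threshold} {d} field-big)

      low-degree-test : 512 ℕ.* threshold ℕ.* d ℕ.* b ℕ.^ 9 ℕ.< size ℕ.* a ℕ.^ 9 → Outcome a b
      low-degree-test field-big with a ℕ.* size ℕ.<? 100 ℕ.* b
      ... | yes lt = tiny lt
      ... | no ge  = ample (ℕP.≮⇒≥ ge) field-big

-- The polynomial z - Q, its weighted degree and its discriminant.

module MonicPolynomials (F : FiniteField) where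

  open FieldArithmetic F
  open Polynomials F
  open Bivariate F
  open RootExtraction F
  open import Data.Nat as ℕ using (ℕ; zero; suc; z≤n; _⊔_)
  import Data.Nat.Properties as ℕP
  open import Data.Bool using (if_then_else_)
  open import Data.List using (List; []; _∷_; map)
  open import Data.List.Relation.Unary.All using ([]; _∷_)
  open import Data.Product using (∃; _×_; _,_)
  open import Data.Empty using (⊥-elim)
  open import Function using (_∘_)
  open import Relation.Nullary using (¬_; yes; no; does)
  open import Relation.Binary.PropositionalEquality hiding ([_])

  open FiniteField F renaming (Carrier to C)
  open FF F

  coefficients : {A : Set} → ℕ → (ℕ → A) → List A
  coefficients zero    c = c 0 ∷ []
  coefficients (suc N) c = c 0 ∷ coefficients N (c ∘ suc)

  map-coefficients : ∀ {A B : Set} (h : A → B) N c → map h (coefficients N c) ≡ coefficients N (h ∘ c)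
  map-coefficients h zero    c = refl
  map-coefficients h (suc N) c = cong (h (c 0) ∷_) (map-coefficients h N (c ∘ suc))

  horner-coefficients : ∀ N c t → horner (coefficients N c) t ≡ pev N c t
  horner-coefficients zero    c t = trans (cong (c 0 +_) (zeroʳ t)) (+-identityʳ (c 0))
  horner-coefficients (suc N) c t = cong (λ z → c 0 + t * z) (horner-coefficients N (c ∘ suc) t)

  wdeg1-bound : ∀ base N c j → wdeg1 base j (coefficients N c) ℕ.≤ base ℕ.+ (j ℕ.+ N)
  wdeg1-bound base N c j = go N c j
    where
    top : ∀ x {n} j → j ℕ.≤ n → (if does (x ≟ 0#) then 0 else base ℕ.+ j) ℕ.≤ base ℕ.+ n
    top x j le with x ≟ 0#
    ... | yes _ = z≤n
    ... | no _  = ℕP.+-monoʳ-≤ base le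
    go : ∀ N c j → wdeg1 base j (coefficients N c) ℕ.≤ base ℕ.+ (j ℕ.+ N)
    go zero    c j = ℕP.⊔-lub (top (c 0) j (ℕP.m≤m+n j 0)) z≤n
    go (suc N) c j = ℕP.⊔-lub (top (c 0) j (ℕP.m≤m+n j (suc N)))
      (ℕP.≤-trans (go N (c ∘ suc) (suc j)) (ℕP.≤-reflexive (cong (base ℕ.+_) (sym (ℕP.+-suc j N)))))

  wdeg2-bound : ∀ base M N (c : ℕ → ℕ → C) i → wdeg2 base i (coefficients M (coefficients N ∘ c)) ℕ.≤ (base ℕ.+ (i ℕ.+ M)) ℕ.+ N
  wdeg2-bound base zero    N c i = ℕP.⊔-lub (ℕP.≤-trans (wdeg1-bound (base ℕ.+ i) N (c 0) 0) (ℕP.+-monoˡ-≤ N (ℕP.+-monoʳ-≤ base (ℕP.m≤m+n i 0)))) z≤n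
  wdeg2-bound base (suc M) N c i = ℕP.⊔-lub
    (ℕP.≤-trans (wdeg1-bound (base ℕ.+ i) N (c 0) 0) (ℕP.+-monoˡ-≤ N (ℕP.+-monoʳ-≤ base (ℕP.m≤m+n i (suc M)))))
    (ℕP.≤-trans (wdeg2-bound base M N (c ∘ suc) (suc i)) (ℕP.≤-reflexive (cong (λ z → base ℕ.+ z ℕ.+ N) (sym (ℕP.+-suc i M)))))

  monic : Poly2 → Poly3
  monic B₀ = B₀ ∷ one2 ∷ []

  monic-nonzero : ∀ B₀ → ¬ IsZero3 (monic B₀)
  monic-nonzero B₀ (_ ∷ ((z ∷ []) ∷ []) ∷ []) = 0≢1 (sym z)

  monic-hasse : ∀ B₀ → ¬ IsZero3 (hasseZ (monic B₀))
  monic-hasse B₀ (((z ∷ []) ∷ []) ∷ []) = 0≢1 (sym (trans (sym (trans (*-identityʳ _) (+-identityʳ 1#))) z))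

  -- The degrees in `z` are 1 and 0, so the Sylvester matrix has a single entry, the derivative 1.
  monic-disc : ∀ B₀ → ¬ IsZero2 (DiscZ (monic B₀))
  -- `stripZ` tests the leading coefficients, so both decisions must be settled before `degZ` and
  -- the determinant compute.
  monic-disc B₀ with 1# ≟ 0# | ((1# + 0#) * 1#) ≟ 0#
  ... | yes z | _     = ⊥-elim (0≢1 (sym z))
  ... | no _  | yes z = ⊥-elim (0≢1 (sym (trans (sym (trans (*-identityʳ _) (+-identityʳ 1#))) z)))
  ... | no _  | no nz = λ { ((z ∷ _) ∷ _) → nz (trans (sym (trans (+-identityʳ _) (*-identityʳ _))) z) }

  monic-eval : ∀ B₀ a b z → eval3 (monic B₀) a b z ≡ eval2 B₀ a b + z
  monic-eval B₀ a b z = cong (eval2 B₀ a b +_) (trans (cong (λ u → z * u) (trans (cong₂ _+_ one (zeroʳ z)) (+-identityʳ 1#))) (*-identityʳ z))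
    where
    one : eval2 one2 a b ≡ 1#
    one = trans (cong₂ _+_ (trans (cong (1# +_) (zeroʳ b)) (+-identityʳ 1#)) (zeroʳ a)) (+-identityʳ 1#)

  -- The monomial `z` has weight `d`, hence the hypothesis on `d`.
  monic-wdeg : ∀ d M N c → d ℕ.≤ M ℕ.+ N → deg₁₁ d (monic (coefficients M (coefficients N ∘ c))) ℕ.≤ M ℕ.+ N
  monic-wdeg d M N c le = ℕP.⊔-lub (ℕP.≤-trans (wdeg2-bound (d ℕ.* 0) M N c 0) (ℕP.≤-reflexive (cong (λ z → z ℕ.+ M ℕ.+ N) (ℕP.*-zeroʳ d))))
    (ℕP.⊔-lub (ℕP.≤-trans (wdeg2-bound (d ℕ.* 1) 0 0 (λ _ _ → 1#) 0) (ℕP.≤-trans (ℕP.≤-reflexive (trans (ℕP.+-identityʳ _) (trans (ℕP.+-identityʳ _) (ℕP.*-identityʳ d)))) le)) z≤n)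

  -- The coefficients are read off in a box of side `N`, which turns total degree `N` into the bound
  -- `N + N`.
  vanishing-polynomial : ∀ {d N Q} → d ℕ.≤ N ℕ.+ N → Bi N Q → ∃ λ B₀ →
    deg₁₁ d (monic B₀) ℕ.≤ N ℕ.+ N × (∀ a b z → z ≡ Q a b → eval3 (monic B₀) a b z ≡ 0#)
  vanishing-polynomial {d} {N} {Q} le biQ with Bi⇒pev (BiF.neg {g = λ (x , y) → Q x y} biQ)
  ... | c , c≡ = coefficients N (coefficients N ∘ c) , monic-wdeg d N N c le , λ a b z e → begin
    eval3 (monic (coefficients N (coefficients N ∘ c))) a b z       ≡⟨ monic-eval (coefficients N (coefficients N ∘ c)) a b z ⟩
    eval2 (coefficients N (coefficients N ∘ c)) a b + z             ≡⟨ cong₂ _+_ (value a b) e ⟩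
    - Q a b + Q a b                                                 ≡⟨ -‿inverseˡ _ ⟩
    0#                                                              ∎
    where
    open ≡-Reasoning
    value : ∀ a b → eval2 (coefficients N (coefficients N ∘ c)) a b ≡ - Q a b
    value a b = begin
      horner (map (λ p → horner p b) (coefficients N (coefficients N ∘ c))) a  ≡⟨ cong (λ l → horner l a) (map-coefficients (λ p → horner p b) N (coefficients N ∘ c)) ⟩
      horner (coefficients N (λ i → horner (coefficients N (c i)) b)) a        ≡⟨ horner-coefficients N (λ i → horner (coefficients N (c i)) b) a ⟩
      pev N (λ i → horner (coefficients N (c i)) b) a                          ≡⟨ pev-cong N a (λ i _ → horner-coefficients N (c i) b) ⟩
      pev N (λ i → pev N (c i) b) a                                            ≡⟨ c≡ a b ⟨
      - Q a b                                                                  ∎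

-- Conclusion: the bounds in terms of ε.

open FiniteSums
open Fractions
open Scaling
open import Data.Nat using (ℕ; suc)
import Data.Nat as ℕ
import Data.Nat.Properties as ℕP
open import Data.Nat.Solver using (module +-*-Solver)
open import Data.Bool using (T)
open import Data.Bool.Properties using (T?)
open import Data.Integer using (+_)
open import Data.List using (filterᵇ)
open import Data.List.Relation.Unary.All as All using (All)
open import Data.List.Relation.Unary.All.Properties using (all-filter)
open import Data.Rational using (ℚ; _≤_; _<_; _*_; _/_; 0ℚ; 1ℚ)
import Data.Rational.Properties as ℚP
open import Data.Product using (Σ; _×_; _,_)
open import Relation.Nullary using (¬_)
open import Relation.Nullary.Decidable using (from-yes)
open import Relation.Binary.PropositionalEquality using (_≡_; refl; sym; trans; cong; subst)

private
  module Conclude (ε : ℚ) (ε≤1 : ε ≤ 1ℚ) (a b : ℕ) (0<a : 0 ℕ.< a) (ε≡ : Fraction ε a b)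
                  (d : ℕ) (F : FiniteField)
                  (f : FF.Point F → FiniteField.Carrier F) (P : FF.Line F → FF.UPoly F d) where

    open FF F
    open LowDegreeTest.Test F f P

    a≤b : a ℕ.≤ b
    a≤b = ℕP.≤-trans (ℕP.≤-reflexive (sym (ℕP.*-identityʳ a))) (ℕP.≤-trans (Fraction-≤→ ε≡ (Fraction-ℕ 1) ε≤1) (ℕP.≤-reflexive (ℕP.*-identityˡ b)))

    field-size : ∀ c → ℕtoℚ (c ℕ.* d) < ℕtoℚ size * (ε ^ℚ 9) → c ℕ.* d ℕ.* b ℕ.^ 9 ℕ.< size ℕ.* a ℕ.^ 9
    field-size c lt = ℕP.≤-<-trans (ℕP.≤-reflexive (cong (c ℕ.* d ℕ.*_) (sym (ℕP.*-identityˡ (b ℕ.^ 9)))))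
      (ℕP.<-≤-trans (Fraction-<→ (Fraction-ℕ (c ℕ.* d)) (Fraction-* (Fraction-ℕ size) (Fraction-^ 9 ε≡)) lt) (ℕP.≤-reflexive (ℕP.*-identityʳ _)))

    passes : PassesLDT P f ε → a ℕ.* (size ℕ.* size) ℕ.* suc size ℕ.≤ b ℕ.* ∑ points (goodLines P f)
    passes le = ℕP.≤-trans (Fraction-≤→ (Fraction-* ε≡ (Fraction-ℕ (size ℕ.* size))) (Fraction-sum (goodLines P f) size points) le)
      (ℕP.≤-reflexive (trans (ℕP.*-comm (∑ points (goodLines P f)) (b ℕ.* 1)) (cong (ℕ._* ∑ points (goodLines P f)) (ℕP.*-identityʳ b))))

    -- The construction gives a bound by `4 d`; since `ε ≤ 1` this is at most `4 d / ε²`.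
    degree-bound : ∀ {n} → n ℕ.≤ 4 ℕ.* d → ℕtoℚ n * (ε ^ℚ 2) ≤ ℕtoℚ 4 * ℕtoℚ d
    degree-bound {n} le = Fraction-≤← (Fraction-* (Fraction-ℕ n) (Fraction-^ 2 ε≡)) (Fraction-* (Fraction-ℕ 4) (Fraction-ℕ d))
      (ℕP.≤-trans (ℕP.≤-reflexive (ℕP.*-identityʳ _)) (ℕP.*-mono-≤ le (ℕP.≤-trans (ℕP.^-monoˡ-≤ 2 a≤b) (ℕP.≤-reflexive (sym (ℕP.*-identityˡ (b ℕ.^ 2)))))))

    module _ (o : Outcome a b) where
      open Outcome o

      count : ∑ points (λ x → [ T? (S x) ]) ≡ card S
      count = sym (∑-filter (λ x → T? (S x)) points)

      large′ : (a ℕ.* size) ℕ.* (a ℕ.* size) ℕ.≤ 10000 ℕ.* (b ℕ.* b) ℕ.* card S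
      large′ = subst (λ n → (a ℕ.* size) ℕ.* (a ℕ.* size) ℕ.≤ 10000 ℕ.* (b ℕ.* b) ℕ.* n) count large

      size-bound : (+ 1 / 10000) * (ε ^ℚ 2) * ℕtoℚ (size ℕ.* size) ≤ ℕtoℚ (card S)
      size-bound = Fraction-≤← (Fraction-* (Fraction-* (Fraction-/ 1 9999) (Fraction-^ 2 ε≡)) (Fraction-ℕ (size ℕ.* size))) (Fraction-ℕ (card S)) (begin
        1 ℕ.* a ℕ.^ 2 ℕ.* (size ℕ.* size) ℕ.* 1               ≡⟨ solve 2 (λ a s → con 1 :* a :^ 2 :* (s :* s) :* con 1 := (a :* s) :* (a :* s)) refl a size ⟩
        (a ℕ.* size) ℕ.* (a ℕ.* size)                         ≤⟨ large′ ⟩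
        10000 ℕ.* (b ℕ.* b) ℕ.* card S                        ≡⟨ regroup 10000 b (card S) ⟩
        card S ℕ.* (10000 ℕ.* b ℕ.^ 2 ℕ.* 1)                  ∎)
        where
        open ℕP.≤-Reasoning
        open +-*-Solver
        regroup : ∀ c b s → c ℕ.* (b ℕ.* b) ℕ.* s ≡ s ℕ.* (c ℕ.* b ℕ.^ 2 ℕ.* 1)
        regroup = solve 3 (λ c b s → c :* (b :* b) :* s := s :* (c :* b :^ 2 :* con 1)) refl

      inside : ℕ
      inside = ∑ (filterᵇ S points) (goodLines P f)

      inside-large : card S ℕ.* (a ℕ.* suc size) ℕ.≤ 2 ℕ.* b ℕ.* inside
      inside-large = begin
        card S ℕ.* (a ℕ.* suc size)                              ≡⟨ ∑-const (a ℕ.* suc size) (filterᵇ S points) ⟨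
        ∑ (filterᵇ S points) (λ _ → a ℕ.* suc size)              ≤⟨ ∑-mono-∈ (filterᵇ S points) (λ {x} x∈ → heavy x (All.lookup (all-filter (λ x → T? (S x)) points) x∈)) ⟩
        ∑ (filterᵇ S points) (λ x → 2 ℕ.* b ℕ.* goodLines P f x) ≡⟨ ∑-*ˡ (2 ℕ.* b) (goodLines P f) (filterᵇ S points) ⟩
        2 ℕ.* b ℕ.* inside                                       ∎
        where open ℕP.≤-Reasoning

      -- `S` has at least `ε² q² / 10000` points, and each contributes at least `ε / 2`.
      sum-bound : (+ 1 / 20000) * (ε ^ℚ 3) * ℕtoℚ (size ℕ.* size) ≤ sumOver S (epsAt P f)
      sum-bound = Fraction-≤← (Fraction-* (Fraction-* (Fraction-/ 1 19999) (Fraction-^ 3 ε≡)) (Fraction-ℕ (size ℕ.* size)))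
        (Fraction-sum (goodLines P f) size (filterᵇ S points)) (begin
        1 ℕ.* a ℕ.^ 3 ℕ.* (size ℕ.* size) ℕ.* suc size                   ≡⟨ solve 3 (λ a s t → con 1 :* a :^ 3 :* (s :* s) :* t := (a :* s) :* (a :* s) :* (a :* t)) refl a size (suc size) ⟩
        (a ℕ.* size) ℕ.* (a ℕ.* size) ℕ.* (a ℕ.* suc size)               ≤⟨ ℕP.*-monoˡ-≤ (a ℕ.* suc size) large′ ⟩
        10000 ℕ.* (b ℕ.* b) ℕ.* card S ℕ.* (a ℕ.* suc size)              ≡⟨ ℕP.*-assoc (10000 ℕ.* (b ℕ.* b)) (card S) (a ℕ.* suc size) ⟩
        10000 ℕ.* (b ℕ.* b) ℕ.* (card S ℕ.* (a ℕ.* suc size))            ≤⟨ ℕP.*-monoʳ-≤ (10000 ℕ.* (b ℕ.* b)) inside-large ⟩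
        10000 ℕ.* (b ℕ.* b) ℕ.* (2 ℕ.* b ℕ.* inside)                     ≡⟨ regroup 10000 2 b inside ⟩
        inside ℕ.* (10000 ℕ.* 2 ℕ.* b ℕ.^ 3 ℕ.* 1)                       ∎)
        where
        open ℕP.≤-Reasoning
        open +-*-Solver
        regroup : ∀ c k b s → c ℕ.* (b ℕ.* b) ℕ.* (k ℕ.* b ℕ.* s) ≡ s ℕ.* (c ℕ.* k ℕ.* b ℕ.^ 3 ℕ.* 1)
        regroup = solve 4 (λ c k b s → c :* (b :* b) :* (k :* b :* s) := s :* (c :* k :* b :^ 3 :* con 1)) refl

      heavy-point : ∀ x → T (S x) → ε * (+ 1 / 2) ≤ epsAt P f x
      heavy-point x t = Fraction-≤← (Fraction-* ε≡ (Fraction-/ 1 1)) (Fraction-/ (goodLines P f x) size) (begin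
        a ℕ.* 1 ℕ.* suc size                  ≡⟨ cong (ℕ._* suc size) (ℕP.*-identityʳ a) ⟩
        a ℕ.* suc size                        ≤⟨ heavy x t ⟩
        2 ℕ.* b ℕ.* goodLines P f x           ≡⟨ solve 2 (λ b g → con 2 :* b :* g := g :* (b :* con 2)) refl b (goodLines P f x) ⟩
        goodLines P f x ℕ.* (b ℕ.* 2)         ∎)
        where
        open ℕP.≤-Reasoning
        open +-*-Solver

theorem4p3 : Σ ℕ λ c₁ → Σ ℕ λ c₂ →
    Σ ℚ λ C-deg → Σ ℚ λ C-size → Σ ℚ λ C-sum →
    (0ℚ < C-deg) × (0ℚ < C-size) × (0ℚ < C-sum) ×
    ( (ε : ℚ) → 0ℚ < ε → ε ≤ 1ℚ → (d : ℕ) → (F : FiniteField) →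
    ℕtoℚ (c₁ Data.Nat.* d) < ℕtoℚ (FF.size F) * (ε ^ℚ c₂) →
    (f : FF.Point F → FiniteField.Carrier F) →
    (P : FF.Line F → FF.UPoly F d) →
    (∀ ℓ → FF.IsBestFit F d f ℓ (P ℓ)) →
    FF.PassesLDT F P f ε →
    Σ (FF.Poly3 F) λ A → Σ (FF.Subset F) λ S →
    (¬ FF.IsZero3 F A)
    × (ℕtoℚ (FF.deg₁₁ F d A) * (ε ^ℚ 2) ≤ C-deg * ℕtoℚ d)
    × (C-size * (ε ^ℚ 2) * ℕtoℚ (FF.size F Data.Nat.* FF.size F) ≤ ℕtoℚ (FF.card F S))
    × (C-sum * (ε ^ℚ 3) * ℕtoℚ (FF.size F Data.Nat.* FF.size F) ≤ FF.sumOver F S (FF.epsAt F P f))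
    × (∀ a b → T (S (a , b)) → ε * (+ 1 / 2) ≤ FF.epsAt F P f (a , b))
    × (∀ a b → T (S (a , b)) → FF.eval3 F A a b (f (a , b)) ≡ FiniteField.0# F)
    × (¬ FF.IsZero3 F (FF.hasseZ F A))
    × (¬ FF.IsZero2 F (FF.DiscZ F A)) )
-- The degree constant 4 is for `Q` of total degree at most `2 d`, whose box of coefficients has
-- weight at most `4 d`. 10000 is the square of the 100 at which the single-point case ends, and
-- 20000 is its double because `ε_x` is at least `ε / 2` on `S`.
theorem4p3 = 512 ℕ.* threshold , 9 , ℕtoℚ 4 , + 1 / 10000 , + 1 / 20000 ,
  from-yes (0ℚ ℚP.<? ℕtoℚ 4) , from-yes (0ℚ ℚP.<? (+ 1 / 10000)) , from-yes (0ℚ ℚP.<? (+ 1 / 20000)) ,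
  λ ε 0<ε ε≤1 d F large f P _ pass →
    let (a , b , 0<a , ε≡)   = as-fraction ε 0<ε
        module K = Conclude ε ε≤1 a b 0<a ε≡ d F f P
        o = LowDegreeTest.Test.low-degree-test F f P a b 0<a K.a≤b (K.passes pass) (K.field-size (512 ℕ.* threshold) large)
        module O = LowDegreeTest.Test.Outcome o
        (B₀ , deg≤ , root)   = MonicPolynomials.vanishing-polynomial F (ℕP.≤-trans (ℕP.m≤m+n d d) (ℕP.m≤m+n (d ℕ.+ d) (d ℕ.+ d))) O.biQ
    in MonicPolynomials.monic F B₀ , O.S , MonicPolynomials.monic-nonzero F B₀ ,
       K.degree-bound (ℕP.≤-trans deg≤ (ℕP.≤-reflexive (+-*-Solver.solve 1 (λ d → (d +-*-Solver.:+ d) +-*-Solver.:+ (d +-*-Solver.:+ d) +-*-Solver.:= +-*-Solver.con 4 +-*-Solver.:* d) refl d))) ,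
       K.size-bound o , K.sum-bound o , (λ x y → K.heavy-point o (x , y)) ,
       (λ x y t → root x y (f (x , y)) (sym (O.agrees (x , y) t))) ,
       MonicPolynomials.monic-hasse F B₀ , MonicPolynomials.monic-disc F B₀
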